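{- For all integers $k\ge 3$ and $k/2<\ell<k$ such that $(k-\ell)\nmid k$, there exists $\Delta>0$ such that the following holds for all sufficiently large $n\in(k-\ell)\mathbb{N}$, where $s=\lceil \frac{k}{k-\ell}\rceil$. Suppose that $\mathcal{H}=(V,E)$ is an $n$-vertex $k$-graph. If $\mathcal{H}$ is $\Delta$-extremal and either \begin{itemize} \item $k/2<\ell<3k/4$ and $\delta_{k-1}(\mathcal{H})\ge \frac{n}{s(k-\ell)}$, or \item $k/2<\ell<k$ and $\delta_{k-1}(\mathcal{H})\ge \frac{n}{s(k-\ell)}+\frac{k^2}{2}$, \end{itemize} then $\mathcal{H}$ contains a Hamilton $\ell$-cycle.
   Context: A $k$-graph ($k$-uniform hypergraph) $\mathcal{H}=(V,E)$ has a finite vertex set $V$ and edge set $E\subseteq\binom{V}{k}$. For a $(k-1)$-set $S\subseteq V$, $\deg_{\mathcal{H}}(S)$ is the number of vertices $v\in V\setminus S$ with $S\cup\{v\}\in E$, and the minimum co-degree $\delta_{k-1}(\mathcal{H})$ is the minimum of $\deg_{\mathcal{H}}(S)$ over all $(k-1)$-sets $S\subseteq V$. For $B\subseteq V$, $e(B)$ is the number of edges of $\mathcal{H}$ contained in $B$. For $\Delta>0$ (and given $k,\ell$, $s=\lceil \frac{k}{k-\ell}\rceil$), an $n$-vertex $k$-graph $\mathcal{H}$ is called $\Delta$-extremal if there is a set $B\subseteq V(\mathcal{H})$ such that $|B|=\left\lfloor\left(1-\frac{1}{s(k-\ell)}\right)n\right\rfloor$ and $e(B)\le \Delta n^k$.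 A $k$-graph is a ($k$-uniform) $\ell$-cycle if there is a cyclic ordering of its vertices such that every edge consists of $k$ consecutive vertices and two consecutive edges share exactly $\ell$ vertices. $\mathcal{H}$ contains a Hamilton $\ell$-cycle if it contains an $\ell$-cycle as a spanning subhypergraph. -}

module Defs where

open import Data.Fin.Base as Fin using (Fin; toℕ)
open import Data.Fin.Properties using (nonZeroIndex)
open import Data.Fin.Subset
  using (Subset; inside; outside; ⁅_⁆; _∪_; _∩_; ⋃; _∈_; ∣_∣)
open import Data.Fin.Subset.Properties using (_∈?_; _⊆?_)
import Data.Integer.Base as ℤ
open import Data.List.Base using (List; []; _∷_; _++_; map; filter; length; allFin; upTo)
import Data.List.Extrema.Nat as Extrema
open import Data.Nat.Base
  using (ℕ; zero; suc; _+_; _*_; _∸_; _^_; _<_; s≤s; z≤n; NonZero;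
         ≢-nonZero; >-nonZero; >-nonZero⁻¹)
open import Data.Nat.DivMod using (_/_; _mod_; m≥n⇒m/n>0)
open import Data.Nat.Properties
  using (_≟_; m>n⇒m∸n≢0; m*n≢0; ≤-trans; ≤-reflexive; +-monoˡ-≤; m+[n∸m]≡n)
open import Data.Product.Base using (Σ-syntax; ∃-syntax; _×_)
open import Data.Rational.Base as ℚ using (ℚ; 1ℚ; floor)
open import Data.Vec.Base using ([]; _∷_)
open import Function.Bundles using (_⇔_; _⤖_; module Bijection)
open import Level using (0ℓ)
open import Relation.Binary.PropositionalEquality.Core using (_≡_; sym)
open import Relation.Nullary.Decidable using (_×-dec_; ¬?)
open import Relation.Unary using (Pred; Decidable)

-- k-graphs on the vertex set Fin n.
record Hypergraph (k n : ℕ) : Set₁ where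
  field
    Edge    : Pred (Subset n) 0ℓ
    edge?   : Decidable Edge
    uniform : ∀ {S} → Edge S → ∣ S ∣ ≡ k

open Hypergraph public

subsets : ∀ n → List (Subset n)
subsets zero    = [] ∷ []
subsets (suc n) = map (outside ∷_) (subsets n) ++ map (inside ∷_) (subsets n)

deg : ∀ {k n} → Hypergraph k n → Subset n → ℕ
deg {n = n} H S =
  length (filter (λ v → ¬? (v ∈? S) ×-dec edge? H (S ∪ ⁅ v ⁆)) (allFin n))

-- The first argument n of min is only its value on the empty list: every degree
-- is at most n, so it does not affect the minimum once (k-1)-sets exist (k-1 ≤ n).
minCodegree : ∀ {k n} → Hypergraph k n → ℕ
minCodegree {k} {n} H =
  Extrema.min n (map (deg H) (filter (λ S → ∣ S ∣ ≟ k ∸ 1) (subsets n)))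

e : ∀ {k n} → Hypergraph k n → Subset n → ℕ
e {n = n} H B = length (filter (λ S → edge? H S ×-dec (S ⊆? B)) (subsets n))

⌈_/_⌉ : (m d : ℕ) .{{_ : NonZero d}} → ℕ
⌈ m / d ⌉ = (m + (d ∸ 1)) / d

fromℕ : ℕ → ℚ
fromℕ m = (ℤ.+ m) ℚ./ 1

module Parameters {k ℓ : ℕ} (ℓ<k : ℓ < k) where

  private instance
    k∸ℓ≢0 : NonZero (k ∸ ℓ)
    k∸ℓ≢0 = ≢-nonZero (m>n⇒m∸n≢0 ℓ<k)

  s : ℕ
  s = ⌈ k / k ∸ ℓ ⌉

  s≢0 : NonZero s
  s≢0 = >-nonZero (m≥n⇒m/n>0 (≤-trans
    (≤-reflexive (sym (m+[n∸m]≡n (>-nonZero⁻¹ (k ∸ ℓ)))))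
    (+-monoˡ-≤ (k ∸ ℓ ∸ 1) (≤-trans (s≤s z≤n) ℓ<k))))

  private instance
    s[k∸ℓ]≢0 : NonZero (s * (k ∸ ℓ))
    s[k∸ℓ]≢0 = m*n≢0 s (k ∸ ℓ) {{s≢0}}

  infix 8 _/s[k-ℓ]
  _/s[k-ℓ] : ℕ → ℚ
  m /s[k-ℓ] = (ℤ.+ m) ℚ./ (s * (k ∸ ℓ))

  Extremal : ℚ → ∀ {n} → Hypergraph k n → Set
  Extremal Δ {n} H = Σ[ B ∈ Subset n ]
    (ℤ.+ ∣ B ∣ ≡ floor ((1ℚ ℚ.- 1 /s[k-ℓ]) ℚ.* fromℕ n)) ×
    (fromℕ (e H B) ℚ.≤ Δ ℚ.* fromℕ (n ^ k))

infixl 6 _⊕_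
_⊕_ : ∀ {n} → Fin n → ℕ → Fin n
i ⊕ j = (toℕ i + j) mod _
  where instance _ = nonZeroIndex i

-- The k consecutive vertices occupying positions a, a+1, …, a+k-1 (modulo n) of
-- the cyclic ordering.
consecutive : ∀ {n} → ℕ → (Fin n ⤖ Fin n) → Fin n → Subset n
consecutive k ordering a =
  ⋃ (map (λ j → ⁅ Bijection.to ordering (a ⊕ j) ⁆) (upTo k))

-- The edges are listed in the cyclic order of their starting positions, so the
-- consecutive pairs are those with indices i and i+1 modulo the number of edges.
-- As usual a cycle has no isolated vertices; without this the hypergraph with no
-- edges, and one with just two edges sharing ℓ vertices, would be ℓ-cycles.
record IsCycle {k n : ℕ} (ℓ : ℕ) (C : Hypergraph k n) : Set where
  field
    ordering   : Fin n ⤖ Fin n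
    edgeCount  : ℕ
    start      : Fin edgeCount → Fin n
    increasing : ∀ {i j} → i Fin.< j → start i Fin.< start j
    edges      : ∀ S → Edge C S ⇔ (∃[ i ] S ≡ consecutive k ordering (start i))
    meet       : ∀ i → ∣ consecutive k ordering (start i)
                       ∩ consecutive k ordering (start (i ⊕ 1)) ∣ ≡ ℓ
    covering   : ∀ v → ∃[ S ] Edge C S × v ∈ S

HasHamiltonCycle : ∀ {k n} → ℕ → Hypergraph k n → Set₁
HasHamiltonCycle {k} {n} ℓ H =
  Σ[ C ∈ Hypergraph k n ] IsCycle ℓ C × (∀ S → Edge C S → Edge H S)

-- The edges are studied through words (lists of vertices). A word T is nice if few continuations of T by vertices of B are
-- edges, the threshold κ decreasing rapidly with the length of T; averaging shows that a nice word extends generically by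
-- vertices of B to a nice word, so any two nice words can be joined. Let A′ be the set of vertices that are not nice.
-- The Hamilton cycle is built from a cyclic sequence of the nice vertices, all of whose intervals shorter than k are nice.
-- With d = k − ℓ and s = ⌈k / d⌉, a vertex of A′ inserted at the head of its block of d vertices covers s consecutive edges and
-- one inserted at its end covers s − 1, the slack which lets the number of edges be exactly n / d. If |A′| < |V ∖ B|, the
-- codegree condition forces edges inside B; s of them replace each missing vertex, a minimal non-nice part of such an edge
-- being completed by generic vertices so that its proper intervals are nice.
-- The vertices of A′ whose link misses many words of B come first, each through a dense cube in its link (Cauchy–Schwarz). Short nice chunks
-- then use up almost all remaining vertices, the few left over are inserted into distinct chunks, and the rest of A′
-- is assigned to the remaining units by exchanging partners, since few pairs are incompatible.

module Submission where

open import Data.Bool.Base using (true; false)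
open import Data.Empty using (⊥-elim)
open import Data.Fin.Base as Fin using (Fin; toℕ; fromℕ<; cast)
open import Data.List.Base using (List; []; _∷_; [_]; _++_; map; filter; length; allFin; upTo; applyUpTo; take; drop; replicate; lookup)
open import Data.List.Properties using (length-++; ++-assoc; ++-identityʳ; length-map; length-take; length-drop; take++drop≡id; map-++; map-tabulate; length-tabulate; length-upTo; drop-drop; take-[]; take-all; drop-all; take-take; map-upTo; length-applyUpTo; map-∘; drop-[]; ∷-injectiveʳ; ∷-injectiveˡ)
open import Data.List.Relation.Unary.All as All using (All; []; _∷_; all?)
open import Data.List.Relation.Unary.Any as Any using (Any; here; there; any?)
open import Data.List.Relation.Unary.AllPairs using ([]; _∷_)
open import Data.List.Relation.Unary.Unique.Propositional using (Unique)
open import Data.List.Membership.Propositional using (_∈_; _∉_; find; lose)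
open import Data.List.Relation.Binary.Permutation.Propositional using (_↭_; ↭-refl; ↭-sym; ↭-trans; prep; swap; ↭-reflexive; ↭⇒↭ₛ)
open import Data.Nat.Base hiding (_/_; _%_)
open import Data.Nat.Properties
open import Data.Product.Base using (Σ-syntax; ∃-syntax; _×_; _,_; proj₁; proj₂)
open import Data.Sum.Base using (_⊎_; inj₁; inj₂) renaming ([_,_]′ to either)
open import Function.Base using (_∘_; id; _$_)
open import Relation.Binary.PropositionalEquality using (_≡_; _≢_; refl; sym; trans; cong; cong₂; subst; subst₂; module ≡-Reasoning)
open import Relation.Nullary using (Dec; yes; no; ¬_; contradiction)
open import Relation.Nullary.Decidable using (_×-dec_; _⊎-dec_; ¬?; decidable-stable)
open import Data.Nat.Tactic.RingSolver using (solve-∀)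
open import Data.List.Relation.Unary.All.Properties as Allₚ using (¬Any⇒All¬)
open import Relation.Binary.Definitions using (DecidableEquality)
open import Defs
open import Data.Fin.Subset as Sub using (Subset; outside; ⁅_⁆; _∪_; ⋃; ∣_∣; _∩_)
open import Data.Fin.Subset.Properties as Subₚ using (x∈⁅x⁆; x∈⁅y⁆⇒x≡y; x∈p∪q⁺; x∈p∪q⁻; ∪-comm; ∉⊥; x∈p∩q⁺; x∈p∩q⁻)
open import Data.Fin.Properties as Finₚ using (toℕ-injective; toℕ-fromℕ<; toℕ<n; toℕ-cast)
open import Data.List.Membership.Propositional.Properties using (∈-allFin; ∈-++⁺ˡ; ∈-++⁺ʳ; ∈-map⁺; ∈-filter⁺; ∈-upTo⁺; ∈-upTo⁻; ∈-++⁻; ∈-∃++; ∈-lookup; ∈-applyUpTo⁺; ∈-applyUpTo⁻; ∈-filter⁻)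
open import Data.List.Relation.Unary.Unique.Propositional.Properties as Uniqₚ using (allFin⁺)
open import Data.List.Relation.Binary.Permutation.Propositional.Properties as Permₚ using (Any-resp-↭; ↭-length; ++⁺ʳ; ++-comm; All-resp-↭; shift; ++⁺ˡ; ↭-map-inv; ∈-resp-↭; ++⁺; shifts)
open import Data.Vec.Properties using (≡-dec)
import Data.Bool.Properties as Boolₚ
import Data.Vec.Base as Vec
open import Data.List.Extrema.Nat using (min≤xs)
import Data.List.Relation.Binary.Permutation.Setoid.Properties as PermSetoid
open import Relation.Binary.PropositionalEquality.Properties using () renaming (setoid to ≡-setoid)
open import Data.Nat.DivMod using (_%_; _/_; _mod_; m%n<n; m<n⇒m%n≡m; [m+n]%n≡m%n; m≡m%n+[m/n]*n; n%n≡0; m<n*o⇒m/o<n; m*n/n≡m; m<n⇒m/n≡0; +-distrib-/-∣ʳ)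
open import Data.Nat.Divisibility using (_∣_; divides; ∣⇒≤; _∤_; divides-refl; m%n≡0⇒n∣m)
open import Function.Bundles using (_⤖_; mk⤖; mk⇔)
open import Function.Consequences.Propositional using (strictlySurjective⇒surjective)
open import Data.Unit.Base using (⊤; tt)
open import Data.List.Membership.Propositional.Properties.WithK using (unique∧set⇒bag)
open import Data.List.Relation.Binary.BagAndSetEquality using (∼bag⇒↭)
import Data.Integer.Tactic.RingSolver as ℤ-Solver
import Data.Integer.Base as ℤ
import Data.Integer.Properties as ℤₚ
import Data.Integer.DivMod as ℤ-DivMod
open import Data.Rational.Base as ℚ using (ℚ; mkℚ; 0ℚ; 1ℚ; toℚᵘ; floor)
import Data.Rational.Properties as ℚₚ
open import Data.Rational.Unnormalised.Base as ℚᵘ using (ℚᵘ; mkℚᵘ)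
import Data.Rational.Unnormalised.Properties as ℚᵘₚ

open import Algebra.Properties.CommutativeSemigroup *-commutativeSemigroup using (x∙yz≈y∙xz; interchange)

χ : ∀ {a} {P : Set a} → Dec P → ℕ
χ (yes _) = 1
χ (no _)  = 0

χ-yes : ∀ {a} {P : Set a} (d : Dec P) → P → χ d ≡ 1
χ-yes (yes _) _ = refl
χ-yes (no ¬p) p = contradiction p ¬p

χ-no : ∀ {a} {P : Set a} (d : Dec P) → ¬ P → χ d ≡ 0
χ-no (yes p) ¬p = contradiction p ¬p
χ-no (no _)  _  = refl

χ≤1 : ∀ {a} {P : Set a} (d : Dec P) → χ d ≤ 1
χ≤1 (yes _) = ≤-refl
χ≤1 (no _)  = z≤n

χ-pos : ∀ {a} {P : Set a} (d : Dec P) → 0 < χ d → P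
χ-pos (yes p) _ = p

χ-zero : ∀ {a} {P : Set a} (d : Dec P) → χ d ≡ 0 → ¬ P
χ-zero (no ¬p) _ = ¬p

χ-mono : ∀ {a b} {P : Set a} {Q : Set b} (d : Dec P) (d′ : Dec Q) → (P → Q) → χ d ≤ χ d′
χ-mono (yes p) d′ f = ≤-reflexive (sym (χ-yes d′ (f p)))
χ-mono (no _)  d′ f = z≤n

χ-⊎ : ∀ {a b c} {P : Set a} {Q : Set b} {R : Set c} (d : Dec P) (d₁ : Dec Q) (d₂ : Dec R) →
      (P → Q ⊎ R) → χ d ≤ χ d₁ + χ d₂
χ-⊎ (no _) d₁ d₂ f = z≤n
χ-⊎ (yes p) d₁ d₂ f with f p
... | inj₁ q = ≤-trans (≤-reflexive (sym (χ-yes d₁ q))) (m≤m+n _ _)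
... | inj₂ r = ≤-trans (≤-reflexive (sym (χ-yes d₂ r))) (m≤n+m _ (χ d₁))

χ-× : ∀ {a b c} {P : Set a} {Q : Set b} {R : Set c} (d : Dec P) (d₁ : Dec Q) (d₂ : Dec R) →
      (P → Q × R) → (Q → R → P) → χ d ≡ χ d₁ * χ d₂
χ-× d (yes q) (yes r) f g = χ-yes d (g q r)
χ-× d (yes q) (no ¬r) f g = χ-no d (λ p → ¬r (proj₂ (f p)))
χ-× d (no ¬q) d₂      f g = χ-no d (λ p → ¬q (proj₁ (f p)))

χ-≤ : ∀ {a} {P : Set a} (d : Dec P) {x y} → (P → x ≤ y) → x * χ d ≤ y
χ-≤ (yes p) {x} f = ≤-trans (≤-reflexive (*-identityʳ x)) (f p)
χ-≤ (no _) {x} f = ≤-trans (≤-reflexive (*-zeroʳ x)) z≤n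

module _ {a} {A : Set a} where

  ∑ : List A → (A → ℕ) → ℕ
  ∑ []       f = 0
  ∑ (x ∷ xs) f = f x + ∑ xs f

  ∑-mono∈ : ∀ xs {f g} → (∀ x → x ∈ xs → f x ≤ g x) → ∑ xs f ≤ ∑ xs g
  ∑-mono∈ []       h = z≤n
  ∑-mono∈ (x ∷ xs) h = +-mono-≤ (h x (here refl)) (∑-mono∈ xs (λ y y∈ → h y (there y∈)))

  ∑-mono : ∀ xs {f g} → (∀ x → f x ≤ g x) → ∑ xs f ≤ ∑ xs g
  ∑-mono xs h = ∑-mono∈ xs (λ x _ → h x)

  ∑-cong : ∀ xs {f g} → (∀ x → f x ≡ g x) → ∑ xs f ≡ ∑ xs g
  ∑-cong []       h = refl
  ∑-cong (x ∷ xs) h = cong₂ _+_ (h x) (∑-cong xs h)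

  ∑-+ : ∀ xs f g → ∑ xs (λ x → f x + g x) ≡ ∑ xs f + ∑ xs g
  ∑-+ []       f g = refl
  ∑-+ (x ∷ xs) f g rewrite ∑-+ xs f g = arith (f x) (g x) (∑ xs f) (∑ xs g)
    where
    arith : ∀ a b c d → a + b + (c + d) ≡ a + c + (b + d)
    arith = solve-∀

  ∑-* : ∀ c xs f → ∑ xs (λ x → c * f x) ≡ c * ∑ xs f
  ∑-* c []       f = sym (*-zeroʳ c)
  ∑-* c (x ∷ xs) f = trans (cong (c * f x +_) (∑-* c xs f)) (sym (*-distribˡ-+ c (f x) (∑ xs f)))

  ∑-const : ∀ xs c → ∑ xs (λ _ → c) ≡ length xs * c
  ∑-const []       c = refl
  ∑-const (x ∷ xs) c = cong (c +_) (∑-const xs c)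

  ∑-zero : ∀ xs → ∑ xs (λ _ → 0) ≡ 0
  ∑-zero xs = trans (∑-const xs 0) (*-zeroʳ (length xs))

  ∑-++ : ∀ xs ys f → ∑ (xs ++ ys) f ≡ ∑ xs f + ∑ ys f
  ∑-++ []       ys f = refl
  ∑-++ (x ∷ xs) ys f = trans (cong (f x +_) (∑-++ xs ys f)) (sym (+-assoc (f x) _ _))

  ∑-∈ : ∀ {xs x} f → x ∈ xs → f x ≤ ∑ xs f
  ∑-∈ {xs = x ∷ xs} f (here refl) = m≤m+n (f x) _
  ∑-∈ {xs = x ∷ xs} f (there x∈) = ≤-trans (∑-∈ f x∈) (m≤n+m _ (f x))

  ∑-≡0 : ∀ {xs x} f → ∑ xs f ≡ 0 → x ∈ xs → f x ≡ 0
  ∑-≡0 f h x∈ = n≤0⇒n≡0 (≤-trans (∑-∈ f x∈) (≤-reflexive h))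

  ∑-∃ : ∀ xs f g → ∑ xs f < ∑ xs g → ∃[ x ] x ∈ xs × f x < g x
  ∑-∃ (x ∷ xs) f g h with f x <? g x
  ... | yes p = x , here refl , p
  ... | no ¬p with ∑-∃ xs f g (+-cancelˡ-< (f x) _ _ (<-≤-trans h (+-monoˡ-≤ _ (≮⇒≥ ¬p))))
  ... | y , y∈ , q = y , there y∈ , q

  ∑-↭ : ∀ {xs ys} f → xs ↭ ys → ∑ xs f ≡ ∑ ys f
  ∑-↭ f _↭_.refl = refl
  ∑-↭ f (prep x p) = cong (f x +_) (∑-↭ f p)
  ∑-↭ f (swap {xs} {ys} x y p) rewrite ∑-↭ f p =
    trans (sym (+-assoc (f x) (f y) _)) (trans (cong (_+ ∑ ys f) (+-comm (f x) (f y))) (+-assoc (f y) (f x) _))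
  ∑-↭ f (_↭_.trans p q) = trans (∑-↭ f p) (∑-↭ f q)

  ∑-filter : ∀ {p} {P : A → Set p} (P? : ∀ x → Dec (P x)) xs f →
             ∑ (filter P? xs) f ≡ ∑ xs (λ x → χ (P? x) * f x)
  ∑-filter P? [] f = refl
  ∑-filter P? (x ∷ xs) f with P? x
  ... | yes _ = cong₂ _+_ (sym (+-identityʳ (f x))) (∑-filter P? xs f)
  ... | no _  = ∑-filter P? xs f

  length-filter : ∀ {p} {P : A → Set p} (P? : ∀ x → Dec (P x)) xs →
                  length (filter P? xs) ≡ ∑ xs (λ x → χ (P? x))
  length-filter P? [] = refl
  length-filter P? (x ∷ xs) with P? x
  ... | yes _ = cong suc (length-filter P? xs)
  ... | no _  = length-filter P? xs

  ∑-length : ∀ xs → ∑ xs (λ _ → 1) ≡ length xs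
  ∑-length xs = trans (∑-const xs 1) (*-identityʳ _)

module _ {a b} {A : Set a} {B : Set b} where

  ∑-swap : ∀ (xs : List A) (ys : List B) (f : A → B → ℕ) →
           ∑ xs (λ x → ∑ ys (f x)) ≡ ∑ ys (λ y → ∑ xs (λ x → f x y))
  ∑-swap []       ys f = sym (∑-zero ys)
  ∑-swap (x ∷ xs) ys f = trans (cong (∑ ys (f x) +_) (∑-swap xs ys f)) (sym (∑-+ ys (f x) _))

  ∑-map : ∀ (g : A → B) xs f → ∑ (map g xs) f ≡ ∑ xs (f ∘ g)
  ∑-map g [] f = refl
  ∑-map g (x ∷ xs) f = cong (f (g x) +_) (∑-map g xs f)

2xy≤ : ∀ x y → 2 * (x * y) ≤ x * x + y * y
2xy≤ zero y = z≤n
2xy≤ (suc x) zero rewrite *-zeroʳ x = z≤n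
2xy≤ (suc x) (suc y) = ≤-trans (≤-reflexive (l x y)) (≤-trans (+-monoˡ-≤ (2 + 2 * x + 2 * y) (2xy≤ x y)) (≤-reflexive (r x y)))
  where
  l : ∀ x y → 2 * (suc x * suc y) ≡ 2 * (x * y) + (2 + 2 * x + 2 * y)
  l = solve-∀
  r : ∀ x y → x * x + y * y + (2 + 2 * x + 2 * y) ≡ suc x * suc x + suc y * suc y
  r = solve-∀

module _ {a} {A : Set a} where

  cauchy-schwarz : ∀ (xs : List A) f → ∑ xs f * ∑ xs f ≤ length xs * ∑ xs (λ x → f x * f x)
  cauchy-schwarz [] f = z≤n
  cauchy-schwarz (x ∷ xs) f = begin
    (f x + S) * (f x + S)                       ≡⟨ l (f x) S ⟩
    f x * f x + (2 * (f x * S) + S * S)         ≤⟨ +-monoʳ-≤ (f x * f x) (+-mono-≤ cross (cauchy-schwarz xs f)) ⟩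
    f x * f x + ((length xs * (f x * f x) + S₂) + length xs * S₂) ≡⟨ r (f x) (length xs) S₂ ⟩
    suc (length xs) * (f x * f x + S₂)          ∎
    where
    open ≤-Reasoning
    S = ∑ xs f
    S₂ = ∑ xs (λ y → f y * f y)
    l : ∀ a b → (a + b) * (a + b) ≡ a * a + (2 * (a * b) + b * b)
    l = solve-∀
    r : ∀ a n s → a * a + ((n * (a * a) + s) + n * s) ≡ suc n * (a * a + s)
    r = solve-∀
    cross : 2 * (f x * S) ≤ length xs * (f x * f x) + S₂
    cross = begin
      2 * (f x * S)                                  ≡⟨ trans (sym (*-assoc 2 (f x) S)) (trans (sym (∑-* (2 * f x) xs f)) (∑-cong xs (λ y → *-assoc 2 (f x) (f y)))) ⟩
      ∑ xs (λ y → 2 * (f x * f y))                   ≤⟨ ∑-mono xs (λ y → 2xy≤ (f x) (f y)) ⟩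
      ∑ xs (λ y → f x * f x + f y * f y)             ≡⟨ ∑-+ xs _ _ ⟩
      ∑ xs (λ _ → f x * f x) + S₂                    ≡⟨ cong (_+ S₂) (∑-const xs _) ⟩
      length xs * (f x * f x) + S₂                   ∎

take-++ : ∀ {a} {A : Set a} (xs ys : List A) {m} → length xs ≡ m → take m (xs ++ ys) ≡ xs
take-++ []       ys refl = refl
take-++ (x ∷ xs) ys refl = cong (x ∷_) (take-++ xs ys refl)

drop-++ : ∀ {a} {A : Set a} (xs ys : List A) {m} → length xs ≡ m → drop m (xs ++ ys) ≡ ys
drop-++ []       ys refl = refl
drop-++ (x ∷ xs) ys refl = drop-++ xs ys refl

cubeConst : ℕ → ℕ → ℕ
cubeConst zero    K = K
cubeConst (suc r) K = 2 * (K * K) * cubeConst r (2 * (K * K))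

module Counting {A : Set} (V : List A) (n : ℕ) (|V|≡n : length V ≡ n) where

  ∑V-const : ∀ c → ∑ V (λ _ → c) ≡ n * c
  ∑V-const c = trans (∑-const V c) (cong (_* c) |V|≡n)

  ΣW : ℕ → (List A → ℕ) → ℕ
  ΣW zero    f = f []
  ΣW (suc N) f = ∑ V (λ x → ΣW N (λ l → f (x ∷ l)))

  ΣW-mono : ∀ N {f g} → (∀ l → length l ≡ N → f l ≤ g l) → ΣW N f ≤ ΣW N g
  ΣW-mono zero    h = h [] refl
  ΣW-mono (suc N) h = ∑-mono V (λ x → ΣW-mono N (λ l e → h (x ∷ l) (cong suc e)))

  ΣW-cong : ∀ N {f g} → (∀ l → length l ≡ N → f l ≡ g l) → ΣW N f ≡ ΣW N g
  ΣW-cong zero    h = h [] refl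
  ΣW-cong (suc N) h = ∑-cong V (λ x → ΣW-cong N (λ l e → h (x ∷ l) (cong suc e)))

  ΣW-+ : ∀ N f g → ΣW N (λ l → f l + g l) ≡ ΣW N f + ΣW N g
  ΣW-+ zero    f g = refl
  ΣW-+ (suc N) f g = trans (∑-cong V (λ x → ΣW-+ N _ _)) (∑-+ V _ _)

  ΣW-* : ∀ N c f → ΣW N (λ l → c * f l) ≡ c * ΣW N f
  ΣW-* zero    c f = refl
  ΣW-* (suc N) c f = trans (∑-cong V (λ x → ΣW-* N c _)) (∑-* c V _)

  ΣW-const : ∀ N c → ΣW N (λ _ → c) ≡ n ^ N * c
  ΣW-const zero    c = sym (*-identityˡ c)
  ΣW-const (suc N) c = trans (∑-cong V (λ _ → ΣW-const N c)) (trans (∑V-const _) (sym (*-assoc n (n ^ N) c)))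

  ΣW-zero : ∀ N → ΣW N (λ _ → 0) ≡ 0
  ΣW-zero N = trans (ΣW-const N 0) (*-zeroʳ (n ^ N))

  ΣW-≤-const : ∀ N {f c} → (∀ l → length l ≡ N → f l ≤ c) → ΣW N f ≤ n ^ N * c
  ΣW-≤-const N h = ≤-trans (ΣW-mono N h) (≤-reflexive (ΣW-const N _))

  ΣW-++ : ∀ a b f → ΣW (a + b) f ≡ ΣW a (λ xs → ΣW b (λ ys → f (xs ++ ys)))
  ΣW-++ zero    b f = refl
  ΣW-++ (suc a) b f = ∑-cong V (λ x → ΣW-++ a b (λ l → f (x ∷ l)))

  ΣW-∑ : ∀ {b} {B : Set b} N (ys : List B) (f : List A → B → ℕ) →
         ΣW N (λ l → ∑ ys (f l)) ≡ ∑ ys (λ y → ΣW N (λ l → f l y))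
  ΣW-∑ zero    ys f = refl
  ΣW-∑ (suc N) ys f = trans (∑-cong V (λ x → ΣW-∑ N ys (λ l → f (x ∷ l)))) (∑-swap V ys _)

  ΣW-∃ : ∀ N f g → ΣW N f < ΣW N g → ∃[ l ] length l ≡ N × f l < g l
  ΣW-∃ zero    f g h = [] , refl , h
  ΣW-∃ (suc N) f g h with ∑-∃ V _ _ h
  ... | x , _ , h′ with ΣW-∃ N _ _ h′
  ... | l , e , h″ = x ∷ l , cong suc e , h″

  record Small (q c N : ℕ) (f : List A → ℕ) : Set where
    constructor small
    field bound : q * ΣW N f ≤ c * n ^ N

  small-mono : ∀ {q c N f g} → (∀ l → length l ≡ N → f l ≤ g l) → Small q c N g → Small q c N f
  small-mono {q} {N = N} h (small s) = small (≤-trans (*-monoʳ-≤ q (ΣW-mono N h)) s)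

  small-+ : ∀ {q c c′ N f g} → Small q c N f → Small q c′ N g → Small q (c + c′) N (λ l → f l + g l)
  small-+ {q} {c} {c′} {N} {f} {g} (small s) (small t) = small $ begin
    q * ΣW N (λ l → f l + g l)        ≡⟨ cong (q *_) (ΣW-+ N f g) ⟩
    q * (ΣW N f + ΣW N g)             ≡⟨ *-distribˡ-+ q _ _ ⟩
    q * ΣW N f + q * ΣW N g           ≤⟨ +-mono-≤ s t ⟩
    c * n ^ N + c′ * n ^ N            ≡⟨ *-distribʳ-+ (n ^ N) c c′ ⟨
    (c + c′) * n ^ N                  ∎
    where open ≤-Reasoning

  small-∑ : ∀ {b} {B : Set b} {q c N} (ys : List B) {f : B → List A → ℕ} →
            (∀ y → y ∈ ys → Small q c N (f y)) → Small q (length ys * c) N (λ l → ∑ ys (λ y → f y l))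
  small-∑ {q = q} {N = N} [] h = small (≤-reflexive (trans (cong (q *_) (ΣW-zero N)) (*-zeroʳ q)))
  small-∑ {q = q} {c} {N} (y ∷ ys) {f} h =
    small-+ (h y (here refl)) (small-∑ ys (λ z z∈ → h z (there z∈)))

  ΣW-pick : ∀ i j c f → ΣW (i + (j + c)) (λ l → f (take j (drop i l))) ≡ n ^ i * (n ^ c * ΣW j f)
  ΣW-pick i j c f = begin
    ΣW (i + (j + c)) (λ l → f (take j (drop i l)))
      ≡⟨ ΣW-++ i (j + c) _ ⟩
    ΣW i (λ xs → ΣW (j + c) (λ l → f (take j (drop i (xs ++ l)))))
      ≡⟨ ΣW-cong i (λ xs e → trans (ΣW-cong (j + c) (λ l _ → cong (f ∘ take j) (drop-++ xs l e))) (ΣW-++ j c _)) ⟩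
    ΣW i (λ _ → ΣW j (λ ys → ΣW c (λ zs → f (take j (ys ++ zs)))))
      ≡⟨ ΣW-const i _ ⟩
    n ^ i * ΣW j (λ ys → ΣW c (λ zs → f (take j (ys ++ zs))))
      ≡⟨ cong (n ^ i *_) (ΣW-cong j (λ ys e → trans (ΣW-cong c (λ zs _ → cong f (take-++ ys zs e))) (ΣW-const c _))) ⟩
    n ^ i * ΣW j (λ ys → n ^ c * f ys)
      ≡⟨ cong (n ^ i *_) (ΣW-* j (n ^ c) f) ⟩
    n ^ i * (n ^ c * ΣW j f) ∎
    where open ≡-Reasoning

  small-pick : ∀ {q c N} i j {f} → i + j ≤ N → Small q c j f → Small q c N (λ l → f (take j (drop i l)))
  small-pick {q} {c} {N} i j {f} h (small s) with m≤n⇒∃[o]m+o≡n h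
  ... | o , refl rewrite +-assoc i j o = small $ begin
    q * ΣW (i + (j + o)) (λ l → f (take j (drop i l))) ≡⟨ cong (q *_) (ΣW-pick i j o f) ⟩
    q * (n ^ i * (n ^ o * ΣW j f))    ≡⟨ l q (n ^ i) (n ^ o) (ΣW j f) ⟩
    n ^ i * n ^ o * (q * ΣW j f)      ≤⟨ *-monoʳ-≤ (n ^ i * n ^ o) s ⟩
    n ^ i * n ^ o * (c * n ^ j)       ≡⟨ r (n ^ i) (n ^ o) c (n ^ j) ⟩
    c * (n ^ i * (n ^ j * n ^ o))     ≡⟨ cong (λ z → c * (n ^ i * z)) (^-distribˡ-+-* n j o) ⟨
    c * (n ^ i * n ^ (j + o))         ≡⟨ cong (c *_) (^-distribˡ-+-* n i (j + o)) ⟨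
    c * n ^ (i + (j + o))             ∎
    where
    open ≤-Reasoning
    l : ∀ q a b s → q * (a * (b * s)) ≡ a * b * (q * s)
    l = solve-∀
    r : ∀ a b c d → a * b * (c * d) ≡ c * (a * (d * b))
    r = solve-∀

  small-any : ∀ {q N p} {P : A → Set p} (P? : ∀ x → Dec (P x)) → q * ∑ V (λ x → χ (P? x)) ≤ n →
              Small q N N (λ l → χ (any? P? l))
  small-any {q} {zero} P? h = small (≤-reflexive (*-zeroʳ q))
  small-any {q} {suc N} {P = P} P? h = small $ begin
    q * ΣW (suc N) (λ l → χ (any? P? l))
      ≤⟨ *-monoʳ-≤ q (ΣW-mono (suc N) {χ ∘ any? P?} {g} (λ { (x ∷ l) _ → χ-⊎ (any? P? (x ∷ l)) (P? x) (any? P? l) (λ { (here p) → inj₁ p ; (there p) → inj₂ p }) })) ⟩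
    q * ∑ V (λ x → ΣW N (λ l → χ (P? x) + χ (any? P? l)))
      ≡⟨ cong (q *_) (trans (∑-cong V (λ x → trans (ΣW-+ N _ _) (cong (_+ S) (ΣW-const N (χ (P? x)))))) (∑-+ V _ _)) ⟩
    q * (∑ V (λ x → n ^ N * χ (P? x)) + ∑ V (λ _ → S))
      ≡⟨ cong (q *_) (cong₂ _+_ (∑-* (n ^ N) V _) (∑V-const S)) ⟩
    q * (n ^ N * ∑ V (λ x → χ (P? x)) + n * S)
      ≡⟨ l q (n ^ N) (∑ V (λ x → χ (P? x))) n S ⟩
    n ^ N * (q * ∑ V (λ x → χ (P? x))) + n * (q * S)
      ≤⟨ +-mono-≤ (*-monoʳ-≤ (n ^ N) h) (*-monoʳ-≤ n (Small.bound (small-any {q} {N} P? h))) ⟩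
    n ^ N * n + n * (N * n ^ N)
      ≡⟨ r (n ^ N) n N ⟩
    suc N * n ^ suc N ∎
    where
    open ≤-Reasoning
    S = ΣW N (λ l → χ (any? P? l))
    g : List A → ℕ
    g [] = 0
    g (x ∷ l) = χ (P? x) + χ (any? P? l)
    l : ∀ q a b n s → q * (a * b + n * s) ≡ a * (q * b) + n * (q * s)
    l = solve-∀
    r : ∀ a n N → a * n + n * (N * a) ≡ suc N * (n * a)
    r = solve-∀

  ΣW-all : ∀ {p} {P : A → Set p} (P? : ∀ x → Dec (P x)) N →
           ΣW N (λ l → χ (all? P? l)) ≡ ∑ V (λ x → χ (P? x)) ^ N
  ΣW-all P? zero    = refl
  ΣW-all P? (suc N) = begin
    ∑ V (λ x → ΣW N (λ l → χ (all? P? (x ∷ l))))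
      ≡⟨ ∑-cong V (λ x → trans (ΣW-cong N (λ l _ → χ-all x l)) (ΣW-* N (χ (P? x)) _)) ⟩
    ∑ V (λ x → χ (P? x) * S)     ≡⟨ ∑-cong V (λ x → *-comm (χ (P? x)) S) ⟩
    ∑ V (λ x → S * χ (P? x))     ≡⟨ ∑-* S V _ ⟩
    S * ∑ V (λ x → χ (P? x))     ≡⟨ *-comm S _ ⟩
    ∑ V (λ x → χ (P? x)) * S     ≡⟨ cong (∑ V (λ x → χ (P? x)) *_) (ΣW-all P? N) ⟩
    ∑ V (λ x → χ (P? x)) ^ suc N ∎
    where
    open ≡-Reasoning
    S = ΣW N (λ l → χ (all? P? l))
    χ-all : ∀ x l → χ (all? P? (x ∷ l)) ≡ χ (P? x) * χ (all? P? l)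
    χ-all x l = χ-× (all? P? (x ∷ l)) (P? x) (all? P? l) (λ { (p ∷ ps) → p , ps }) _∷_

  ^-distribʳ-* : ∀ a b N → (a * b) ^ N ≡ a ^ N * b ^ N
  ^-distribʳ-* a b zero    = refl
  ^-distribʳ-* a b (suc N) = trans (cong (a * b *_) (^-distribʳ-* a b N)) (interchange a b (a ^ N) (b ^ N))

  dense-all : ∀ {p} {P : A → Set p} (P? : ∀ x → Dec (P x)) {G} N → n ≤ G * ∑ V (λ x → χ (P? x)) →
              n ^ N ≤ G ^ N * ΣW N (λ l → χ (all? P? l))
  dense-all P? {G} N h = ≤-trans (^-monoˡ-≤ N h)
    (≤-reflexive (trans (^-distribʳ-* G _ N) (cong (G ^ N *_) (sym (ΣW-all P? N)))))

  pick : ∀ {q c g} N {P : List A → Set} (P? : ∀ l → Dec (P l)) (b : List A → ℕ) → 0 < n → g * c < q →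
         n ^ N ≤ g * ΣW N (λ l → χ (P? l)) → Small q c N b → ∃[ l ] length l ≡ N × P l × b l ≡ 0
  pick {q} {c} {g} N P? b n>0 gc<q dense (small sm) with ΣW-∃ N b _ lt
    where
    lt : ΣW N b < ΣW N (λ l → χ (P? l))
    lt = ≰⇒> λ le → <⇒≱ gc<q (*-cancelʳ-≤ q (g * c) (n ^ N) {{m^n≢0 n N {{>-nonZero n>0}}}} (begin
      q * n ^ N                      ≤⟨ *-monoʳ-≤ q dense ⟩
      q * (g * ΣW N (λ l → χ (P? l))) ≤⟨ *-monoʳ-≤ q (*-monoʳ-≤ g le) ⟩
      q * (g * ΣW N b)               ≡⟨ x∙yz≈y∙xz q g _ ⟩
      g * (q * ΣW N b)               ≤⟨ *-monoʳ-≤ g sm ⟩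
      g * (c * n ^ N)                ≡⟨ *-assoc g c _ ⟨
      g * c * n ^ N                  ∎))
      where open ≤-Reasoning
  ... | l , e , h = l , e , χ-pos (P? l) (≤-<-trans {0} {b l} z≤n h) , n<1⇒n≡0 (<-≤-trans h (χ≤1 (P? l)))

  -- The relation expressing that every choice of one entry from each of the pairs (xᵢ , yᵢ) satisfies R.
  Cube : (List A → Set) → List A → List A → Set
  Cube R (x ∷ xs) (y ∷ ys) = Cube (λ l → R (x ∷ l) × R (y ∷ l)) xs ys
  Cube R xs       ys       = R []

  cube? : ∀ {R} → (∀ l → Dec (R l)) → ∀ xs ys → Dec (Cube R xs ys)
  cube? R? []       ys       = R? []
  cube? R? (x ∷ xs) []       = R? []
  cube? R? (x ∷ xs) (y ∷ ys) = cube? (λ l → R? (x ∷ l) ×-dec R? (y ∷ l)) xs ys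

  cube-mixed : ∀ {R : List A → Set} xs ys → length xs ≡ length ys → Cube R xs ys →
               ∀ i → i ≤ length xs → R (take i ys ++ drop i xs)
  cube-mixed {R} []       []       e c zero i≤ = c
  cube-mixed (x ∷ xs) (y ∷ ys) e c zero    i≤ = proj₁ (cube-mixed xs ys (suc-injective e) c 0 z≤n)
  cube-mixed (x ∷ xs) (y ∷ ys) e c (suc i) (s≤s i≤) = proj₂ (cube-mixed xs ys (suc-injective e) c i i≤)

  -- Doubling the first coordinate squares the density by Cauchy–Schwarz; the pairs (x , y) whose common link is dense
  -- carry half of the total, and the induction hypothesis applies to each of those links.
  dense-cube : ∀ r K {R : List A → Set} (R? : ∀ l → Dec (R l)) → 0 < n →
               n ^ r ≤ K * ΣW r (λ l → χ (R? l)) →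
               n ^ r * n ^ r ≤ cubeConst r K * ΣW r (λ xs → ΣW r (λ ys → χ (cube? R? xs ys)))
  dense-cube zero    K R? n>0 h = h
  dense-cube (suc r) K {R} R? n>0 h = +-cancelʳ-≤ (n ^ suc r * n ^ suc r) _ _ (begin
    n ^ suc r * n ^ suc r + n ^ suc r * n ^ suc r  ≡⟨ e₀ (n ^ r) n ⟩
    2 * (n ^ r * (n ^ r * (n * n)))                ≤⟨ *-monoʳ-≤ 2 (*-monoʳ-≤ (n ^ r) codense) ⟩
    2 * (n ^ r * (K * K * C))                      ≡⟨ e₁ (n ^ r) (K * K) C ⟩
    M * n ^ r * C                                  ≡⟨ ∑∑-* (M * n ^ r) c₂ ⟨
    ∑ V (λ x → ∑ V (λ y → M * n ^ r * c₂ x y))     ≤⟨ ∑-mono V (λ x → ∑-mono V (λ y → pair x y)) ⟩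
    ∑ V (λ x → ∑ V (λ y → n ^ r * n ^ r + M * K′ * D x y))
      ≡⟨ trans (∑-cong V (λ x → trans (∑-+ V _ _) (cong (_+ ∑ V (λ y → M * K′ * D x y)) (∑V-const _)))) (trans (∑-+ V _ _) (cong₂ _+_ (∑V-const _) (∑∑-* (M * K′) D))) ⟩
    n * (n * (n ^ r * n ^ r)) + M * K′ * ∑ V (λ x → ∑ V (D x))
      ≡⟨ cong₂ _+_ (e₂ n (n ^ r)) (cong (M * K′ *_) (sym reorder)) ⟩
    n ^ suc r * n ^ suc r + M * K′ * ΣW (suc r) (λ xs → ΣW (suc r) (λ ys → χ (cube? R? xs ys))) ≡⟨ +-comm (n ^ suc r * n ^ suc r) _ ⟩
    M * K′ * ΣW (suc r) (λ xs → ΣW (suc r) (λ ys → χ (cube? R? xs ys))) + n ^ suc r * n ^ suc r ∎)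
    where
    open ≤-Reasoning
    M = 2 * (K * K)
    K′ = cubeConst r M
    R₂? : ∀ x y l → Dec (R (x ∷ l) × R (y ∷ l))
    R₂? x y l = R? (x ∷ l) ×-dec R? (y ∷ l)
    c₂ : A → A → ℕ
    c₂ x y = ΣW r (λ l → χ (R₂? x y l))
    C = ∑ V (λ x → ∑ V (λ y → c₂ x y))
    D : A → A → ℕ
    D x y = ΣW r (λ xs → ΣW r (λ ys → χ (cube? (R₂? x y) xs ys)))
    ∑∑-* : ∀ c (f : A → A → ℕ) → ∑ V (λ x → ∑ V (λ y → c * f x y)) ≡ c * ∑ V (λ x → ∑ V (f x))
    ∑∑-* c f = trans (∑-cong V (λ x → ∑-* c V (f x))) (∑-* c V _)
    reorder : ΣW (suc r) (λ xs → ΣW (suc r) (λ ys → χ (cube? R? xs ys))) ≡ ∑ V (λ x → ∑ V (D x))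
    reorder = ∑-cong V (λ x → ΣW-∑ r V _)
    fibre : List A → ℕ
    fibre l = ∑ V (λ x → χ (R? (x ∷ l)))
    χ-×′ : ∀ x y l → χ (R? (x ∷ l)) * χ (R? (y ∷ l)) ≡ χ (R₂? x y l)
    χ-×′ x y l = sym (χ-× (R₂? x y l) (R? (x ∷ l)) (R? (y ∷ l)) id _,_)
    fibre² : ∀ l → fibre l * fibre l ≡ ∑ V (λ x → ∑ V (λ y → χ (R₂? x y l)))
    fibre² l = trans (*-comm (fibre l) (fibre l)) (trans (sym (∑-* (fibre l) V _)) (∑-cong V (λ x → trans (*-comm (fibre l) _)
      (trans (sym (∑-* (χ (R? (x ∷ l))) V _)) (∑-cong V (λ y → χ-×′ x y l))))))
    ∑fibre² : ΣW r (λ l → fibre l * fibre l) ≡ C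
    ∑fibre² = trans (ΣW-cong r (λ l _ → fibre² l)) (trans (ΣW-∑ r V _) (∑-cong V (λ x → ΣW-∑ r V _)))
    CS : ∀ N (f : List A → ℕ) → ΣW N f * ΣW N f ≤ n ^ N * ΣW N (λ l → f l * f l)
    CS zero f = ≤-reflexive (sym (*-identityˡ _))
    CS (suc N) f = begin
      ∑ V F * ∑ V F               ≤⟨ subst (λ m → ∑ V F * ∑ V F ≤ m * ∑ V (λ x → F x * F x)) |V|≡n (cauchy-schwarz V F) ⟩
      n * ∑ V (λ x → F x * F x)   ≤⟨ *-monoʳ-≤ n (∑-mono V (λ x → CS N (λ l → f (x ∷ l)))) ⟩
      n * ∑ V (λ x → n ^ N * ΣW N (λ l → f (x ∷ l) * f (x ∷ l))) ≡⟨ cong (n *_) (∑-* (n ^ N) V _) ⟩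
      n * (n ^ N * ΣW (suc N) (λ l → f l * f l)) ≡⟨ *-assoc n _ _ ⟨
      n ^ suc N * ΣW (suc N) (λ l → f l * f l) ∎
      where
      F = λ x → ΣW N (λ l → f (x ∷ l))
    T = ΣW r fibre
    T≡ : ΣW (suc r) (λ l → χ (R? l)) ≡ T
    T≡ = sym (ΣW-∑ r V _)
    codense : n ^ r * (n * n) ≤ K * K * C
    codense = *-cancelˡ-≤ (n ^ r) {{m^n≢0 n r {{>-nonZero n>0}}}} (begin
      n ^ r * (n ^ r * (n * n))           ≡⟨ e₃ (n ^ r) n ⟩
      n ^ suc r * n ^ suc r               ≤⟨ *-mono-≤ h h ⟩
      K * ΣW (suc r) (λ l → χ (R? l)) * (K * ΣW (suc r) (λ l → χ (R? l))) ≡⟨ cong (λ z → K * z * (K * z)) T≡ ⟩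
      K * T * (K * T)                     ≡⟨ interchange K T K T ⟩
      K * K * (T * T)                     ≤⟨ *-monoʳ-≤ (K * K) (CS r fibre) ⟩
      K * K * (n ^ r * ΣW r (λ l → fibre l * fibre l)) ≡⟨ cong (λ z → K * K * (n ^ r * z)) ∑fibre² ⟩
      K * K * (n ^ r * C)                 ≡⟨ x∙yz≈y∙xz (K * K) (n ^ r) C ⟩
      n ^ r * (K * K * C)                 ∎)
      where
      e₃ : ∀ a n → a * (a * (n * n)) ≡ n * a * (n * a)
      e₃ = solve-∀
    pair : ∀ x y → M * n ^ r * c₂ x y ≤ n ^ r * n ^ r + M * K′ * D x y
    pair x y with n ^ r ≤? M * c₂ x y
    ... | yes p = begin
      M * n ^ r * c₂ x y          ≤⟨ *-monoʳ-≤ (M * n ^ r) (≤-trans (ΣW-≤-const r (λ l _ → χ≤1 (R₂? x y l))) (≤-reflexive (*-identityʳ _))) ⟩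
      M * n ^ r * n ^ r           ≡⟨ *-assoc M _ _ ⟩
      M * (n ^ r * n ^ r)         ≤⟨ *-monoʳ-≤ M (dense-cube r M (R₂? x y) n>0 p) ⟩
      M * (K′ * D x y)            ≡⟨ *-assoc M K′ _ ⟨
      M * K′ * D x y              ≤⟨ m≤n+m _ (n ^ r * n ^ r) ⟩
      n ^ r * n ^ r + M * K′ * D x y ∎
    ... | no ¬p = begin
      M * n ^ r * c₂ x y          ≡⟨ e₄ M (n ^ r) (c₂ x y) ⟩
      n ^ r * (M * c₂ x y)        ≤⟨ *-monoʳ-≤ (n ^ r) (<⇒≤ (≰⇒> ¬p)) ⟩
      n ^ r * n ^ r               ≤⟨ m≤m+n _ _ ⟩
      n ^ r * n ^ r + M * K′ * D x y ∎
      where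
      e₄ : ∀ a b c → a * b * c ≡ b * (a * c)
      e₄ = solve-∀
    e₀ : ∀ a n → n * a * (n * a) + n * a * (n * a) ≡ 2 * (a * (a * (n * n)))
    e₀ = solve-∀
    e₁ : ∀ a k c → 2 * (a * (k * c)) ≡ 2 * k * a * c
    e₁ = solve-∀
    e₂ : ∀ n a → n * (n * (a * a)) ≡ n * a * (n * a)
    e₂ = solve-∀

  module _ (_≟ᴬ_ : DecidableEquality A) (uniqueV : Unique V) where

    open import Data.List.Membership.DecPropositional _≟ᴬ_ using (_∈?_)
    open import Data.List.Relation.Unary.Unique.DecPropositional _≟ᴬ_ using (unique?)

    ∑-≡ : ∀ y → ∑ V (λ x → χ (x ≟ᴬ y)) ≤ 1
    ∑-≡ y = go V uniqueV
      where
      go : ∀ xs → Unique xs → ∑ xs (λ x → χ (x ≟ᴬ y)) ≤ 1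
      go [] _ = z≤n
      go (x ∷ xs) (x∉ ∷ u) with x ≟ᴬ y
      ... | no _ = go xs u
      ... | yes refl = s≤s (≤-reflexive (none xs x∉))
        where
        none : ∀ xs → All (x ≢_) xs → ∑ xs (λ z → χ (z ≟ᴬ x)) ≡ 0
        none [] _ = refl
        none (z ∷ xs) (p ∷ ps) = cong₂ _+_ (χ-no (z ≟ᴬ x) (p ∘ sym)) (none xs ps)

    ∑-∈? : ∀ l → ∑ V (λ x → χ (x ∈? l)) ≤ length l
    ∑-∈? [] = ≤-trans (∑-mono V (λ x → ≤-reflexive (χ-no (x ∈? []) (λ ())))) (≤-reflexive (∑-zero V))
    ∑-∈? (y ∷ l) = ≤-trans (∑-mono V (λ x → χ-⊎ (x ∈? (y ∷ l)) (x ≟ᴬ y) (x ∈? l) (λ { (here p) → inj₁ p ; (there p) → inj₂ p })))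
      (≤-trans (≤-reflexive (∑-+ V _ _)) (+-mono-≤ (∑-≡ y) (∑-∈? l)))

    ΣW-repeat : ∀ N → n * ΣW N (λ l → χ (¬? (unique? l))) ≤ N * N * n ^ N
    ΣW-repeat zero = ≤-reflexive (*-zeroʳ n)
    ΣW-repeat (suc N) = begin
      n * ΣW (suc N) (λ l → χ (¬? (unique? l)))
        ≤⟨ *-monoʳ-≤ n (∑-mono V (λ x → ΣW-mono N (λ l _ → χ-⊎ (¬? (unique? (x ∷ l))) (x ∈? l) (¬? (unique? l)) (split x l)))) ⟩
      n * ∑ V (λ x → ΣW N (λ l → χ (x ∈? l) + χ (¬? (unique? l))))
        ≡⟨ cong (n *_) (trans (∑-cong V (λ x → ΣW-+ N _ _)) (∑-+ V _ _)) ⟩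
      n * (∑ V (λ x → ΣW N (λ l → χ (x ∈? l))) + ∑ V (λ _ → S))
        ≡⟨ cong (n *_) (cong₂ _+_ (sym (ΣW-∑ N V _)) (∑V-const S)) ⟩
      n * (ΣW N (λ l → ∑ V (λ x → χ (x ∈? l))) + n * S)
        ≤⟨ *-monoʳ-≤ n (+-mono-≤ (ΣW-≤-const N (λ l e → ≤-trans (∑-∈? l) (≤-reflexive e))) (ΣW-repeat N)) ⟩
      n * (n ^ N * N + N * N * n ^ N)
        ≤⟨ m≤m+n _ (suc N * (n * n ^ N)) ⟩
      n * (n ^ N * N + N * N * n ^ N) + suc N * (n * n ^ N)
        ≡⟨ r n (n ^ N) N ⟩
      suc N * suc N * n ^ suc N ∎
      where
      open ≤-Reasoning
      S = ΣW N (λ l → χ (¬? (unique? l)))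
      split : ∀ x l → ¬ Unique (x ∷ l) → x ∈ l ⊎ ¬ Unique l
      split x l ¬u with x ∈? l | unique? l
      ... | yes p | _ = inj₁ p
      ... | no p | no q = inj₂ q
      ... | no p | yes q = contradiction (¬Any⇒All¬ l p ∷ q) ¬u
      r : ∀ n a N → n * (a * N + N * N * a) + suc N * (n * a) ≡ suc N * suc N * (n * a)
      r = solve-∀

    small-repeat : ∀ {q N} → 0 < n → q * (N * N) ≤ n → Small q 1 N (λ l → χ (¬? (unique? l)))
    small-repeat {q} {N} n>0 h = small $ *-cancelˡ-≤ n {{>-nonZero n>0}} (begin
      n * (q * S)          ≡⟨ x∙yz≈y∙xz n q S ⟩
      q * (n * S)          ≤⟨ *-monoʳ-≤ q (ΣW-repeat N) ⟩
      q * (N * N * n ^ N)  ≡⟨ *-assoc q (N * N) _ ⟨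
      q * (N * N) * n ^ N  ≤⟨ *-monoˡ-≤ (n ^ N) h ⟩
      n * n ^ N            ≡⟨ cong (n *_) (*-identityˡ _) ⟨
      n * (1 * n ^ N)      ∎)
      where
      open ≤-Reasoning
      S = ΣW N (λ l → χ (¬? (unique? l)))

setOf : ∀ {n} → List (Fin n) → Subset n
setOf l = ⋃ (map ⁅_⁆ l)

module _ {n : ℕ} where

  open import Data.List.Membership.DecPropositional (Finₚ._≟_ {n}) using (_∈?_)

  V : List (Fin n)
  V = allFin n

  ∈-setOf⁺ : ∀ {v} {l : List (Fin n)} → v ∈ l → v Sub.∈ setOf l
  ∈-setOf⁺ (here refl) = x∈p∪q⁺ (inj₁ (x∈⁅x⁆ _))
  ∈-setOf⁺ (there h)   = x∈p∪q⁺ (inj₂ (∈-setOf⁺ h))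

  ∈-setOf⁻ : ∀ {v} (l : List (Fin n)) → v Sub.∈ setOf l → v ∈ l
  ∈-setOf⁻ []      h = contradiction h ∉⊥
  ∈-setOf⁻ (x ∷ l) h with x∈p∪q⁻ ⁅ x ⁆ (setOf l) h
  ... | inj₁ p = here (x∈⁅y⁆⇒x≡y _ p)
  ... | inj₂ p = there (∈-setOf⁻ l p)

  subset-ext : ∀ {p q : Subset n} → (∀ v → v Sub.∈ p → v Sub.∈ q) → (∀ v → v Sub.∈ q → v Sub.∈ p) → p ≡ q
  subset-ext f g = Subₚ.⊆-antisym (λ {v} → f v) (λ {v} → g v)

  setOf-ext : ∀ {l m : List (Fin n)} → (∀ {v} → v ∈ l → v ∈ m) → (∀ {v} → v ∈ m → v ∈ l) → setOf l ≡ setOf m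
  setOf-ext {l} {m} f g = subset-ext (λ v p → ∈-setOf⁺ (f (∈-setOf⁻ l p))) (λ v p → ∈-setOf⁺ (g (∈-setOf⁻ m p)))

  setOf-↭ : ∀ {l m : List (Fin n)} → l ↭ m → setOf l ≡ setOf m
  setOf-↭ p = setOf-ext (Any-resp-↭ p) (Any-resp-↭ (↭-sym p))

  uniqueV : Unique V
  uniqueV = allFin⁺ n

  ∑-≡1 : ∀ y → ∑ V (λ x → χ (x Finₚ.≟ y)) ≡ 1
  ∑-≡1 y = ≤-antisym (Counting.∑-≡ V n (length-tabulate id) Finₚ._≟_ uniqueV y)
    (≤-trans (≤-reflexive (sym (χ-yes (y Finₚ.≟ y) refl))) (∑-∈ (λ x → χ (x Finₚ.≟ y)) (∈-allFin y)))

  ∑-unique : ∀ (l : List (Fin n)) → Unique l → ∑ V (λ x → χ (x ∈? l)) ≡ length l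
  ∑-unique [] _ = trans (∑-cong V (λ x → χ-no (x ∈? []) (λ ()))) (∑-zero V)
  ∑-unique (y ∷ l) (y∉ ∷ u) = trans (∑-cong V split) (trans (∑-+ V _ _) (cong₂ _+_ (∑-≡1 y) (∑-unique l u)))
    where
    split′ : ∀ x (d : Dec (x ≡ y)) → χ (x ∈? (y ∷ l)) ≡ χ d + χ (x ∈? l)
    split′ x (yes refl) = trans (χ-yes (x ∈? (x ∷ l)) (here refl)) (cong suc (sym (χ-no (x ∈? l) (λ x∈ → All.lookup y∉ x∈ refl))))
    split′ x (no ¬p) = ≤-antisym (χ-mono (x ∈? (y ∷ l)) (x ∈? l) (λ { (here p) → contradiction p ¬p ; (there p) → p }))
                                 (χ-mono (x ∈? l) (x ∈? (y ∷ l)) there)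
    split : ∀ x → χ (x ∈? (y ∷ l)) ≡ χ (x Finₚ.≟ y) + χ (x ∈? l)
    split x = split′ x (x Finₚ.≟ y)

module _ where

  card-∑ : ∀ {n} (S : Subset n) → ∣ S ∣ ≡ ∑ (allFin n) (λ v → χ (v Subₚ.∈? S))
  card-∑ Vec.[] = refl
  card-∑ {suc n} (b Vec.∷ S) = begin
    ∣ b Vec.∷ S ∣                         ≡⟨ step b ⟩
    χ (Fin.zero Subₚ.∈? (b Vec.∷ S)) + ∣ S ∣      ≡⟨ cong (χ (Fin.zero Subₚ.∈? (b Vec.∷ S)) +_) (trans (card-∑ S) (∑-cong (allFin n) below)) ⟩
    χ (Fin.zero Subₚ.∈? (b Vec.∷ S)) + ∑ (allFin n) (λ v → χ (Fin.suc v Subₚ.∈? (b Vec.∷ S))) ≡⟨ cong (χ (Fin.zero Subₚ.∈? (b Vec.∷ S)) +_) (∑-map Fin.suc (allFin n) _) ⟨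
    χ (Fin.zero Subₚ.∈? (b Vec.∷ S)) + ∑ (map Fin.suc (allFin n)) (λ v → χ (v Subₚ.∈? (b Vec.∷ S))) ≡⟨ cong (λ l → χ (Fin.zero Subₚ.∈? (b Vec.∷ S)) + ∑ l (λ v → χ (v Subₚ.∈? (b Vec.∷ S)))) (map-tabulate {n = n} id Fin.suc) ⟩
    ∑ (allFin (suc n)) (λ v → χ (v Subₚ.∈? (b Vec.∷ S))) ∎
    where
    open ≡-Reasoning
    step : ∀ b → ∣ b Vec.∷ S ∣ ≡ χ (Fin.zero Subₚ.∈? (b Vec.∷ S)) + ∣ S ∣
    step true  = refl
    step false = refl
    below : ∀ v → χ (v Subₚ.∈? S) ≡ χ (Fin.suc v Subₚ.∈? (b Vec.∷ S))
    below v = ≤-antisym (χ-mono _ _ Vec.there) (χ-mono _ (v Subₚ.∈? S) Subₚ.drop-there)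

  ∈-subsets : ∀ {n} (S : Subset n) → S ∈ subsets n
  ∈-subsets Vec.[] = here refl
  ∈-subsets {suc n} (false Vec.∷ S) = ∈-++⁺ˡ (∈-map⁺ _ (∈-subsets S))
  ∈-subsets {suc n} (true Vec.∷ S)  = ∈-++⁺ʳ (map (outside Vec.∷_) (subsets n)) (∈-map⁺ _ (∈-subsets S))

module EdgeWords {k n : ℕ} (H : Hypergraph k n) where

  open Counting (allFin n) n (length-tabulate id) public
  open import Data.List.Membership.DecPropositional (Finₚ._≟_ {n}) public using (_∈?_)

  card-setOf : ∀ (l : List (Fin n)) → ∣ setOf l ∣ ≡ ∑ (allFin n) (λ v → χ (v ∈? l))
  card-setOf l = trans (card-∑ (setOf l)) (∑-cong (allFin n) λ v → ≤-antisym
    (χ-mono (v Subₚ.∈? setOf l) (v ∈? l) (∈-setOf⁻ l)) (χ-mono (v ∈? l) (v Subₚ.∈? setOf l) ∈-setOf⁺))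

  card-setOf-≤ : ∀ l → ∣ setOf l ∣ ≤ length l
  card-setOf-≤ l = ≤-trans (≤-reflexive (card-setOf l)) (∑-∈? Finₚ._≟_ uniqueV l)

  E : List (Fin n) → Set
  E l = Edge H (setOf l)

  abstract
   E? : ∀ l → Dec (E l)
   E? l = edge? H (setOf l)

  E-↭ : ∀ {l m} → l ↭ m → E l → E m
  E-↭ p = subst (Edge H) (setOf-↭ p)

  E-length : ∀ {l} → E l → k ≤ length l
  E-length {l} h = ≤-trans (≤-reflexive (sym (uniform H h))) (card-setOf-≤ l)

  E-fresh : ∀ {v l} → suc (length l) ≡ k → E (v ∷ l) → v ∉ l
  E-fresh {v} {l} e h v∈l = <⇒≱ (≤-reflexive e) (≤-trans (E-length {l} (subst (Edge H) eq h)) ≤-refl)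
    where
    eq : setOf (v ∷ l) ≡ setOf l
    eq = setOf-ext (λ { (here refl) → v∈l ; (there p) → p }) there

  codegree : ∀ l → Unique l → length l ≡ k ∸ 1 → minCodegree H ≤ ∑ (allFin n) (λ v → χ (E? (v ∷ l)))
  codegree l u e = begin
    minCodegree H                           ≤⟨ All.lookup (min≤xs n _) (∈-map⁺ (deg H) (∈-filter⁺ (λ S → ∣ S ∣ ≟ k ∸ 1) (∈-subsets (setOf l)) card)) ⟩
    deg H (setOf l)                         ≡⟨ length-filter _ (allFin n) ⟩
    ∑ (allFin n) (λ v → χ (¬? (v Subₚ.∈? setOf l) ×-dec edge? H (setOf l ∪ ⁅ v ⁆)))
      ≤⟨ ∑-mono (allFin n) (λ v → χ-mono _ (E? (v ∷ l)) (λ { (_ , h) → subst (Edge H) (∪-comm (setOf l) ⁅ v ⁆) h })) ⟩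
    ∑ (allFin n) (λ v → χ (E? (v ∷ l)))     ∎
    where
    open ≤-Reasoning
    card : ∣ setOf l ∣ ≡ k ∸ 1
    card = trans (card-setOf l) (trans (∑-unique l u) e)

  module _ (B : Subset n) where

    InB : Fin n → Set
    InB v = v Sub.∈ B

    abstract
     InB? : ∀ v → Dec (InB v)
     InB? v = v Subₚ.∈? B

    -- Each edge arises from at most kᵏ lists.
    words≤edges : ΣW k (λ l → χ (all? InB? l ×-dec E? l)) ≤ k ^ k * e H B
    words≤edges = begin
      ΣW k (λ l → χ (all? InB? l ×-dec E? l))
        ≤⟨ ΣW-mono k (λ l _ → into l) ⟩
      ΣW k (λ l → ∑ (subsets n) (λ S → χ (edge? H S ×-dec (S Subₚ.⊆? B)) * χ (S ≟ˢ setOf l)))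
        ≡⟨ ΣW-∑ k (subsets n) _ ⟩
      ∑ (subsets n) (λ S → ΣW k (λ l → χ (edge? H S ×-dec (S Subₚ.⊆? B)) * χ (S ≟ˢ setOf l)))
        ≡⟨ ∑-cong (subsets n) (λ S → ΣW-* k (χ (edge? H S ×-dec (S Subₚ.⊆? B))) _) ⟩
      ∑ (subsets n) (λ S → χ (edge? H S ×-dec (S Subₚ.⊆? B)) * ΣW k (λ l → χ (S ≟ˢ setOf l)))
        ≤⟨ ∑-mono (subsets n) few ⟩
      ∑ (subsets n) (λ S → k ^ k * χ (edge? H S ×-dec (S Subₚ.⊆? B)))
        ≡⟨ ∑-* (k ^ k) (subsets n) _ ⟩
      k ^ k * ∑ (subsets n) (λ S → χ (edge? H S ×-dec (S Subₚ.⊆? B)))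
        ≡⟨ cong (k ^ k *_) (length-filter _ (subsets n)) ⟨
      k ^ k * e H B ∎
      where
      open ≤-Reasoning
      _≟ˢ_ : (S S′ : Subset n) → Dec (S ≡ S′)
      _≟ˢ_ = ≡-dec Boolₚ._≟_
      into : ∀ l → χ (all? InB? l ×-dec E? l) ≤ ∑ (subsets n) (λ S → χ (edge? H S ×-dec (S Subₚ.⊆? B)) * χ (S ≟ˢ setOf l))
      into l with all? InB? l ×-dec E? l
      ... | no _ = z≤n
      ... | yes (b , h) = ≤-trans (≤-reflexive (sym (cong₂ _*_
          (χ-yes (edge? H (setOf l) ×-dec (setOf l Subₚ.⊆? B)) (h , λ v∈ → All.lookup b (∈-setOf⁻ l v∈)))
          (χ-yes (setOf l ≟ˢ setOf l) refl))))
        (∑-∈ _ (∈-subsets (setOf l)))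
      few : ∀ S → χ (edge? H S ×-dec (S Subₚ.⊆? B)) * ΣW k (λ l → χ (S ≟ˢ setOf l)) ≤ k ^ k * χ (edge? H S ×-dec (S Subₚ.⊆? B))
      few S with edge? H S ×-dec (S Subₚ.⊆? B)
      ... | no _ = z≤n
      ... | yes (h , _) = ≤-trans (≤-reflexive (*-identityˡ _)) (begin
        ΣW k (λ l → χ (S ≟ˢ setOf l))
          ≤⟨ ΣW-mono k (λ l _ → χ-mono (S ≟ˢ setOf l) (all? (Subₚ._∈? S) l) (λ { refl → All.tabulate ∈-setOf⁺ })) ⟩
        ΣW k (λ l → χ (all? (Subₚ._∈? S) l))   ≡⟨ ΣW-all (Subₚ._∈? S) k ⟩
        ∑ (allFin n) (λ v → χ (v Subₚ.∈? S)) ^ k ≡⟨ cong (_^ k) (trans (sym (card-∑ S)) (uniform H h)) ⟩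
        k ^ k                                  ≡⟨ *-identityʳ _ ⟨
        k ^ k * 1                              ∎)

module _ {a} {A : Set a} where

  take-app : ∀ j (U W : List A) → take j (U ++ W) ≡ take j U ++ take (j ∸ length U) W
  take-app zero    []      W = refl
  take-app (suc j) []      W = refl
  take-app zero    (x ∷ U) W = refl
  take-app (suc j) (x ∷ U) W = cong (x ∷_) (take-app j U W)

  drop-app : ∀ i (U W : List A) → drop i (U ++ W) ≡ drop i U ++ drop (i ∸ length U) W
  drop-app zero    []      W = refl
  drop-app (suc i) []      W = refl
  drop-app zero    (x ∷ U) W = refl
  drop-app (suc i) (x ∷ U) W = drop-app i U W

  take-app-≤ : ∀ {j} (U W : List A) → j ≤ length U → take j (U ++ W) ≡ take j U
  take-app-≤ {j} U W h rewrite take-app j U W | m≤n⇒m∸n≡0 h = ++-identityʳ _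

  drop-app-≤ : ∀ {i} (U W : List A) → i ≤ length U → drop i (U ++ W) ≡ drop i U ++ W
  drop-app-≤ {i} U W h rewrite drop-app i U W | m≤n⇒m∸n≡0 h = refl

  drop-app-≥ : ∀ {i} (U W : List A) → length U ≤ i → drop i (U ++ W) ≡ drop (i ∸ length U) W
  drop-app-≥ {i} U W h rewrite drop-app i U W | drop-all i U h = refl

  take-⊓ : ∀ j (X : List A) → take j X ≡ take (j ⊓ length X) X
  take-⊓ zero    X       = refl
  take-⊓ (suc j) []      = refl
  take-⊓ (suc j) (x ∷ X) = cong (x ∷_) (take-⊓ j X)

module _ {A : Set} where

  Intervals : ℕ → (List A → Set) → List A → Set
  Intervals k P l = ∀ i j → j < k → P (take j (drop i l))

  -- An interval shorter than k cannot meet both sides of a segment of length at least k ∸ 1.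
  intervals-glue : ∀ {k P} U X {Y} → k ≤ suc (length X) → Intervals k P (U ++ X) → Intervals k P (X ++ Y) → Intervals k P (U ++ X ++ Y)
  intervals-glue {k} {P} U X {Y} k≤ hU hY i j j<k with ≤-total (length U) i
  ... | inj₁ U≤i rewrite drop-app-≥ U (X ++ Y) U≤i = hY (i ∸ length U) j j<k
  ... | inj₂ i≤U = subst P (sym eq) (hU i j j<k)
    where
    len : j ≤ length (drop i (U ++ X))
    len = ≤-trans (≤-pred (≤-trans j<k k≤)) (≤-trans (m≤n+m (length X) (length (drop i U)))
      (≤-reflexive (sym (trans (cong length (drop-app-≤ U X i≤U)) (length-++ (drop i U))))))
    eq : take j (drop i (U ++ X ++ Y)) ≡ take j (drop i (U ++ X))
    eq = trans (cong (take j) (trans (cong (drop i) (sym (++-assoc U X Y)))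
        (drop-app-≤ (U ++ X) Y (≤-trans i≤U (≤-trans (m≤m+n _ _) (≤-reflexive (sym (length-++ U))))))))
      (take-app-≤ (drop i (U ++ X)) Y len)

take-all′ : ∀ {a} {A : Set a} {m} (X : List A) → length X ≤ m → take m X ≡ X
take-all′ {m = m} X h = take-all m X h

suc-pred′ : ∀ {k} → 0 < k → suc (k ∸ 1) ≡ k
suc-pred′ {suc k} _ = refl

module _ {A : Set} where

  unique-++ : ∀ {us X : List A} → Unique us → Unique X → All (_∉ us) X → Unique (us ++ X)
  unique-++ uu ux d = Uniqₚ.++⁺ uu ux (λ { (v∈us , v∈X) → All.lookup d v∈X v∈us })

  unique-↭ : ∀ {xs ys : List A} → xs ↭ ys → Unique xs → Unique ys
  unique-↭ p = PermSetoid.Unique-resp-↭ (≡-setoid A) (↭⇒↭ₛ p)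

  unique-++ˡ : ∀ (xs : List A) {ys} → Unique (xs ++ ys) → Unique xs
  unique-++ˡ []       u = []
  unique-++ˡ (x ∷ xs) (x∉ ∷ u) = Allₚ.++⁻ˡ xs x∉ ∷ unique-++ˡ xs u

  unique-++ʳ : ∀ (xs : List A) {ys} → Unique (xs ++ ys) → Unique ys
  unique-++ʳ []       u = u
  unique-++ʳ (x ∷ xs) (_ ∷ u) = unique-++ʳ xs u

∈⇒↭ : ∀ {A : Set} {x : A} {xs} → x ∈ xs → ∃[ ys ] xs ↭ x ∷ ys
∈⇒↭ {x = x} x∈ with ∈-∃++ x∈
... | ys , zs , refl = ys ++ zs , shift x ys zs

module _ {X S : Set} {Bad : X → S → Set} (bad? : ∀ x s → Dec (Bad x s)) where

  private
    BadPair : X × S → Set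
    BadPair (x , s) = Bad x s

    badPair? : ∀ p → Dec (BadPair p)
    badPair? (x , s) = bad? x s

    #bad : List (X × S) → ℕ
    #bad ps = ∑ ps (λ p → χ (badPair? p))

  -- Exchanging the partners in a bad pair with those of a pair compatible with it lowers the number of bad pairs.
  repair : ∀ c xs ss ps → (∀ x → x ∈ xs → 2 * ∑ ss (λ s → χ (bad? x s)) < length ss) →
           (∀ s → s ∈ ss → 2 * ∑ xs (λ x → χ (bad? x s)) < length ss) →
           map proj₁ ps ↭ xs → map proj₂ ps ↭ ss → #bad ps < c →
           ∃[ ps′ ] map proj₁ ps′ ↭ xs × map proj₂ ps′ ↭ ss × All (λ p → ¬ BadPair p) ps′
  repair zero xs ss ps hx hs px ps₂ ()
  repair (suc c) xs ss ps hx hs px ps₂ lt = go (any? badPair? ps)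
    where
    go : Dec (Any BadPair ps) → _
    go (no ¬any) = ps , px , ps₂ , Allₚ.¬Any⇒All¬ ps ¬any
    go (yes any) = fix (find any)
      where
      fix : ∃[ p ] p ∈ ps × BadPair p → _
      fix ((x , s) , p∈ , b) = exchange (∑-∃ ps _ (λ _ → 1) few)
        where
        open ≤-Reasoning
        x∈ : x ∈ xs
        x∈ = Permₚ.∈-resp-↭ px (∈-map⁺ proj₁ p∈)
        s∈ : s ∈ ss
        s∈ = Permₚ.∈-resp-↭ ps₂ (∈-map⁺ proj₂ p∈)
        few : ∑ ps (λ q → χ (bad? x (proj₂ q)) + χ (bad? (proj₁ q) s)) < ∑ ps (λ _ → 1)
        few = *-cancelˡ-< 2 _ _ (begin-strict
          2 * ∑ ps (λ q → χ (bad? x (proj₂ q)) + χ (bad? (proj₁ q) s)) ≡⟨ cong (2 *_) (∑-+ ps _ _) ⟩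
          2 * (∑ ps (λ q → χ (bad? x (proj₂ q))) + ∑ ps (λ q → χ (bad? (proj₁ q) s)))
            ≡⟨ cong (2 *_) (cong₂ _+_ (trans (sym (∑-map proj₂ ps _)) (∑-↭ _ ps₂)) (trans (sym (∑-map proj₁ ps _)) (∑-↭ _ px))) ⟩
          2 * (∑ ss (λ t → χ (bad? x t)) + ∑ xs (λ y → χ (bad? y s))) ≡⟨ *-distribˡ-+ 2 (∑ ss (λ t → χ (bad? x t))) _ ⟩
          2 * ∑ ss (λ t → χ (bad? x t)) + 2 * ∑ xs (λ y → χ (bad? y s)) <⟨ +-mono-< (hx x x∈) (hs s s∈) ⟩
          length ss + length ss                             ≡⟨ cong (length ss +_) (+-identityʳ (length ss)) ⟨
          2 * length ss                                     ≡⟨ cong (2 *_) (trans (sym (↭-length ps₂)) (trans (length-map proj₂ ps) (sym (∑-length ps)))) ⟩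
          2 * ∑ ps (λ _ → 1)                                ∎)
        exchange : ∃[ q ] q ∈ ps × χ (bad? x (proj₂ q)) + χ (bad? (proj₁ q) s) < 1 → _
        exchange ((y , t) , q∈ , h) = remove (∈⇒↭ p∈)
          where
          h0 : χ (bad? x t) + χ (bad? y s) ≡ 0
          h0 = n<1⇒n≡0 h
          ¬xt : ¬ Bad x t
          ¬xt = χ-zero (bad? x t) (m+n≡0⇒m≡0 _ h0)
          ¬ys : ¬ Bad y s
          ¬ys = χ-zero (bad? y s) (m+n≡0⇒n≡0 (χ (bad? x t)) h0)
          remove : ∃[ rest ] ps ↭ (x , s) ∷ rest → _
          remove (rest , e₁) = other (Permₚ.∈-resp-↭ e₁ q∈)
            where
            other : (y , t) ∈ (x , s) ∷ rest → _
            other (here refl) = contradiction b ¬xt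
            other (there q∈′) = done (∈⇒↭ q∈′)
              where
              done : ∃[ rest′ ] rest ↭ (y , t) ∷ rest′ → _
              done (rest′ , e₂) = repair c xs ss ((x , t) ∷ (y , s) ∷ rest′) hx hs
                (↭-trans (Permₚ.map⁺ proj₁ (↭-sym both)) px)
                (↭-trans (swap t s ↭-refl) (↭-trans (Permₚ.map⁺ proj₂ (↭-sym both)) ps₂))
                (<-≤-trans lower (≤-pred lt))
                where
                both : ps ↭ (x , s) ∷ (y , t) ∷ rest′
                both = ↭-trans e₁ (prep (x , s) e₂)
                lower : #bad ((x , t) ∷ (y , s) ∷ rest′) < #bad ps
                lower = begin-strict
                  χ (bad? x t) + (χ (bad? y s) + #bad rest′) ≡⟨ cong₂ (λ u v → u + (v + #bad rest′)) (χ-no (bad? x t) ¬xt) (χ-no (bad? y s) ¬ys) ⟩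
                  #bad rest′                                <⟨ s≤s (m≤n+m _ (χ (bad? y t))) ⟩
                  1 + (χ (bad? y t) + #bad rest′)           ≡⟨ cong (_+ (χ (bad? y t) + #bad rest′)) (χ-yes (bad? x s) b) ⟨
                  χ (bad? x s) + (χ (bad? y t) + #bad rest′) ≡⟨ ∑-↭ _ both ⟨
                  #bad ps                                   ∎

  private
    pairUp : ∀ (xs : List X) (ss : List S) → length xs ≡ length ss → ∃[ ps ] map proj₁ ps ≡ xs × map proj₂ ps ≡ ss
    pairUp [] [] _ = [] , refl , refl
    pairUp (x ∷ xs) (s ∷ ss) e = let ps , p , q = pairUp xs ss (suc-injective e) in (x , s) ∷ ps , cong (x ∷_) p , cong (s ∷_) q

  perfect-matching : ∀ xs ss → length xs ≡ length ss →
                     (∀ x → x ∈ xs → 2 * ∑ ss (λ s → χ (bad? x s)) < length ss) →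
                     (∀ s → s ∈ ss → 2 * ∑ xs (λ x → χ (bad? x s)) < length ss) →
                     ∃[ ps ] map proj₁ ps ↭ xs × map proj₂ ps ≡ ss × All (λ p → ¬ Bad (proj₁ p) (proj₂ p)) ps
  perfect-matching xs ss len hx hs =
    let ps₀ , p₀ , q₀ = pairUp xs ss len
        ps , p , q , good = repair (suc (#bad ps₀)) xs ss ps₀ hx hs (↭-reflexive p₀) (↭-reflexive q₀) ≤-refl
        ps′ , eq , perm = ↭-map-inv proj₂ q
    in ps′ , ↭-trans (Permₚ.map⁺ proj₁ (↭-sym perm)) p , sym eq , Permₚ.All-resp-↭ perm good

module _ {A : Set} where

  applyUpTo-lookup : ∀ (xs : List A) (c : ℕ → A) → (∀ i → c (toℕ i) ≡ lookup xs i) → applyUpTo c (length xs) ≡ xs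
  applyUpTo-lookup []       c h = refl
  applyUpTo-lookup (x ∷ xs) c h = cong₂ _∷_ (h Fin.zero) (applyUpTo-lookup xs (c ∘ suc) (h ∘ Fin.suc))

  applyUpTo-++ : ∀ (c : ℕ → A) i j → applyUpTo c (i + j) ≡ applyUpTo c i ++ applyUpTo (λ p → c (i + p)) j
  applyUpTo-++ c zero    j = refl
  applyUpTo-++ c (suc i) j = cong (c 0 ∷_) (applyUpTo-++ (c ∘ suc) i j)

  applyUpTo-cong : ∀ {c c′ : ℕ → A} j → (∀ p → c p ≡ c′ p) → applyUpTo c j ≡ applyUpTo c′ j
  applyUpTo-cong zero    h = refl
  applyUpTo-cong (suc j) h = cong₂ _∷_ (h 0) (applyUpTo-cong j (h ∘ suc))

  take-applyUpTo : ∀ (c : ℕ → A) {i j} → i ≤ j → take i (applyUpTo c j) ≡ applyUpTo c i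
  take-applyUpTo c {i} i≤j with m≤n⇒∃[o]m+o≡n i≤j
  ... | o , refl = trans (cong (take i) (applyUpTo-++ c i o)) (take-++ (applyUpTo c i) _ (length-applyUpTo c i))

  drop-applyUpTo : ∀ (c : ℕ → A) i j → drop i (applyUpTo c (i + j)) ≡ applyUpTo (λ p → c (i + p)) j
  drop-applyUpTo c i j = trans (cong (drop i) (applyUpTo-++ c i j)) (drop-++ (applyUpTo c i) _ (length-applyUpTo c i))

  lookup-injective : ∀ {xs : List A} → Unique xs → ∀ i j → lookup xs i ≡ lookup xs j → i ≡ j
  lookup-injective (x∉ ∷ u) Fin.zero    Fin.zero    e = refl
  lookup-injective (x∉ ∷ u) Fin.zero    (Fin.suc j) e = contradiction e (All.lookup x∉ (∈-lookup j))
  lookup-injective (x∉ ∷ u) (Fin.suc i) Fin.zero    e = contradiction (sym e) (All.lookup x∉ (∈-lookup i))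
  lookup-injective (x∉ ∷ u) (Fin.suc i) (Fin.suc j) e = cong Fin.suc (lookup-injective u i j e)

%-injective : ∀ n .{{_ : NonZero n}} q {a b} → a ≤ b → b < n → (q + a) % n ≡ (q + b) % n → a ≡ b
%-injective n q {a} {b} a≤b b<n e = go (b ∸ a) refl
  where
  x = (q + a) / n
  y = (q + b) / n
  ρ = (q + a) % n
  diff : b ∸ a ≡ (y ∸ x) * n
  diff = begin
    b ∸ a                            ≡⟨ [m+n]∸[m+o]≡n∸o q b a ⟨
    (q + b) ∸ (q + a)                ≡⟨ cong₂ _∸_ (m≡m%n+[m/n]*n (q + b) n) (m≡m%n+[m/n]*n (q + a) n) ⟩
    (q + b) % n + y * n ∸ (ρ + x * n) ≡⟨ cong (λ z → z + y * n ∸ (ρ + x * n)) e ⟨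
    ρ + y * n ∸ (ρ + x * n)          ≡⟨ [m+n]∸[m+o]≡n∸o ρ (y * n) (x * n) ⟩
    y * n ∸ x * n                    ≡⟨ *-distribʳ-∸ n y x ⟨
    (y ∸ x) * n                      ∎
    where open ≡-Reasoning
  go : ∀ z → b ∸ a ≡ z → a ≡ b
  go zero    h = ≤-antisym a≤b (m∸n≡0⇒m≤n h)
  go (suc z) h = contradiction (≤-<-trans (m∸n≤m b a) b<n) (≤⇒≯ (∣⇒≤ {{>-nonZero (subst (0 <_) (sym h) z<s)}} (divides (y ∸ x) diff)))

module _ {k n : ℕ} (H : Hypergraph k n) where

  open EdgeWords H

  list⇒cycle : ∀ d m ww → 0 < d → d ≤ k → n ≡ m * d → k + k ≤ n → 0 < k → ww ↭ allFin n →
               (∀ i → i < m → E (take k (drop (i * d) (ww ++ take (k ∸ d) ww)))) → HasHamiltonCycle (k ∸ d) H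
  list⇒cycle d m ww d>0 d≤k n≡md 2k≤n k>0 perm windows = C , record
    { ordering = ord ; edgeCount = m ; start = start
    ; increasing = λ {i} {j} i<j → subst₂ _<_ (sym (toℕ-start i)) (sym (toℕ-start j)) (*-monoˡ-< d {{>-nonZero d>0}} i<j)
    ; edges = λ S → mk⇔ id id ; meet = meet ; covering = covering } , λ { S (i , refl) → window i }
    where
    n>0 : 0 < n
    n>0 = <-≤-trans k>0 (≤-trans (m≤m+n k k) 2k≤n)
    instance
      nz : NonZero n
      nz = >-nonZero n>0
      dz : NonZero d
      dz = >-nonZero d>0
    len : n ≡ length ww
    len = trans (sym (length-tabulate id)) (sym (↭-length perm))
    uww : Unique ww
    uww = unique-↭ (↭-sym perm) uniqueV
    f : Fin n → Fin n
    f i = lookup ww (cast len i)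
    f-inj : ∀ {i j} → f i ≡ f j → i ≡ j
    f-inj {i} {j} e = toℕ-injective (trans (sym (toℕ-cast len i)) (trans (cong toℕ (lookup-injective uww (cast len i) (cast len j) e)) (toℕ-cast len j)))
    f-surj : ∀ v → ∃[ i ] f i ≡ v
    f-surj v = let v∈ = ∈-resp-↭ (↭-sym perm) (∈-allFin v); p = Any.index v∈ in
      cast (sym len) p , trans (cong (lookup ww) (toℕ-injective (trans (toℕ-cast len _) (toℕ-cast (sym len) p)))) (sym (lookup-index v∈))
      where
      lookup-index : ∀ {xs : List (Fin n)} (v∈ : v ∈ xs) → v ≡ lookup xs (Any.index v∈)
      lookup-index (here p) = p
      lookup-index (there q) = lookup-index q
    ord : Fin n ⤖ Fin n
    ord = mk⤖ {to = f} (f-inj , strictlySurjective⇒surjective f-surj)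
    c : ℕ → Fin n
    c p = f (p mod n)
    toℕ-mod : ∀ p → toℕ (p mod n) ≡ p % n
    toℕ-mod p = toℕ-fromℕ< (m%n<n p n)
    c-cong : ∀ {p q} → p % n ≡ q % n → c p ≡ c q
    c-cong {p} {q} e = cong f (toℕ-injective (trans (toℕ-mod p) (trans e (sym (toℕ-mod q)))))
    c-+n : ∀ p → c (n + p) ≡ c p
    c-+n p = c-cong (trans (cong (_% n) (+-comm n p)) ([m+n]%n≡m%n p n))
    c-inj : ∀ q {a b} → a < n → b < n → c (q + a) ≡ c (q + b) → a ≡ b
    c-inj q {a} {b} a<n b<n e with ≤-total a b
    ... | inj₁ a≤b = %-injective n q a≤b b<n (trans (sym (toℕ-mod (q + a))) (trans (cong toℕ (f-inj e)) (toℕ-mod (q + b))))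
    ... | inj₂ b≤a = sym (%-injective n q b≤a a<n (trans (sym (toℕ-mod (q + b))) (trans (cong toℕ (f-inj (sym e))) (toℕ-mod (q + a)))))
    ww≡ : applyUpTo c n ≡ ww
    ww≡ = trans (cong (applyUpTo c) len) (applyUpTo-lookup ww c λ i → cong (lookup ww) (toℕ-injective (trans (toℕ-cast len _)
      (trans (toℕ-mod (toℕ i)) (m<n⇒m%n≡m (subst (toℕ i <_) (sym len) (toℕ<n i)))))))
    k-d≤n : k ∸ d ≤ n
    k-d≤n = ≤-trans (m∸n≤m k d) (≤-trans (m≤m+n k k) 2k≤n)
    L≡ : applyUpTo c (n + (k ∸ d)) ≡ ww ++ take (k ∸ d) ww
    L≡ = trans (applyUpTo-++ c n (k ∸ d)) (cong₂ _++_ ww≡ (trans (applyUpTo-cong (k ∸ d) c-+n)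
      (trans (sym (take-applyUpTo c k-d≤n)) (cong (take (k ∸ d)) ww≡))))
    seg : ℕ → ℕ → List (Fin n)
    seg p j = applyUpTo (λ t → c (p + t)) j
    fits : ∀ i → i < m → i * d + k ≤ n + (k ∸ d)
    fits i i<m = begin
      i * d + k               ≡⟨ cong (i * d +_) (m+[n∸m]≡n d≤k) ⟨
      i * d + (d + (k ∸ d))   ≡⟨ +-assoc (i * d) d _ ⟨
      i * d + d + (k ∸ d)     ≡⟨ cong (_+ (k ∸ d)) (+-comm (i * d) d) ⟩
      suc i * d + (k ∸ d)     ≤⟨ +-monoˡ-≤ (k ∸ d) (*-monoˡ-≤ d i<m) ⟩
      m * d + (k ∸ d)         ≡⟨ cong (_+ (k ∸ d)) n≡md ⟨
      n + (k ∸ d)             ∎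
      where open ≤-Reasoning
    window-seg : ∀ i → i < m → take k (drop (i * d) (ww ++ take (k ∸ d) ww)) ≡ seg (i * d) k
    window-seg i i<m with m≤n⇒∃[o]m+o≡n (fits i i<m)
    ... | o , eq = begin
      take k (drop (i * d) (ww ++ take (k ∸ d) ww))      ≡⟨ cong (λ l → take k (drop (i * d) l)) L≡ ⟨
      take k (drop (i * d) (applyUpTo c (n + (k ∸ d))))  ≡⟨ cong (λ z → take k (drop (i * d) (applyUpTo c z))) (trans (sym eq) (+-assoc (i * d) k o)) ⟩
      take k (drop (i * d) (applyUpTo c (i * d + (k + o)))) ≡⟨ cong (take k) (drop-applyUpTo c (i * d) (k + o)) ⟩
      take k (seg (i * d) (k + o))                       ≡⟨ take-applyUpTo _ (m≤m+n k o) ⟩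
      seg (i * d) k                                      ∎
      where open ≡-Reasoning
    start<n : ∀ (i : Fin m) → toℕ i * d < n
    start<n i = subst (toℕ i * d <_) (sym n≡md) (*-monoˡ-< d (toℕ<n i))
    start : Fin m → Fin n
    start i = fromℕ< (start<n i)
    toℕ-start : ∀ i → toℕ (start i) ≡ toℕ i * d
    toℕ-start i = toℕ-fromℕ< (start<n i)
    cons : Fin n → Subset n
    cons a = consecutive k ord a
    cons-seg : ∀ a → cons a ≡ setOf (seg (toℕ a) k)
    cons-seg a = cong ⋃ (trans (map-∘ (upTo k)) (cong (map ⁅_⁆) (map-upTo (λ j → f (a ⊕ j)) k)))
    window : ∀ i → Edge H (cons (start i))
    window i = subst (Edge H) (sym (trans (cons-seg (start i)) (cong (λ p → setOf (seg p k)) (toℕ-start i))))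
      (subst E (window-seg (toℕ i) (toℕ<n i)) (windows (toℕ i) (toℕ<n i)))
    C : Hypergraph k n
    C = record { Edge = λ S → ∃[ i ] S ≡ cons (start i)
               ; edge? = λ S → Finₚ.any? (λ i → ≡-dec Boolₚ._≟_ S (cons (start i)))
               ; uniform = λ { (i , refl) → uniform H (window i) } }
    toℕ-⊕ : ∀ (i : Fin m) → toℕ (i ⊕ 1) ≡ _%_ (toℕ i + 1) m {{Finₚ.nonZeroIndex i}}
    toℕ-⊕ i = toℕ-fromℕ< (m%n<n (toℕ i + 1) m {{Finₚ.nonZeroIndex i}})
    next : ∀ (i : Fin m) t → c (toℕ (start (i ⊕ 1)) + t) ≡ c (toℕ i * d + d + t)
    next i t = trans (cong (λ z → c (z + t)) (trans (toℕ-start (i ⊕ 1)) (cong (_* d) (toℕ-⊕ i)))) (wrap i {{Finₚ.nonZeroIndex i}})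
      where
      wrap : ∀ (i : Fin m) {{_ : NonZero m}} → c ((toℕ i + 1) % m * d + t) ≡ c (toℕ i * d + d + t)
      wrap i with m≤n⇒m<n∨m≡n (toℕ<n i)
      ... | inj₁ i+1<m rewrite +-comm (toℕ i) 1 | m<n⇒m%n≡m i+1<m = cong (λ z → c (z + t)) (+-comm d (toℕ i * d))
      ... | inj₂ i+1≡m = trans (cong (λ z → c (z * d + t)) (trans (cong (_% m) (trans (+-comm (toℕ i) 1) i+1≡m)) (n%n≡0 m)))
        (trans (sym (c-+n t)) (cong (λ z → c (z + t)) (trans n≡md (trans (cong (_* d) (sym i+1≡m)) (+-comm d (toℕ i * d))))))
    seg-next : ∀ i → seg (toℕ (start (i ⊕ 1))) k ≡ seg (toℕ i * d + d) k
    seg-next i = applyUpTo-cong k (next i)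
    meet : ∀ i → ∣ cons (start i) ∩ cons (start (i ⊕ 1)) ∣ ≡ k ∸ d
    meet i = begin
      ∣ cons (start i) ∩ cons (start (i ⊕ 1)) ∣
        ≡⟨ cong₂ (λ S T → ∣ S ∩ T ∣) (trans (cons-seg (start i)) (cong (λ p → setOf (seg p k)) (toℕ-start i))) (trans (cons-seg (start (i ⊕ 1))) (cong setOf (seg-next i))) ⟩
      ∣ setOf (seg p k) ∩ setOf (seg (p + d) k) ∣ ≡⟨ cong ∣_∣ common ⟩
      ∣ setOf (seg (p + d) (k ∸ d)) ∣   ≡⟨ card-setOf (seg (p + d) (k ∸ d)) ⟩
      ∑ (allFin n) (λ v → χ (v ∈? seg (p + d) (k ∸ d))) ≡⟨ ∑-unique (seg (p + d) (k ∸ d)) uniq ⟩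
      length (seg (p + d) (k ∸ d))      ≡⟨ length-applyUpTo _ (k ∸ d) ⟩
      k ∸ d ∎
      where
      open ≡-Reasoning
      p = toℕ i * d
      uniq : Unique (seg (p + d) (k ∸ d))
      uniq = Uniqₚ.applyUpTo⁺₁ _ (k ∸ d) λ {a} {b} a<b b< e → <⇒≢ a<b (c-inj (p + d) (<-≤-trans (<-trans a<b b<) k-d≤n) (<-≤-trans b< k-d≤n) e)
      common : setOf (seg p k) ∩ setOf (seg (p + d) k) ≡ setOf (seg (p + d) (k ∸ d))
      common = subset-ext to from
        where
        to : ∀ v → v Sub.∈ setOf (seg p k) ∩ setOf (seg (p + d) k) → v Sub.∈ setOf (seg (p + d) (k ∸ d))
        to v h = ∈-setOf⁺ (inside′ (∈-applyUpTo⁻ _ (∈-setOf⁻ _ (proj₁ (x∈p∩q⁻ _ _ h)))) (∈-applyUpTo⁻ _ (∈-setOf⁻ _ (proj₂ (x∈p∩q⁻ _ _ h)))))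
          where
          inside′ : (∃[ a ] a < k × v ≡ c (p + a)) → (∃[ b ] b < k × v ≡ c (p + d + b)) → v ∈ seg (p + d) (k ∸ d)
          inside′ (a , a<k , va) (b , b<k , vb) = subst (_∈ seg (p + d) (k ∸ d)) (sym vb) (∈-applyUpTo⁺ _ (m+n≤o⇒m≤o∸n (suc b) (≤-trans (≤-reflexive (cong suc (trans (+-comm b d) (sym a≡)))) a<k)))
            where
            a≡ : a ≡ d + b
            a≡ = c-inj p (<-≤-trans a<k (≤-trans (m≤m+n k k) 2k≤n)) (<-≤-trans (+-mono-≤-< d≤k b<k) 2k≤n) (trans (sym va) (trans vb (cong c (+-assoc p d b))))
        from : ∀ v → v Sub.∈ setOf (seg (p + d) (k ∸ d)) → v Sub.∈ setOf (seg p k) ∩ setOf (seg (p + d) k)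
        from v h = let b , b< , vb = ∈-applyUpTo⁻ (λ t → c (p + d + t)) (∈-setOf⁻ (seg (p + d) (k ∸ d)) h)
                       d+b<k = ≤-trans (+-monoʳ-< d b<) (≤-reflexive (m+[n∸m]≡n d≤k))
          in x∈p∩q⁺ (∈-setOf⁺ (subst (_∈ seg p k) (sym (trans vb (cong c (+-assoc p d b)))) (∈-applyUpTo⁺ _ d+b<k))
                    , ∈-setOf⁺ (subst (_∈ seg (p + d) k) (sym vb) (∈-applyUpTo⁺ _ (<-≤-trans b< (m∸n≤m k d)))))
    covering : ∀ v → ∃[ S ] Edge C S × v Sub.∈ S
    covering v = let q , fq = f-surj v
                     t = toℕ q
                     i<m = m<n*o⇒m/o<n {t} {m} {d} (subst (t <_) n≡md (toℕ<n q))
                     i = fromℕ< i<m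
                     v≡ = trans (sym fq) (trans (cong f (toℕ-injective (trans (sym (m<n⇒m%n≡m (toℕ<n q))) (sym (toℕ-mod t)))))
                            (cong c (trans (m≡m%n+[m/n]*n t d) (trans (+-comm (t % d) _) (cong (λ z → z * d + t % d) (sym (toℕ-fromℕ< i<m)))))))
                 in cons (start i) , (i , refl) ,
      subst (v Sub.∈_) (sym (trans (cons-seg (start i)) (cong (λ p → setOf (seg p k)) (toℕ-start i))))
        (∈-setOf⁺ (subst (_∈ seg (toℕ i * d) k) (sym v≡) (∈-applyUpTo⁺ (λ s → c (toℕ i * d + s)) (<-≤-trans (m%n<n t d) d≤k))))

-- Throughout d = suc d′ is the shift between consecutive edges and k = (1 + t) d + r with 0 < r < d, so that ⌈ k / d ⌉ = 2 + t.
module Units {k n : ℕ} (H : Hypergraph k n) (d′ t r : ℕ) (r>0 : 0 < r) (r≤d′ : r ≤ d′) (k≡ : k ≡ suc t * suc d′ + r) where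

  open EdgeWords H

  d : ℕ
  d = suc d′

  W : Set
  W = List (Fin n)

  -- The position of the vertex of A in its block: as the first vertex it lies in 2 + t edges, as the last one in 1 + t.
  data Kind : Set where
    first last : Kind

  before after span : Kind → ℕ
  before first = suc t * d
  before last  = t * d + d′
  after first = d′
  after last  = 0
  span first = suc (suc t)
  span last  = suc t

  data Unit : Set where
    A-unit : Kind → Fin n → Unit
    B-unit : Unit

  size blocks : Unit → ℕ
  size (A-unit κ _) = before κ + after κ
  size B-unit       = d
  blocks (A-unit κ _) = span κ
  blocks B-unit       = 1

  sizes : List Unit → ℕ
  sizes us = ∑ us size

  ∑blocks : List Unit → ℕ
  ∑blocks us = ∑ us blocks

  arrange : Unit → W → W
  arrange (A-unit κ a) l = take (before κ) l ++ a ∷ take (after κ) (drop (before κ) l)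
  arrange B-unit       l = take d l

  arrangement : List Unit → W → W
  arrangement []       l = []
  arrangement (u ∷ us) l = arrange u l ++ arrangement us (drop (size u) l)

  centres : List Unit → W
  centres []                = []
  centres (A-unit _ a ∷ us) = a ∷ centres us
  centres (B-unit ∷ us)     = centres us

  Valid : Unit → W → Set
  Valid (A-unit κ a) l = ∀ i → i < span κ → E (a ∷ take (k ∸ 1) (drop (i * d) l))
  Valid B-unit       l = E (take k l)

  AllValid : List Unit → W → Set
  AllValid []       l = ⊤
  AllValid (u ∷ us) l = Valid u l × AllValid us (drop (size u) l)

  d≤k : d ≤ k
  d≤k = ≤-trans (m≤m+n d (t * d)) (≤-trans (m≤m+n (suc t * d) r) (≤-reflexive (sym k≡)))

  k-d : k ∸ d ≡ t * d + r
  k-d = trans (cong (_∸ d) (trans k≡ (+-assoc d (t * d) r))) (m+n∸m≡n d _)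

  before<k : ∀ κ → before κ < k
  before<k first = ≤-trans (m<m+n (suc t * d) r>0) (≤-reflexive (sym k≡))
  before<k last  = ≤-trans (≤-reflexive (arith t d′)) (≤-trans (m≤m+n (suc t * d) r) (≤-reflexive (sym k≡)))
    where
    arith : ∀ t d′ → suc (t * suc d′ + d′) ≡ suc t * suc d′
    arith = solve-∀

  k-d≤before : ∀ κ → k ∸ d ≤ before κ
  k-d≤before first = ≤-trans (≤-reflexive k-d) (≤-trans (+-monoʳ-≤ (t * d) (≤-trans r≤d′ (n≤1+n d′))) (≤-reflexive (+-comm (t * d) d)))
  k-d≤before last  = ≤-trans (≤-reflexive k-d) (+-monoʳ-≤ (t * d) r≤d′)

  span-size : ∀ κ → span κ * d ≡ suc (before κ + after κ)
  span-size first = arith t d′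
    where
    arith : ∀ t d′ → suc (suc t) * suc d′ ≡ suc (suc t * suc d′ + d′)
    arith = solve-∀
  span-size last = arith t d′
    where
    arith : ∀ t d′ → suc t * suc d′ ≡ suc (t * suc d′ + d′ + 0)
    arith = solve-∀

  step≤before : ∀ κ i → i < span κ → i * d ≤ before κ
  step≤before first i (s≤s i≤) = *-monoˡ-≤ d i≤
  step≤before last  i (s≤s i≤) = ≤-trans (*-monoˡ-≤ d i≤) (m≤m+n (t * d) d′)

  rest : List Unit → W → W
  rest us l = arrangement us l ++ drop (sizes us) l

  rest-∷ : ∀ u us l → rest (u ∷ us) l ≡ arrange u l ++ rest us (drop (size u) l)
  rest-∷ u us l = trans (++-assoc (arrange u l) _ _) (cong (λ z → arrange u l ++ arrangement us (drop (size u) l) ++ z) (sym (drop-drop (size u) (sizes us) l)))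

  take-+ : ∀ i j (l : W) → take (i + j) l ≡ take i l ++ take j (drop i l)
  take-+ zero    j l       = refl
  take-+ (suc i) zero []   = refl
  take-+ (suc i) (suc j) [] = refl
  take-+ (suc i) j (x ∷ l) = cong (x ∷_) (take-+ i j l)

  length-take-≤ : ∀ {i} (l : W) → i ≤ length l → length (take i l) ≡ i
  length-take-≤ {i} l h = trans (length-take i l) (m≤n⇒m⊓n≡m h)

  take-rest : ∀ us l j → j ≤ k ∸ d → j ≤ length l → take j (rest us l) ≡ take j l
  take-rest [] l j _ _ = refl
  take-rest (A-unit κ a ∷ us) l j j≤ j≤l = begin
    take j (rest (A-unit κ a ∷ us) l)    ≡⟨ cong (take j) (trans (rest-∷ (A-unit κ a) us l) (++-assoc (take (before κ) l) _ _)) ⟩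
    take j (take (before κ) l ++ tail)   ≡⟨ take-app-≤ (take (before κ) l) tail (≤-trans (⊓-glb j≤b j≤l) (≤-reflexive (sym (length-take (before κ) l)))) ⟩
    take j (take (before κ) l)           ≡⟨ take-take j (before κ) l ⟩
    take (j ⊓ before κ) l                ≡⟨ cong (λ z → take z l) (m≤n⇒m⊓n≡m j≤b) ⟩
    take j l                             ∎
    where
    open ≡-Reasoning
    j≤b = ≤-trans j≤ (k-d≤before κ)
    tail = (a ∷ take (after κ) (drop (before κ) l)) ++ rest us (drop (before κ + after κ) l)
  take-rest (B-unit ∷ us) l j j≤ j≤l = trans (cong (take j) (rest-∷ B-unit us l)) (go (≤-total j d))
    where
    go : j ≤ d ⊎ d ≤ j → take j (take d l ++ rest us (drop d l)) ≡ take j l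
    go (inj₁ j≤d) = trans (take-app-≤ (take d l) _ (≤-trans (⊓-glb j≤d j≤l) (≤-reflexive (sym (length-take d l)))))
      (trans (take-take j d l) (cong (λ z → take z l) (m≤n⇒m⊓n≡m j≤d)))
    go (inj₂ d≤j) = begin
      take j (take d l ++ rest us (drop d l))         ≡⟨ take-app j (take d l) _ ⟩
      take j (take d l) ++ take (j ∸ length (take d l)) (rest us (drop d l))
        ≡⟨ cong₂ _++_ (take-all j (take d l) (≤-trans (≤-reflexive ld) d≤j)) (trans (cong (λ z → take z (rest us (drop d l))) (cong (j ∸_) ld))
             (take-rest us (drop d l) (j ∸ d) (≤-trans (m∸n≤m j d) j≤) (≤-trans (∸-monoˡ-≤ d j≤l) (≤-reflexive (sym (length-drop d l)))))) ⟩
      take d l ++ take (j ∸ d) (drop d l)             ≡⟨ take-+ d (j ∸ d) l ⟨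
      take (d + (j ∸ d)) l                            ≡⟨ cong (λ z → take z l) (m+[n∸m]≡n d≤j) ⟩
      take j l ∎
      where
      open ≡-Reasoning
      ld : length (take d l) ≡ d
      ld = length-take-≤ l (≤-trans d≤j j≤l)

  take-∷ : ∀ {P : W} {a X b} → length P ≤ b → take (suc b) (P ++ a ∷ X) ≡ P ++ a ∷ take (b ∸ length P) X
  take-∷ {[]}    h = refl
  take-∷ {x ∷ P} (s≤s h) = cong (x ∷_) (take-∷ {P} h)

  unit-windows : ∀ u us l → Valid u l → size u + (k ∸ d) ≤ length l → ∀ i → i < blocks u → E (take k (drop (i * d) (rest (u ∷ us) l)))
  unit-windows B-unit us l v len zero i< = subst E (sym eq) v
    where
    open ≡-Reasoning
    ld : length (take d l) ≡ d
    ld = length-take-≤ l (≤-trans (m≤m+n d _) len)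
    eq : take k (rest (B-unit ∷ us) l) ≡ take k l
    eq = begin
      take k (rest (B-unit ∷ us) l)             ≡⟨ cong (take k) (rest-∷ B-unit us l) ⟩
      take k (take d l ++ rest us (drop d l))   ≡⟨ take-app k (take d l) _ ⟩
      take k (take d l) ++ take (k ∸ length (take d l)) (rest us (drop d l))
        ≡⟨ cong₂ _++_ (take-all k (take d l) (≤-trans (≤-reflexive ld) d≤k)) (trans (cong (λ z → take z (rest us (drop d l))) (cong (k ∸_) ld))
             (take-rest us (drop d l) (k ∸ d) ≤-refl (m+n≤o⇒m≤o∸n′ (k ∸ d) d len))) ⟩
      take d l ++ take (k ∸ d) (drop d l)       ≡⟨ take-+ d (k ∸ d) l ⟨
      take (d + (k ∸ d)) l                      ≡⟨ cong (λ z → take z l) (m+[n∸m]≡n d≤k) ⟩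
      take k l                                  ∎
      where
      m+n≤o⇒m≤o∸n′ : ∀ m n → n + m ≤ length l → m ≤ length (drop n l)
      m+n≤o⇒m≤o∸n′ m n h = ≤-trans (m+n≤o⇒m≤o∸n m (≤-trans (≤-reflexive (+-comm m n)) h)) (≤-reflexive (sym (length-drop n l)))
  unit-windows B-unit us l v len (suc i) (s≤s ())
  unit-windows (A-unit κ a) us l v len i i< = E-↭ perm (v i i<)
    where
    b = before κ
    c = after κ
    P = take b l
    Q = take c (drop b l)
    l′ = drop (b + c) l
    L = rest us l′
    x = i * d
    x≤b = step≤before κ i i<
    lP : length P ≡ b
    lP = length-take-≤ l (≤-trans (≤-trans (m≤m+n b c) (m≤m+n (b + c) _)) len)
    lQ : length Q ≡ c
    lQ = length-take-≤ (drop b l) (≤-trans (m+n≤o⇒m≤o∸n c (≤-trans (≤-reflexive (+-comm c b)) (≤-trans (m≤m+n (b + c) _) len))) (≤-reflexive (sym (length-drop b l))))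
    l-split : l ≡ P ++ Q ++ l′
    l-split = trans (sym (take++drop≡id b l)) (cong (P ++_) (trans (sym (take++drop≡id c (drop b l))) (cong (Q ++_) (drop-drop b c l))))
    D = drop x P
    lD : length D ≡ b ∸ x
    lD = trans (length-drop x P) (cong (_∸ x) lP)
    y = k ∸ 1 ∸ length D
    D≤ : length D ≤ k ∸ 1
    D≤ = ≤-trans (≤-reflexive lD) (≤-trans (m∸n≤m b x) (≤-pred (≤-trans (before<k κ) (≤-reflexive (sym k′)))))
      where
      k′ : suc (k ∸ 1) ≡ k
      k′ = trans (+-comm 1 (k ∸ 1)) (m∸n+n≡m (≤-trans (s≤s z≤n) d≤k))
    y-c : y ∸ length Q ≤ k ∸ d
    y-c = begin
      y ∸ length Q                   ≡⟨ cong₂ (λ p q → k ∸ 1 ∸ p ∸ q) lD lQ ⟩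
      k ∸ 1 ∸ (b ∸ x) ∸ c            ≡⟨ trans (cong (_∸ c) (∸-+-assoc k 1 (b ∸ x))) (∸-+-assoc k (1 + (b ∸ x)) c) ⟩
      k ∸ (1 + (b ∸ x) + c)          ≤⟨ ∸-monoʳ-≤ k d≤ ⟩
      k ∸ d                          ∎
      where
      open ≤-Reasoning
      d≤ : d ≤ 1 + (b ∸ x) + c
      d≤ = +-cancelʳ-≤ x d _ (begin
        d + x                    ≤⟨ *-monoˡ-≤ d i< ⟩
        span κ * d               ≡⟨ span-size κ ⟩
        suc (b + c)              ≡⟨ cong (λ z → suc (z + c)) (m∸n+n≡m x≤b) ⟨
        suc (b ∸ x + x + c)      ≡⟨ arith (b ∸ x) x c ⟩
        1 + (b ∸ x) + c + x      ∎)
        where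
        arith : ∀ p q r → suc (p + q + r) ≡ 1 + p + r + q
        arith = solve-∀
    tails : take y (Q ++ L) ≡ take y (Q ++ l′)
    tails = trans (take-app y Q L) (trans (cong (take y Q ++_) (take-rest us l′ (y ∸ length Q) y-c
      (≤-trans y-c (≤-trans (m+n≤o⇒m≤o∸n (k ∸ d) (≤-trans (≤-reflexive (+-comm (k ∸ d) (b + c))) len)) (≤-reflexive (sym (length-drop (b + c) l))))))) (sym (take-app y Q l′)))
    left : take k (drop x (rest (A-unit κ a ∷ us) l)) ≡ D ++ a ∷ take y (Q ++ l′)
    left = begin
      take k (drop x (rest (A-unit κ a ∷ us) l))    ≡⟨ cong (take k ∘ drop x) (trans (rest-∷ (A-unit κ a) us l) (++-assoc P (a ∷ Q) L)) ⟩
      take k (drop x (P ++ a ∷ Q ++ L))             ≡⟨ cong (take k) (drop-app-≤ P _ (≤-trans x≤b (≤-reflexive (sym lP)))) ⟩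
      take k (D ++ a ∷ Q ++ L)                      ≡⟨ cong (λ z → take z (D ++ a ∷ Q ++ L)) k′ ⟨
      take (suc (k ∸ 1)) (D ++ a ∷ Q ++ L)          ≡⟨ take-∷ {D} D≤ ⟩
      D ++ a ∷ take y (Q ++ L)                      ≡⟨ cong (λ z → D ++ a ∷ z) tails ⟩
      D ++ a ∷ take y (Q ++ l′)                     ∎
      where
      open ≡-Reasoning
      k′ : suc (k ∸ 1) ≡ k
      k′ = trans (+-comm 1 (k ∸ 1)) (m∸n+n≡m (≤-trans (s≤s z≤n) d≤k))
    right : take (k ∸ 1) (drop x l) ≡ D ++ take y (Q ++ l′)
    right = begin
      take (k ∸ 1) (drop x l)                       ≡⟨ cong (take (k ∸ 1) ∘ drop x) l-split ⟩
      take (k ∸ 1) (drop x (P ++ Q ++ l′))          ≡⟨ cong (take (k ∸ 1)) (drop-app-≤ P _ (≤-trans x≤b (≤-reflexive (sym lP)))) ⟩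
      take (k ∸ 1) (D ++ Q ++ l′)                   ≡⟨ take-app (k ∸ 1) D _ ⟩
      take (k ∸ 1) D ++ take y (Q ++ l′)            ≡⟨ cong (_++ take y (Q ++ l′)) (take-all (k ∸ 1) D D≤) ⟩
      D ++ take y (Q ++ l′)                         ∎
      where open ≡-Reasoning
    perm : a ∷ take (k ∸ 1) (drop x l) ↭ take k (drop x (rest (A-unit κ a ∷ us) l))
    perm = ↭-trans (↭-reflexive (cong (a ∷_) right)) (↭-trans (↭-sym (shift a D _)) (↭-reflexive (sym left)))

  length-arrange : ∀ u l → size u ≤ length l → length (arrange u l) ≡ blocks u * d
  length-arrange B-unit l h = trans (length-take-≤ l h) (sym (+-identityʳ d))
  length-arrange (A-unit κ a) l h = begin
    length (take (before κ) l ++ a ∷ take (after κ) (drop (before κ) l)) ≡⟨ length-++ (take (before κ) l) ⟩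
    length (take (before κ) l) + suc (length (take (after κ) (drop (before κ) l)))
      ≡⟨ cong₂ (λ p q → p + suc q) (length-take-≤ l (≤-trans (m≤m+n _ _) h))
           (length-take-≤ (drop (before κ) l) (≤-trans (m+n≤o⇒m≤o∸n (after κ) (≤-trans (≤-reflexive (+-comm (after κ) _)) h)) (≤-reflexive (sym (length-drop (before κ) l))))) ⟩
    before κ + suc (after κ)                       ≡⟨ trans (+-suc _ _) (sym (span-size κ)) ⟩
    span κ * d                                     ∎
    where open ≡-Reasoning

  windows : ∀ us l → AllValid us l → sizes us + (k ∸ d) ≤ length l → ∀ i → i < ∑blocks us → E (take k (drop (i * d) (rest us l)))
  windows (u ∷ us) l (v , vs) len i i< with i <? blocks u
  ... | yes i<u = unit-windows u us l v (≤-trans (+-monoˡ-≤ (k ∸ d) (m≤m+n (size u) (sizes us))) len) i i<u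
  ... | no i≮u = subst (λ z → E (take k z)) (sym eq) (windows us (drop (size u) l) vs len′ (i ∸ blocks u) i′<)
    where
    u≤i = ≮⇒≥ i≮u
    i′< : i ∸ blocks u < ∑blocks us
    i′< = +-cancelˡ-< (blocks u) _ _ (≤-<-trans (≤-reflexive (m+[n∸m]≡n u≤i)) i<)
    len′ : sizes us + (k ∸ d) ≤ length (drop (size u) l)
    len′ = ≤-trans (m+n≤o⇒m≤o∸n _ (≤-trans (≤-reflexive (trans (+-comm _ (size u)) (sym (+-assoc (size u) _ _)))) len)) (≤-reflexive (sym (length-drop (size u) l)))
    la = length-arrange u l (≤-trans (≤-trans (m≤m+n (size u) (sizes us)) (m≤m+n _ (k ∸ d))) len)
    eq : drop (i * d) (rest (u ∷ us) l) ≡ drop ((i ∸ blocks u) * d) (rest us (drop (size u) l))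
    eq = trans (cong (drop (i * d)) (rest-∷ u us l)) (trans (drop-app-≥ (arrange u l) _ (≤-trans (≤-reflexive la) (*-monoˡ-≤ d u≤i)))
      (cong (λ z → drop z (rest us (drop (size u) l))) (trans (cong (i * d ∸_) la) (sym (*-distribʳ-∸ d i (blocks u))))))

  arrange-↭ : ∀ κ a l → arrange (A-unit κ a) l ↭ a ∷ take (before κ + after κ) l
  arrange-↭ κ a l = ↭-trans (shift a (take (before κ) l) _) (prep a (↭-reflexive (sym (take-+ (before κ) (after κ) l))))

  arrangement-↭ : ∀ us l → arrangement us l ↭ take (sizes us) l ++ centres us
  arrangement-↭ [] l = ↭-refl
  arrangement-↭ (A-unit κ a ∷ us) l = ↭-trans (++⁺ (arrange-↭ κ a l) (arrangement-↭ us (drop s l))) (↭-trans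
    (↭-reflexive (cong (a ∷_) (trans (sym (++-assoc (take s l) _ (centres us))) (cong (_++ centres us) (sym (take-+ s (sizes us) l))))))
    (↭-sym (shift a (take (s + sizes us) l) (centres us))))
    where
    s = before κ + after κ
  arrangement-↭ (B-unit ∷ us) l = ↭-trans (++⁺ˡ (take d l) (arrangement-↭ us (drop d l)))
    (↭-reflexive (trans (sym (++-assoc (take d l) _ (centres us))) (cong (_++ centres us) (sym (take-+ d (sizes us) l)))))

  units⇒cycle : ∀ m us bs ys → n ≡ m * d → ∑blocks us ≡ m → k + k ≤ n → sizes us ≡ length bs → k ∸ d ≤ length bs → take (k ∸ d) ys ≡ take (k ∸ d) bs → k ∸ d ≤ length ys →
                AllValid us (bs ++ ys) → bs ++ centres us ↭ allFin n → HasHamiltonCycle (k ∸ d) H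
  units⇒cycle m us bs ys n≡ m≡ 2k≤n s≡ kd≤ ys≡ kd≤y valid perm = list⇒cycle H d m ww z<s d≤k n≡ 2k≤n (≤-trans z<s d≤k)
    (↭-trans (arrangement-↭ us (bs ++ ys)) (↭-trans (↭-reflexive (cong (_++ centres us) (take-++ bs ys (sym s≡)))) perm))
    (λ i i<m → subst E (win i i<m) (windows us l valid (≤-trans (+-mono-≤ (≤-reflexive s≡) kd≤y) (≤-reflexive (sym (length-++ bs)))) i (≤-trans i<m (≤-reflexive (sym m≡)))))
    where
    l = bs ++ ys
    ww = arrangement us l
    rest≡ : rest us l ≡ ww ++ ys
    rest≡ = cong (ww ++_) (drop-++ bs ys (sym s≡))
    lww : length ww ≡ m * d
    lww = trans (↭-length (↭-trans (arrangement-↭ us l) (↭-trans (↭-reflexive (cong (_++ centres us) (take-++ bs ys (sym s≡)))) perm)))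
      (trans (length-tabulate id) n≡)
    kd≤ww : k ∸ d ≤ length ww
    kd≤ww = ≤-trans (m∸n≤m k d) (≤-trans (≤-trans (m≤m+n k k) 2k≤n) (≤-reflexive (trans n≡ (sym lww))))
    front : take (k ∸ d) ys ≡ take (k ∸ d) ww
    front = trans ys≡ (trans (sym (take-app-≤ bs ys kd≤)) (trans (sym (take-rest us l (k ∸ d) ≤-refl (≤-trans kd≤ (≤-trans (m≤m+n _ _) (≤-reflexive (sym (length-++ bs)))))))
      (trans (cong (take (k ∸ d)) rest≡) (take-app-≤ ww ys kd≤ww))))
    win : ∀ i → i < m → take k (drop (i * d) (rest us l)) ≡ take k (drop (i * d) (ww ++ take (k ∸ d) ww))
    win i i<m = begin
      take k (drop x (rest us l))              ≡⟨ cong (take k ∘ drop x) rest≡ ⟩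
      take k (drop x (ww ++ ys))               ≡⟨ cong (λ z → take k (drop x (ww ++ z))) (take++drop≡id (k ∸ d) ys) ⟨
      take k (drop x (ww ++ take (k ∸ d) ys ++ drop (k ∸ d) ys)) ≡⟨ cong (λ z → take k (drop x z)) (++-assoc ww _ _) ⟨
      take k (drop x ((ww ++ take (k ∸ d) ys) ++ drop (k ∸ d) ys)) ≡⟨ cong (take k) (drop-app-≤ (ww ++ take (k ∸ d) ys) _ x≤) ⟩
      take k (drop x (ww ++ take (k ∸ d) ys) ++ drop (k ∸ d) ys) ≡⟨ take-app-≤ (drop x (ww ++ take (k ∸ d) ys)) _ k≤ ⟩
      take k (drop x (ww ++ take (k ∸ d) ys))  ≡⟨ cong (λ z → take k (drop x (ww ++ z))) front ⟩
      take k (drop x (ww ++ take (k ∸ d) ww))  ∎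
      where
      open ≡-Reasoning
      x = i * d
      ltot : length (ww ++ take (k ∸ d) ys) ≡ m * d + (k ∸ d)
      ltot = trans (length-++ ww) (cong₂ _+_ lww (length-take-≤ ys kd≤y))
      bound : x + k ≤ length (ww ++ take (k ∸ d) ys)
      bound = ≤-trans (≤-reflexive (trans (cong (x +_) (sym (m+[n∸m]≡n d≤k))) (trans (sym (+-assoc x d (k ∸ d))) (cong (_+ (k ∸ d)) (+-comm x d)))))
        (≤-trans (+-monoˡ-≤ (k ∸ d) (*-monoˡ-≤ d i<m)) (≤-reflexive (sym ltot)))
      x≤ : x ≤ length (ww ++ take (k ∸ d) ys)
      x≤ = ≤-trans (m≤m+n x k) bound
      k≤ : k ≤ length (drop x (ww ++ take (k ∸ d) ys))
      k≤ = ≤-trans (m+n≤o⇒m≤o∸n k (≤-trans (≤-reflexive (+-comm k x)) bound)) (≤-reflexive (sym (length-drop x _)))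

full-unique-↭ : ∀ {n} {l : List (Fin n)} → Unique l → (∀ v → v ∈ l) → l ↭ allFin n
full-unique-↭ {n} u f = ∼bag⇒↭ (unique∧set⇒bag u uniqueV (mk⇔ (λ _ → ∈-allFin _) (λ _ → f _)))

seven-small : ∀ {n P₈} P → P₈ ≡ 8 * P → 0 < n → ∀ {a b c d e f g} → P₈ * a ≤ n → P₈ * b ≤ n → P₈ * c ≤ n → P₈ * d ≤ n → P₈ * e ≤ n →
              P₈ * f ≤ n → P₈ * g ≤ n → P * (a + (b + (c + (d + (e + (f + g)))))) < n
seven-small {n} P refl n>0 {a} {b} {c} {d} {e} {f} {g} ha hb hc hd he hf hg = *-cancelˡ-< 8 _ _ (begin-strict
  8 * (P * (a + (b + (c + (d + (e + (f + g))))))) ≡⟨ arith P a b c d e f g ⟩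
  8 * P * a + (8 * P * b + (8 * P * c + (8 * P * d + (8 * P * e + (8 * P * f + 8 * P * g)))))
    ≤⟨ +-mono-≤ ha (+-mono-≤ hb (+-mono-≤ hc (+-mono-≤ hd (+-mono-≤ he (+-mono-≤ hf hg))))) ⟩
  n + (n + (n + (n + (n + (n + n)))))  <⟨ m<n+m _ n>0 ⟩
  n + (n + (n + (n + (n + (n + (n + n)))))) ≡⟨ arith₂ n ⟩
  8 * n ∎)
  where
  open ≤-Reasoning
  arith : ∀ P a b c d e f g → 8 * (P * (a + (b + (c + (d + (e + (f + g))))))) ≡ 8 * P * a + (8 * P * b + (8 * P * c + (8 * P * d + (8 * P * e + (8 * P * f + 8 * P * g)))))
  arith = solve-∀
  arith₂ : ∀ n → n + (n + (n + (n + (n + (n + (n + n)))))) ≡ 8 * n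
  arith₂ = solve-∀

-- The hierarchy of constants: a word of length i is nice if it extends to fewer than a 1/κᵢ fraction of the possible edges in B.
module Numbers (k d′ t : ℕ) where

  d s σ : ℕ
  d = suc d′
  s = suc (suc t)
  σ = suc t * d + d′

  abstract
    c₀ c₁ c₂ c₃ P P₈ G′ : ℕ
    c₀ = 8 * σ + s * (d + 2 * σ)
    c₁ = 12 + 4 * s
    c₂ = 6
    c₃ = 2 * (c₀ + 3 * σ + (1 + 2 * k + (suc k + (k + (c₀ + 3 * σ))))) + 4
    P = s * d * (c₁ + c₂ + c₃) + (32 * k + 12 + 6 * c₀)
    P₈ = 8 * P
    G′ = P₈

    c₀≡ : c₀ ≡ 8 * σ + s * (d + 2 * σ)
    c₀≡ = refl
    c₁≡ : c₁ ≡ 12 + 4 * s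
    c₁≡ = refl
    c₂≡ : c₂ ≡ 6
    c₂≡ = refl
    c₃≡ : c₃ ≡ 2 * (c₀ + 3 * σ + (1 + 2 * k + (suc k + (k + (c₀ + 3 * σ))))) + 4
    c₃≡ = refl
    P₈≡ : P₈ ≡ 8 * P
    P₈≡ = refl
    G′≡ : G′ ≡ P₈
    G′≡ = refl
    sd≤P : s * d * (c₁ + c₂ + c₃) ≤ P
    sd≤P = m≤m+n _ (32 * k + 12 + 6 * c₀)
    tail≤P : 32 * k + 12 + 6 * c₀ ≤ P
    tail≤P = m≤n+m _ (s * d * (c₁ + c₂ + c₃))

  P>0 : 0 < P
  P>0 = ≤-trans (≤-trans (s≤s z≤n) (m≤n⇒m≤n+o (6 * c₀) (m≤n+m 12 (32 * k)))) tail≤P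

  P₈>0 : 0 < P₈
  P₈>0 = subst (0 <_) (sym P₈≡) (≤-trans P>0 (m≤m+n P (7 * P)))

  G G₁ : ℕ
  G = suc G′ * 4
  G₁ = suc G′ * 2

  P₈≤G₁ : P₈ ≤ G₁
  P₈≤G₁ = ≤-trans (≤-reflexive (sym G′≡)) (≤-trans (n≤1+n G′) (m≤m*n (suc G′) 2))

  abstract
    Ko Kc Nm : ℕ
    Ko = P₈
    Kc = 32 * P + 12 * G * suc k
    Nm = 3 * σ + (k + k)

    Ko≡ : Ko ≡ P₈
    Ko≡ = refl
    32P≤Kc : 32 * P ≤ Kc
    32P≤Kc = m≤m+n (32 * P) (12 * G * suc k)
    12G≤Kc : 12 * G * suc k ≤ Kc
    12G≤Kc = m≤n+m (12 * G * suc k) (32 * P)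
    3σ≤Nm : 3 * σ ≤ Nm
    3σ≤Nm = m≤m+n (3 * σ) (k + k)
    2k≤Nm : k + k ≤ Nm
    2k≤Nm = m≤n+m (k + k) (3 * σ)

  Ko>0 : 0 < Ko
  Ko>0 = subst (0 <_) (sym Ko≡) P₈>0

  q₁ q₂ q₃ q₄ q₅ q₆ q₇ q₈ q₉ : ℕ
  q₁ = G₁ ^ (k + k) * (1 + (k * (k * 1) + (suc (k + k) * (k * 1) + Kc * (suc (k + k) * (k * 1)))))
  q₂ = G ^ ((k ∸ 1) + (k ∸ 1)) * (1 + (suc (k ∸ 1) * 1 + suc ((k ∸ 1) + (k ∸ 1)) * (k * 1)))
  q₃ = G ^ Nm * (1 + (k * (k * 1) + (suc Nm * (k * 1) + suc Nm * (k * 1))))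
  q₄ = G ^ (k ∸ 1) * (1 + (2 * σ + s * (d + 2 * σ)))
  q₅ = 1 + (k + (k * (suc k * 1) + (suc k * (k * 1) + suc k * (k * 1))))
  q₆ = 4 * 2 ^ (k ∸ 1)
  q₇ = 24 * P * Ko
  q₈ = 27 * Ko * G * σ
  q₉ = 16 * P * s

  qs : List ℕ
  qs = q₁ ∷ q₂ ∷ q₃ ∷ q₄ ∷ q₅ ∷ q₆ ∷ q₇ ∷ q₈ ∷ q₉ ∷ []

  abstract
    Q : ℕ
    Q = suc (∑ qs id)
    <Q : ∀ {x} → x ∈ qs → x < Q
    <Q x∈ = s≤s (∑-∈ {xs = qs} id x∈)

  q₁<Q : q₁ < Q
  q₁<Q = <Q (here refl)
  q₂<Q : q₂ < Q
  q₂<Q = <Q (there (here refl))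
  q₃<Q : q₃ < Q
  q₃<Q = <Q (there (there (here refl)))
  q₄<Q : q₄ < Q
  q₄<Q = <Q (there (there (there (here refl))))
  q₅<Q : q₅ < Q
  q₅<Q = <Q (there (there (there (there (here refl)))))
  q₆<Q : q₆ < Q
  q₆<Q = <Q (there (there (there (there (there (here refl))))))
  q₇<Q : q₇ < Q
  q₇<Q = <Q (there (there (there (there (there (there (here refl)))))))
  q₈<Q : q₈ < Q
  q₈<Q = <Q (there (there (there (there (there (there (there (here refl))))))))
  q₉<Q : q₉ < Q
  q₉<Q = <Q (there (there (there (there (there (there (there (there (here refl)))))))))

  Q>0 : 0 < Q
  Q>0 = ≤-<-trans z≤n q₁<Q

  kap : ℕ → ℕ
  kap zero    = 1
  kap (suc j) = Q * (kap j * kap j)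

  m q₀ : ℕ
  m = k ∸ 1
  q₀ = suc (cubeConst m (kap (k ∸ 1)) * (1 + ((m + m) + suc (m + m) * (k * 1))))

  z₁ z₂ z₃ : ℕ
  z₁ = P₈
  z₂ = Q
  z₃ = 3 * ((Q * kap (k ∸ 1) + q₀ + 4) * (c₀ + k + 1))

  zs : List ℕ
  zs = z₁ ∷ z₂ ∷ z₃ ∷ []

  abstract
    Z : ℕ
    Z = ∑ zs id
    ≤Z : ∀ {x} → x ∈ zs → x ≤ Z
    ≤Z x∈ = ∑-∈ {xs = zs} id x∈

  z₁≤Z : z₁ ≤ Z
  z₁≤Z = ≤Z (here refl)
  z₂≤Z : z₂ ≤ Z
  z₂≤Z = ≤Z (there (here refl))
  z₃≤Z : z₃ ≤ Z
  z₃≤Z = ≤Z (there (there (here refl)))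

  l₁ l₂ l₃ l₄ l₅ : ℕ
  l₁ = Q * (kap (k ∸ 1) * kap (k ∸ 1))
  l₂ = q₀ * kap (k ∸ 1)
  l₃ = Z * kap (k ∸ 1)
  l₄ = 2 * (Z * Q)
  l₅ = kap (k ∸ 1)

  ls : List ℕ
  ls = l₁ ∷ l₂ ∷ l₃ ∷ l₄ ∷ l₅ ∷ []

  abstract
    Λ : ℕ
    Λ = ∑ ls id
    ≤Λ : ∀ {x} → x ∈ ls → x ≤ Λ
    ≤Λ x∈ = ∑-∈ {xs = ls} id x∈

  l₁≤Λ : l₁ ≤ Λ
  l₁≤Λ = ≤Λ (here refl)
  l₂≤Λ : l₂ ≤ Λ
  l₂≤Λ = ≤Λ (there (here refl))
  l₃≤Λ : l₃ ≤ Λ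
  l₃≤Λ = ≤Λ (there (there (here refl)))
  l₄≤Λ : l₄ ≤ Λ
  l₄≤Λ = ≤Λ (there (there (there (here refl))))
  l₅≤Λ : l₅ ≤ Λ
  l₅≤Λ = ≤Λ (there (there (there (there (here refl)))))

  n₁ n₂ n₃ n₄ n₅ n₆ n₇ n₈ : ℕ
  n₁ = Q * (Nm * Nm)
  n₂ = Q * kap (k ∸ 1) * (k * k)
  n₃ = q₀ * ((m + m) * (m + m))
  n₄ = Q * k
  n₅ = Z
  n₆ = 2 * (Z * Q) * (m * m)
  n₇ = 9 * G * k
  n₈ = k + k

  ns : List ℕ
  ns = n₁ ∷ n₂ ∷ n₃ ∷ n₄ ∷ n₅ ∷ n₆ ∷ n₇ ∷ n₈ ∷ []

  abstract
    n₀ : ℕ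
    n₀ = ∑ ns id
    ≤n₀ : ∀ {x} → x ∈ ns → x ≤ n₀
    ≤n₀ x∈ = ∑-∈ {xs = ns} id x∈

  n₁≤n₀ : n₁ ≤ n₀
  n₁≤n₀ = ≤n₀ (here refl)
  n₂≤n₀ : n₂ ≤ n₀
  n₂≤n₀ = ≤n₀ (there (here refl))
  n₃≤n₀ : n₃ ≤ n₀
  n₃≤n₀ = ≤n₀ (there (there (here refl)))
  n₄≤n₀ : n₄ ≤ n₀
  n₄≤n₀ = ≤n₀ (there (there (there (here refl))))
  n₅≤n₀ : n₅ ≤ n₀
  n₅≤n₀ = ≤n₀ (there (there (there (there (here refl)))))
  n₆≤n₀ : n₆ ≤ n₀
  n₆≤n₀ = ≤n₀ (there (there (there (there (there (here refl))))))
  n₇≤n₀ : n₇ ≤ n₀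
  n₇≤n₀ = ≤n₀ (there (there (there (there (there (there (here refl)))))))
  n₈≤n₀ : n₈ ≤ n₀
  n₈≤n₀ = ≤n₀ (there (there (there (there (there (there (there (here refl))))))))

  κ : ℕ → ℕ
  κ zero    = Λ
  κ (suc i) = kap (k ∸ suc i)

  kap>0 : ∀ j → 0 < kap j
  kap>0 zero    = z<s
  kap>0 (suc j) = *-mono-< {0} {Q} {0} Q>0 (*-mono-< {0} {kap j} {0} (kap>0 j) (kap>0 j))

  kap-step : ∀ j → kap j ≤ kap (suc j)
  kap-step j = ≤-trans (≤-reflexive (sym (*-identityˡ (kap j)))) (*-mono-≤ Q>0 (≤-trans (≤-reflexive (sym (*-identityˡ (kap j)))) (*-monoˡ-≤ (kap j) (kap>0 j))))

  kap-mono : ∀ {i j} → i ≤ j → kap i ≤ kap j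
  kap-mono {i} i≤j with m≤n⇒∃[o]m+o≡n i≤j
  ... | o , refl = go o
    where
    go : ∀ o → kap i ≤ kap (i + o)
    go zero    = ≤-reflexive (cong kap (sym (+-identityʳ i)))
    go (suc o) = ≤-trans (go o) (≤-trans (kap-step (i + o)) (≤-reflexive (cong kap (sym (+-suc i o)))))

  κ-mono : ∀ {i j} → i ≤ j → κ j ≤ κ i
  κ-mono {zero}  {zero}  _ = ≤-refl
  κ-mono {zero}  {suc j} _ = ≤-trans (kap-mono (∸-monoʳ-≤ k (s≤s z≤n))) l₅≤Λ
  κ-mono {suc i} {suc j} h = kap-mono (∸-monoʳ-≤ k h)

  κ-square : ∀ i → i < k → Q * (κ (suc i) * κ (suc i)) ≤ κ i
  κ-square zero    i<k = l₁≤Λ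
  κ-square (suc i) i<k = ≤-reflexive (cong kap (sym (+-∸-assoc 1 i<k)))

  κ-bottom : 0 < κ k
  κ-bottom = go k refl
    where
    go : ∀ j → j ≡ k → 0 < κ j
    go zero    _ = <-≤-trans (kap>0 (k ∸ 1)) l₅≤Λ
    go (suc j) _ = kap>0 (k ∸ suc j)

  record Hierarchy (κ : ℕ → ℕ) : Set where
    field
      square  : ∀ i → i < k → Q * (κ (suc i) * κ (suc i)) ≤ κ i
      bottom  : 0 < κ k
      Q≤κ₁    : Q ≤ κ 1
      Qκ₁≤n₀  : Q * κ 1 * (k * k) ≤ n₀
      q₀κ₁≤κ₀ : q₀ * κ 1 ≤ κ 0
      Zκ₁≤κ₀  : Z * κ 1 ≤ κ 0
      2ZQ≤κ₀  : 2 * (Z * Q) ≤ κ 0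
      budget  : 3 * ((Q * κ 1 + q₀ + 4) * (c₀ + k + 1)) ≤ Z
      cube    : cubeConst m (κ 1) * (1 + ((m + m) + suc (m + m) * (k * 1))) < q₀

  hierarchy : 1 < k → Hierarchy κ
  hierarchy k>1 = record
    { square = κ-square ; bottom = κ-bottom ; Qκ₁≤n₀ = n₂≤n₀ ; q₀κ₁≤κ₀ = l₂≤Λ ; Zκ₁≤κ₀ = l₃≤Λ ; 2ZQ≤κ₀ = l₄≤Λ ; budget = z₃≤Z ; cube = ≤-refl
    ; Q≤κ₁ = ≤-trans (≤-reflexive (sym (*-identityʳ Q))) (kap-mono {1} {k ∸ 1} (∸-monoˡ-≤ 1 k>1)) }

module NiceWords {k n : ℕ} (H : Hypergraph k n) (B : Subset n) (κ : ℕ → ℕ)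
                 (κ-mono : ∀ {i j} → i ≤ j → κ j ≤ κ i) (n>0 : 0 < n) where

  open EdgeWords H public

  W : Set
  W = List (Fin n)

  InB?′ : ∀ v → Dec (InB B v)
  InB?′ = InB? B

  cnt : W → ℕ
  cnt T = ΣW (k ∸ length T) (λ U → χ (all? InB?′ U ×-dec E? (T ++ U)))

  Nice : W → Set
  Nice T = κ (length T) * cnt T < n ^ (k ∸ length T)

  abstract
   nice? : ∀ T → Dec (Nice T)
   nice? T = κ (length T) * cnt T <? n ^ (k ∸ length T)

  Nice-↭ : ∀ {S T} → S ↭ T → Nice S → Nice T
  Nice-↭ {S} {T} p h = subst₂ (λ t c → κ t * c < n ^ (k ∸ t)) (↭-length p) eq h
    where
    eq : cnt S ≡ cnt T
    eq rewrite ↭-length p = ΣW-cong (k ∸ length T) λ U _ → ≤-antisym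
      (χ-mono _ (all? InB?′ U ×-dec E? (T ++ U)) (λ { (b , e) → b , E-↭ (++⁺ʳ U p) e }))
      (χ-mono _ (all? InB?′ U ×-dec E? (S ++ U)) (λ { (b , e) → b , E-↭ (++⁺ʳ U (↭-sym p)) e }))

  Bad : W → ℕ → ℕ → W → Set
  Bad T i j X = (length T + j < k × i + j ≤ length X) ×
                (All (InB B) (take j (drop i X)) × ¬ Nice (T ++ take j (drop i X)))

  abstract
   bad? : ∀ T i j X → Dec (Bad T i j X)
   bad? T i j X = ((length T + j <? k) ×-dec (i + j ≤? length X)) ×-dec
                  (all? InB?′ (take j (drop i X)) ×-dec ¬? (nice? (T ++ take j (drop i X))))

  bad : W → ℕ → ℕ → W → ℕ
  bad T i j X = χ (bad? T i j X)

  bad-0 : ∀ {T i j X} → bad T i j X ≡ 0 → All (InB B) X → length T + j < k → i + j ≤ length X →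
          Nice (T ++ take j (drop i X))
  bad-0 {T} {i} {j} {X} h b t<k i≤ = decidable-stable (nice? (T ++ take j (drop i X)))
    λ ¬p → χ-zero (bad? T i j X) h ((t<k , i≤) , Allₚ.take⁺ j (Allₚ.drop⁺ i b) , ¬p)

  small-0 : ∀ {q N f} → (∀ l → length l ≡ N → f l ≡ 0) → Small q 1 N f
  small-0 {q} {N} h = small (≤-trans (≤-reflexive (trans (cong (q *_) (trans (ΣW-cong N h) (ΣW-zero N))) (*-zeroʳ q))) z≤n)

  -- Averaging cnt over the extensions of T.
  small-extension : ∀ {q T} j → Nice T → length T + suc j ≤ k → q * κ (suc (length T)) ≤ κ (length T) →
                    Small q 1 (suc j) (λ Y → χ (all? InB?′ Y ×-dec ¬? (nice? (T ++ Y))))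
  small-extension {q} {T} j niceT t+j≤k hq with m≤n⇒∃[o]m+o≡n t+j≤k
  ... | c , eq = small (<⇒≤ (*-cancelʳ-< (n ^ c) _ _ (begin-strict
      q * S * n ^ c                    ≡⟨ *-assoc q S _ ⟩
      q * (S * n ^ c)                  ≡⟨ cong (q *_) (trans (*-comm S _) (sym (ΣW-* (suc j) (n ^ c) (λ Y → χ (F? Y))))) ⟩
      q * ΣW (suc j) (λ Y → n ^ c * χ (F? Y)) ≤⟨ *-monoʳ-≤ q (ΣW-mono (suc j) per) ⟩
      q * ΣW (suc j) (λ Y → κ (suc (length T)) * cnt′ Y) ≡⟨ cong (q *_) (ΣW-* (suc j) (κ (suc (length T))) cnt′) ⟩
      q * (κ (suc (length T)) * ΣW (suc j) cnt′) ≡⟨ *-assoc q _ _ ⟨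
      q * κ (suc (length T)) * ΣW (suc j) cnt′ ≤⟨ *-monoˡ-≤ _ hq ⟩
      κ (length T) * ΣW (suc j) cnt′   ≡⟨ cong (κ (length T) *_) total ⟩
      κ (length T) * cnt T             <⟨ niceT ⟩
      n ^ (k ∸ length T)               ≡⟨ cong (n ^_) k-t ⟩
      n ^ (suc j + c)                  ≡⟨ ^-distribˡ-+-* n (suc j) c ⟩
      n ^ suc j * n ^ c                ≡⟨ cong (_* n ^ c) (*-identityˡ (n ^ suc j)) ⟨
      1 * n ^ suc j * n ^ c            ∎)))
    where
    open ≤-Reasoning
    F? : ∀ Y → Dec (All (InB B) Y × ¬ Nice (T ++ Y))
    F? Y = all? InB?′ Y ×-dec ¬? (nice? (T ++ Y))
    S = ΣW (suc j) (λ Y → χ (F? Y))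
    cnt′ : W → ℕ
    cnt′ Y = ΣW c (λ U → χ (all? InB?′ (Y ++ U) ×-dec E? (T ++ (Y ++ U))))
    k-t : k ∸ length T ≡ suc j + c
    k-t = trans (cong (_∸ length T) (trans (sym eq) (+-assoc (length T) (suc j) c))) (m+n∸m≡n (length T) _)
    total : ΣW (suc j) cnt′ ≡ cnt T
    total rewrite k-t = sym (ΣW-++ (suc j) c (λ U → χ (all? InB?′ U ×-dec E? (T ++ U))))
    per : ∀ Y → length Y ≡ suc j → n ^ c * χ (F? Y) ≤ κ (suc (length T)) * cnt′ Y
    per Y e = χ-≤ (F? Y) λ { (b , ¬nice) → begin
      n ^ c                                      ≡⟨ cong (n ^_) k-tj ⟨
      n ^ (k ∸ length (T ++ Y))                  ≤⟨ ≮⇒≥ ¬nice ⟩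
      κ (length (T ++ Y)) * cnt (T ++ Y)         ≤⟨ *-monoˡ-≤ (cnt (T ++ Y)) (κ-mono len) ⟩
      κ (suc (length T)) * cnt (T ++ Y)          ≤⟨ *-monoʳ-≤ (κ (suc (length T))) (into b) ⟩
      κ (suc (length T)) * cnt′ Y                ∎ }
      where
      lenTY : length (T ++ Y) ≡ length T + suc j
      lenTY = trans (length-++ T) (cong (length T +_) e)
      len : suc (length T) ≤ length (T ++ Y)
      len = ≤-trans (≤-trans (s≤s (m≤m+n (length T) j)) (≤-reflexive (sym (+-suc (length T) j)))) (≤-reflexive (sym lenTY))
      k-tj : k ∸ length (T ++ Y) ≡ c
      k-tj = trans (cong₂ _∸_ (sym eq) lenTY) (m+n∸m≡n (length T + suc j) c)
      into : All (InB B) Y → cnt (T ++ Y) ≤ cnt′ Y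
      into b rewrite k-tj = ΣW-mono c λ U _ → χ-mono _ _ λ { (bU , h) → Allₚ.++⁺ b bU , subst E (++-assoc T Y U) h }

  small-bad : ∀ {q N} T i j → Nice T → q * κ (suc (length T)) ≤ κ (length T) → Small q 1 N (bad T i j)
  small-bad {q} {N} T i j niceT hq = go j (length T + j <? k) (i + j ≤? N)
    where
    go : ∀ j → Dec (length T + j < k) → Dec (i + j ≤ N) → Small q 1 N (bad T i j)
    go j       (no ¬p) _        = small-0 (λ l _ → χ-no (bad? T i j l) (λ { ((p , _) , _) → ¬p p }))
    go j       (yes _) (no ¬p)  = small-0 (λ l e → χ-no (bad? T i j l) (λ { ((_ , p) , _) → ¬p (subst (i + j ≤_) e p) }))
    go zero    (yes _) (yes _)  = small-0 (λ l _ → χ-no (bad? T i 0 l)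
      (λ { (_ , _ , ¬nice) → ¬nice (subst Nice (sym (++-identityʳ T)) niceT) }))
    go (suc j) (yes p) (yes i+j≤) = small-mono
      (λ l _ → χ-mono (bad? T i (suc j) l) (all? InB?′ (take (suc j) (drop i l)) ×-dec ¬? (nice? (T ++ take (suc j) (drop i l)))) proj₂)
      (small-pick i (suc j) {λ Y → χ (all? InB?′ Y ×-dec ¬? (nice? (T ++ Y)))} i+j≤ (small-extension {T = T} j niceT (<⇒≤ p) hq))

  NiceSeq : W → Set
  NiceSeq = Intervals k Nice

  niceSeq-join : ∀ {U Y} → NiceSeq U → NiceSeq Y →
                 (∀ i j → length (drop i U) + j < k → Nice (drop i U ++ take j Y)) → NiceSeq (U ++ Y)
  niceSeq-join {U} {Y} nU nY h i j j<k with ≤-total i (length U)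
  ... | inj₂ U≤i rewrite drop-app-≥ U Y U≤i = nY (i ∸ length U) j j<k
  ... | inj₁ i≤U rewrite drop-app-≤ U Y i≤U with ≤-total j (length (drop i U))
  ...   | inj₁ j≤ rewrite take-app-≤ (drop i U) Y j≤ = nU i j j<k
  ...   | inj₂ ≤j rewrite take-app j (drop i U) Y | take-all j (drop i U) ≤j =
    h i (j ∸ length (drop i U)) (subst (_< k) (sym (m+[n∸m]≡n ≤j)) j<k)

  niceSeq-++ˡ : ∀ U {Y} → NiceSeq (U ++ Y) → NiceSeq U
  niceSeq-++ˡ U {Y} h i j j<k with ≤-total i (length U)
  ... | inj₂ U≤i = subst Nice (sym (trans (cong (take j) (drop-all i U U≤i)) (take-[] j))) (h 0 0 (≤-<-trans z≤n j<k))
  ... | inj₁ i≤U = subst Nice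
      (trans (cong (take _) (drop-app-≤ U Y i≤U)) (trans (take-app-≤ (drop i U) Y (m⊓n≤n j _)) (sym (take-⊓ j (drop i U)))))
      (h i (j ⊓ length (drop i U)) (≤-<-trans (m⊓n≤m j _) j<k))

  niceSeq-++ʳ : ∀ U {Y} → NiceSeq (U ++ Y) → NiceSeq Y
  niceSeq-++ʳ U {Y} h i j j<k = subst (λ l → Nice (take j l))
    (trans (drop-app-≥ U Y (m≤m+n (length U) i)) (cong (λ z → drop z Y) (m+n∸m≡n (length U) i))) (h (length U + i) j j<k)

  niceSeq-glue : ∀ U X {Y} → k ≤ suc (length X) → NiceSeq (U ++ X) → NiceSeq (X ++ Y) → NiceSeq (U ++ X ++ Y)
  niceSeq-glue = intervals-glue {P = Nice}

  Fresh : W → Fin n → Set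
  Fresh us v = InB B v × Nice [ v ] × v ∉ us

  abstract
   fresh? : ∀ us v → Dec (Fresh us v)
   fresh? us v = InB?′ v ×-dec nice? [ v ] ×-dec ¬? (v ∈? us)

  #fresh : W → ℕ
  #fresh us = ∑ (allFin n) (λ v → χ (fresh? us v))

  open import Data.List.Relation.Unary.Unique.DecPropositional (Finₚ._≟_ {n}) public using (unique?)

  repeat : W → ℕ
  repeat X = χ (¬? (unique? X))

  repeat-0 : ∀ {X} → repeat X ≡ 0 → Unique X
  repeat-0 {X} h = decidable-stable (unique? X) (χ-zero (¬? (unique? X)) h)

  small-repeat′ : ∀ {q N} → q * (N * N) ≤ n → Small q 1 N repeat
  small-repeat′ h = small-repeat Finₚ._≟_ uniqueV n>0 h

  Fresh⇒InB : ∀ {us X} → All (Fresh us) X → All (InB B) X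
  Fresh⇒InB = All.map proj₁

  pick-fresh : ∀ {q c G} N us (b : W → ℕ) → q * (N * N) ≤ n → n ≤ G * #fresh us → G ^ N * (1 + c) < q →
               Small q c N b → ∃[ X ] length X ≡ N × All (Fresh us) X × Unique X × b X ≡ 0
  pick-fresh {q} {c} {G} N us b hn hG hq sm =
    let X , e , f , z = pick {q} {1 + c} {G ^ N} N (all? (fresh? us)) (λ l → repeat l + b l) n>0 hq (dense-all (fresh? us) N hG) (small-+ (small-repeat′ hn) sm)
    in X , e , f , repeat-0 (m+n≡0⇒m≡0 _ z) , m+n≡0⇒n≡0 (repeat X) z

  NotFresh? : ∀ us v → Dec (InB B v × ¬ Fresh us v)
  NotFresh? us v = InB?′ v ×-dec ¬? (fresh? us v)

  #notFresh : W → ℕ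
  #notFresh us = ∑ (allFin n) (λ v → χ (NotFresh? us v))

  pick-dense : ∀ {q c g} N us {P : W → Set} (P? : ∀ l → Dec (P l)) (b : W → ℕ) → (∀ {X} → length X ≡ N → P X → All (InB B) X) →
               n ^ N ≤ g * ΣW N (λ l → χ (P? l)) → q * (N * N) ≤ n → q * #notFresh us ≤ n → g * (1 + (N + c)) < q →
               Small q c N b → ∃[ X ] length X ≡ N × P X × All (Fresh us) X × Unique X × b X ≡ 0
  pick-dense {q} {c} {g} N us {P} P? b P⇒B dense hn hF hq sm =
    let X , e , p , z = pick {q} {1 + (N + c)} {g} N P? (λ l → repeat l + (χ (any? (NotFresh? us) l) + b l)) n>0 hq dense
                          (small-+ (small-repeat′ hn) (small-+ (small-any (NotFresh? us) hF) sm))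
        z′ = m+n≡0⇒n≡0 (repeat X) z
    in X , e , p , allFresh (P⇒B e p) (χ-zero (any? (NotFresh? us) X) (m+n≡0⇒m≡0 _ z′)) , repeat-0 (m+n≡0⇒m≡0 _ z) , m+n≡0⇒n≡0 (χ (any? (NotFresh? us) X)) z′
    where
    allFresh : ∀ {Y} → All (InB B) Y → ¬ Any (λ v → InB B v × ¬ Fresh us v) Y → All (Fresh us) Y
    allFresh [] h = []
    allFresh {v ∷ Y} (b ∷ bs) h = decidable-stable (fresh? us v) (λ ¬f → h (here (b , ¬f))) ∷ allFresh bs (h ∘ there)

  #fresh-++ : ∀ us X → #fresh us ≤ #fresh (us ++ X) + length X
  #fresh-++ us X = ≤-trans (∑-mono (allFin n) {g = λ v → χ (fresh? (us ++ X) v) + χ (v ∈? X)}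
      (λ v → χ-⊎ (fresh? us v) (fresh? (us ++ X) v) (v ∈? X) (case v)))
    (≤-trans (≤-reflexive (∑-+ (allFin n) _ _)) (+-monoʳ-≤ _ (∑-∈? Finₚ._≟_ uniqueV X)))
    where
    case : ∀ v → Fresh us v → Fresh (us ++ X) v ⊎ v ∈ X
    case v (b , nv , v∉) with v ∈? X
    ... | yes p = inj₂ p
    ... | no ¬p = inj₁ (b , nv , λ h → either v∉ ¬p (∈-++⁻ us h))

  Exceptional? : ∀ v → Dec (InB B v × ¬ Nice [ v ])
  Exceptional? v = InB?′ v ×-dec ¬? (nice? [ v ])

  #exceptional : ℕ
  #exceptional = ∑ (allFin n) (λ v → χ (Exceptional? v))

  #notFresh-≤ : ∀ us → #notFresh us ≤ #exceptional + length us
  #notFresh-≤ us = ≤-trans (∑-mono (allFin n) (λ v → χ-⊎ (NotFresh? us v) (Exceptional? v) (v ∈? us) (case v)))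
    (≤-trans (≤-reflexive (∑-+ (allFin n) _ _)) (+-monoʳ-≤ _ (∑-∈? Finₚ._≟_ uniqueV us)))
    where
    case : ∀ v → InB B v × ¬ Fresh us v → (InB B v × ¬ Nice [ v ]) ⊎ v ∈ us
    case v (b , ¬f) with nice? [ v ] | v ∈? us
    ... | _      | yes p = inj₂ p
    ... | no ¬p  | no _ = inj₁ (b , ¬p)
    ... | yes nv | no ¬p = contradiction (b , nv , ¬p) ¬f

  ∑-upTo-0 : ∀ {m i} (f : ℕ → ℕ) → ∑ (upTo m) f ≡ 0 → i < m → f i ≡ 0
  ∑-upTo-0 f h i<m = ∑-≡0 f h (∈-upTo⁺ i<m)

  small-upTo : ∀ {q c N} m {f : ℕ → W → ℕ} → (∀ i → i < m → Small q c N (f i)) →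
               Small q (m * c) N (λ l → ∑ (upTo m) (λ i → f i l))
  small-upTo {q} {c} {N} m {f} h = subst (λ z → Small q (z * c) N (λ l → ∑ (upTo m) (λ i → f i l))) (length-upTo m)
    (small-∑ (upTo m) (λ i i∈ → h i (∈-upTo⁻ i∈)))

  badLeft : W → W → ℕ
  badLeft P X = ∑ (upTo k) (λ a → ∑ (upTo k) (λ j → bad (drop (length P ∸ a) P) 0 j X))

  badInside : ℕ → W → ℕ
  badInside N X = ∑ (upTo (suc N)) (λ i → ∑ (upTo k) (λ j → bad [] i j X))

  badRight : ℕ → W → W → ℕ
  badRight N M X = ∑ (upTo (suc N)) (λ i → ∑ (upTo k) (λ j → bad (take j M) i (N ∸ i) X))

  length-drop-∸ : ∀ (P : W) a → length (drop (length P ∸ a) P) ≤ a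
  length-drop-∸ P a = ≤-trans (≤-reflexive (length-drop (length P ∸ a) P)) (m∸[m∸n]≤n (length P) a)
    where
    m∸[m∸n]≤n : ∀ m n → m ∸ (m ∸ n) ≤ n
    m∸[m∸n]≤n m n with ≤-total n m
    ... | inj₁ n≤m = ≤-reflexive (m∸[m∸n]≡n n≤m)
    ... | inj₂ m≤n = ≤-trans (m∸n≤m m (m ∸ n)) m≤n

  niceSeq-drop : ∀ {P} i → NiceSeq P → length (drop i P) < k → Nice (drop i P)
  niceSeq-drop {P} i nP h = subst Nice (take-all′ (drop i P) ≤-refl) (nP i (length (drop i P)) h)

  small-badLeft : ∀ {q N} P → (∀ t → t < k → q * κ (suc t) ≤ κ t) → NiceSeq P → Small q (k * (k * 1)) N (badLeft P)
  small-badLeft P hq nP = small-upTo k λ a a<k → small-upTo k λ j _ →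
    let len = ≤-<-trans (length-drop-∸ P a) a<k in
    small-bad (drop (length P ∸ a) P) 0 j (niceSeq-drop (length P ∸ a) nP len) (hq _ len)

  small-badInside : ∀ {q} N → q * κ 1 ≤ κ 0 → Nice [] → Small q (suc N * (k * 1)) N (badInside N)
  small-badInside N hq n[] = small-upTo (suc N) λ i _ → small-upTo k λ j _ → small-bad [] i j n[] hq

  small-badRight : ∀ {q} N M → (∀ t → t ≤ length M → t < k → q * κ (suc t) ≤ κ t) → NiceSeq M →
                   Small q (suc N * (k * 1)) N (badRight N M)
  small-badRight N M hq nM = small-upTo (suc N) λ i _ → small-upTo k λ j j<k →
    small-bad (take j M) i (N ∸ i) (nM 0 j j<k)
      (hq _ (≤-trans (≤-reflexive (length-take j M)) (m⊓n≤n j _)) (≤-<-trans (≤-trans (≤-reflexive (length-take j M)) (m⊓n≤m j _)) j<k))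

  niceInside : ∀ {X N} → length X ≡ N → All (InB B) X → Nice [] → badInside N X ≡ 0 → NiceSeq X
  niceInside {X} refl b n[] z i j j<k with i ≤? length X
  ... | no i≰ rewrite drop-all i X (<⇒≤ (≰⇒> i≰)) | take-[] {A = Fin n} j = n[]
  ... | yes i≤ = subst Nice (sym (take-⊓ j (drop i X)))
    (bad-0 {[]} {i} {j ⊓ length (drop i X)} {X}
      (∑-upTo-0 (λ j → bad [] i j X) (∑-upTo-0 (λ i → ∑ (upTo k) (λ j → bad [] i j X)) z (s≤s i≤)) j′<k) b j′<k
      (≤-trans (+-monoʳ-≤ i (m⊓n≤n j (length (drop i X)))) (≤-reflexive (trans (cong (i +_) (length-drop i X)) (m+[n∸m]≡n i≤)))))
    where
    j′<k : j ⊓ length (drop i X) < k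
    j′<k = ≤-<-trans (m⊓n≤m j _) j<k

  niceLeft : ∀ {P X} → All (InB B) X → NiceSeq P → NiceSeq X → badLeft P X ≡ 0 → NiceSeq (P ++ X)
  niceLeft {P} {X} b nP nX z = niceSeq-join nP nX cross
    where
    cross : ∀ i j → length (drop i P) + j < k → Nice (drop i P ++ take j X)
    cross i j h = subst₂ (λ p q → Nice (p ++ q)) dropeq (sym (take-⊓ j X))
      (bad-0 {drop (length P ∸ a) P} {0} {j′} {X}
        (∑-upTo-0 (λ j → bad (drop (length P ∸ a) P) 0 j X) (∑-upTo-0 (λ a → ∑ (upTo k) (λ j → bad (drop (length P ∸ a) P) 0 j X)) z a<k) j′<k)
        b (subst (λ p → length p + j′ < k) (sym dropeq) (≤-<-trans (+-monoʳ-≤ a (m⊓n≤m j _)) h)) (m⊓n≤n j _))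
      where
      a = length (drop i P)
      j′ = j ⊓ length X
      a<k : a < k
      a<k = ≤-<-trans (m≤m+n a j) h
      j′<k : j′ < k
      j′<k = ≤-<-trans (≤-trans (m⊓n≤m j _) (m≤n+m j a)) h
      dropeq : drop (length P ∸ a) P ≡ drop i P
      dropeq with ≤-total i (length P)
      ... | inj₁ i≤ rewrite length-drop i P = cong (λ z → drop z P) (m∸[m∸n]≡n i≤)
      ... | inj₂ ≤i rewrite drop-all i P ≤i = drop-all (length P) P ≤-refl

  niceRight : ∀ {X M N} → length X ≡ N → All (InB B) X → NiceSeq X → NiceSeq M → badRight N M X ≡ 0 → NiceSeq (X ++ M)
  niceRight {X} {M} refl b nX nM z = niceSeq-join nX nM cross
    where
    cross : ∀ i j → length (drop i X) + j < k → Nice (drop i X ++ take j M)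
    cross i j h with i ≤? length X
    ... | no i≰ rewrite drop-all i X (<⇒≤ (≰⇒> i≰)) = nM 0 j h
    ... | yes i≤ = Nice-↭ (++-comm (take j M) (drop i X)) (subst (λ p → Nice (take j M ++ p)) takeeq
      (bad-0 {take j M} {i} {length X ∸ i} {X}
        (∑-upTo-0 (λ j → bad (take j M) i (length X ∸ i) X) (∑-upTo-0 (λ i → ∑ (upTo k) (λ j → bad (take j M) i (length X ∸ i) X)) z (s≤s i≤)) (≤-<-trans (m≤n+m j _) h))
        b (≤-<-trans (≤-trans (+-mono-≤ (≤-trans (≤-reflexive (length-take j M)) (m⊓n≤m j _)) (≤-reflexive (sym (length-drop i X)))) (≤-reflexive (+-comm j _))) h)
        (≤-reflexive (m+[n∸m]≡n i≤))))
      where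
      takeeq : take (length X ∸ i) (drop i X) ≡ drop i X
      takeeq = take-all′ (drop i X) (≤-reflexive (length-drop i X))

  connect : ∀ {q G N} us P M → (∀ t → t < k → q * κ (suc t) ≤ κ t) → q * (N * N) ≤ n → n ≤ G * #fresh us →
            G ^ N * (1 + (k * (k * 1) + (suc N * (k * 1) + suc N * (k * 1)))) < q → 0 < k → k ≤ suc N → NiceSeq P → NiceSeq M →
            ∃[ X ] length X ≡ N × All (Fresh us) X × Unique X × NiceSeq (P ++ X ++ M)
  connect {q} {G} {N} us P M hκ hn hG hq k>0 k≤N nP nM =
    let X , e , f , u , z = pick-fresh {q} {k * (k * 1) + (suc N * (k * 1) + suc N * (k * 1))} {G} N us (λ X → badLeft P X + (badInside N X + badRight N M X)) hn hG hq
           (small-+ (small-badLeft P hκ nP) (small-+ (small-badInside N (hκ 0 k>0) (nP 0 0 k>0)) (small-badRight N M (λ t _ → hκ t) nM)))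
        b = Fresh⇒InB f
        z′ = m+n≡0⇒n≡0 (badLeft P X) z
        nX = niceInside e b (nP 0 0 k>0) (m+n≡0⇒m≡0 _ z′)
    in X , e , f , u , niceSeq-glue P X (subst (λ m → k ≤ suc m) (sym e) k≤N) (niceLeft b nP nX (m+n≡0⇒m≡0 _ z))
         (niceRight e b nX nM (m+n≡0⇒n≡0 (badInside N X) z′))

  niceSeq-single : ∀ {x} → Nice [] → Nice [ x ] → NiceSeq [ x ]
  niceSeq-single n[] nx zero          zero    _ = n[]
  niceSeq-single n[] nx zero          (suc j) _ = subst Nice (cong (_ ∷_) (sym (take-[] j))) nx
  niceSeq-single n[] nx (suc zero)    j       _ = subst Nice (sym (take-[] j)) n[]
  niceSeq-single n[] nx (suc (suc i)) j       _ = subst Nice (sym (take-[] j)) n[]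

  misfit : ℕ → W → Fin n → ℕ
  misfit N X x = ∑ (upTo (suc N)) (λ i → ∑ (upTo k) (λ j → bad [ x ] i j X))

  small-misfit : ∀ {q} N x → 1 < k → q * κ 2 ≤ κ 1 → Nice [ x ] → Small q (suc N * (k * 1)) N (λ X → misfit N X x)
  small-misfit N x k>1 hq nx = small-upTo (suc N) λ i _ → small-upTo k λ j _ → small-bad [ x ] i j nx hq

  niceSeq-insert : ∀ u v x → length u ≡ k → length v ≡ k → Nice [] → Nice [ x ] → All (InB B) (u ++ v) → NiceSeq (u ++ v) →
                   misfit (k + k) (u ++ v) x ≡ 0 → NiceSeq (u ++ x ∷ v)
  niceSeq-insert u v x lu lv n[] nx b nuv z = niceSeq-join (niceSeq-++ˡ u nuv) nxv cross
    where
    nv : NiceSeq v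
    nv = niceSeq-++ʳ u nuv
    luv : length (u ++ v) ≡ k + k
    luv = trans (length-++ u) (cong₂ _+_ lu lv)
    fit : ∀ i j → suc j < k → i + j ≤ k + k → i < suc (k + k) → Nice (x ∷ take j (drop i (u ++ v)))
    fit i j j<k ij i< = bad-0 {[ x ]} {i} {j} {u ++ v}
      (∑-upTo-0 (λ j → bad [ x ] i j (u ++ v)) (∑-upTo-0 (λ i → ∑ (upTo k) (λ j → bad [ x ] i j (u ++ v))) z i<) (<-trans (n<1+n j) j<k))
      b j<k (subst (i + j ≤_) (sym luv) ij)
    nxv : NiceSeq (x ∷ v)
    nxv = niceSeq-join {[ x ]} (niceSeq-single n[] nx) nv λ where
      zero j h → subst (λ l → Nice (x ∷ take j l)) (drop-++ u v lu) (fit k j h (+-monoʳ-≤ k (≤-trans (n≤1+n j) (<⇒≤ h))) (s≤s (m≤m+n k k)))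
      (suc zero) j h → nv 0 j h
      (suc (suc i)) j h → nv 0 j h
    cross : ∀ i j → length (drop i u) + j < k → Nice (drop i u ++ take j (x ∷ v))
    cross i j h = go (≤-total i (length u)) j h
      where
      go : i ≤ length u ⊎ length u ≤ i → ∀ j → length (drop i u) + j < k → Nice (drop i u ++ take j (x ∷ v))
      go (inj₂ u≤i) j h = subst (λ l → Nice (l ++ take j (x ∷ v))) (sym (drop-all i u u≤i)) (nxv 0 j (≤-<-trans (m≤n+m j _) h))
      go (inj₁ i≤u) zero h = subst Nice (sym (++-identityʳ (drop i u))) (niceSeq-drop i (niceSeq-++ˡ u nuv) (≤-<-trans (m≤m+n _ _) h))
      go (inj₁ i≤u) (suc j) h = Nice-↭ (↭-sym (shift x (drop i u) (take j v))) (subst (λ l → Nice (x ∷ l)) eq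
          (fit i (length (drop i u) + j) (subst (_< k) (+-suc _ j) h) le (s≤s (≤-trans (subst (i ≤_) lu i≤u) (m≤m+n k k)))))
        where
        j<k : j < k
        j<k = ≤-trans (m≤n+m (suc j) (length (drop i u))) (<⇒≤ h)
        le : i + (length (drop i u) + j) ≤ k + k
        le = ≤-trans (≤-reflexive (trans (sym (+-assoc i _ j)) (cong (_+ j) (trans (cong (i +_) (length-drop i u)) (trans (m+[n∸m]≡n i≤u) lu))))) (+-monoʳ-≤ k (<⇒≤ j<k))
        eq : take (length (drop i u) + j) (drop i (u ++ v)) ≡ drop i u ++ take j v
        eq = trans (cong (take (length (drop i u) + j)) (drop-app-≤ u v i≤u))
          (trans (take-app (length (drop i u) + j) (drop i u) v) (cong₂ (λ p m → p ++ take m v) (take-all′ (drop i u) (m≤m+n _ j)) (m+n∸m≡n (length (drop i u)) j)))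

  totalMisfit : ℕ → W → ℕ
  totalMisfit N X = ∑ (allFin n) (λ x → χ (nice? [ x ]) * misfit N X x)

  crowded? : ∀ K N X → Dec (n < K * totalMisfit N X)
  crowded? K N X = n <? K * totalMisfit N X

  small-crowded : ∀ {q} K N → 1 < k → q * κ 2 ≤ κ 1 → Small q (K * (suc N * (k * 1))) N (λ X → χ (crowded? K N X))
  small-crowded {q} K N k>1 hq = small (*-cancelˡ-≤ n {{>-nonZero n>0}} (begin
    n * (q * ΣW N (λ X → χ (crowded? K N X)))    ≡⟨ x∙yz≈y∙xz n q _ ⟩
    q * (n * ΣW N (λ X → χ (crowded? K N X)))    ≡⟨ cong (q *_) (ΣW-* N n (λ X → χ (crowded? K N X))) ⟨
    q * ΣW N (λ X → n * χ (crowded? K N X))      ≤⟨ *-monoʳ-≤ q (ΣW-mono N (λ X _ → χ-≤ (crowded? K N X) <⇒≤)) ⟩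
    q * ΣW N (λ X → K * totalMisfit N X)         ≡⟨ cong (q *_) (ΣW-* N K (totalMisfit N)) ⟩
    q * (K * ΣW N (totalMisfit N))               ≡⟨ x∙yz≈y∙xz q K _ ⟩
    K * (q * ΣW N (totalMisfit N))               ≡⟨ cong (λ z → K * (q * z)) (ΣW-∑ N (allFin n) (λ X x → χ (nice? [ x ]) * misfit N X x)) ⟩
    K * (q * ∑ (allFin n) (λ x → ΣW N (λ X → χ (nice? [ x ]) * misfit N X x))) ≡⟨ cong (K *_) (∑-* q (allFin n) _) ⟨
    K * ∑ (allFin n) (λ x → q * ΣW N (λ X → χ (nice? [ x ]) * misfit N X x))   ≤⟨ *-monoʳ-≤ K (∑-mono (allFin n) per) ⟩
    K * ∑ (allFin n) (λ _ → c * n ^ N)           ≡⟨ cong (K *_) (∑V-const (c * n ^ N)) ⟩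
    K * (n * (c * n ^ N))                        ≡⟨ r K n c (n ^ N) ⟩
    n * (K * c * n ^ N)                          ∎))
    where
    open ≤-Reasoning
    c = suc N * (k * 1)
    r : ∀ a b c d → a * (b * (c * d)) ≡ b * (a * c * d)
    r = solve-∀
    per : ∀ x → q * ΣW N (λ X → χ (nice? [ x ]) * misfit N X x) ≤ c * n ^ N
    per x = go (nice? [ x ])
      where
      go : ∀ (d : Dec (Nice [ x ])) → q * ΣW N (λ X → χ d * misfit N X x) ≤ c * n ^ N
      go (no _) = ≤-trans (≤-reflexive (trans (cong (q *_) (ΣW-zero N)) (*-zeroʳ q))) z≤n
      go (yes nx) = ≤-trans (≤-reflexive (cong (q *_) (ΣW-cong N (λ X _ → *-identityˡ (misfit N X x))))) (Small.bound (small-misfit {q} N x k>1 hq nx))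

  chunk : ∀ {q G K} us P → (∀ t → t < k → q * κ (suc t) ≤ κ t) → q * ((k + k) * (k + k)) ≤ n → n ≤ G * #fresh us →
          G ^ (k + k) * (1 + (k * (k * 1) + (suc (k + k) * (k * 1) + K * (suc (k + k) * (k * 1))))) < q → 1 < k → NiceSeq P →
          ∃[ X ] length X ≡ k + k × All (Fresh us) X × Unique X × NiceSeq (P ++ X) × K * totalMisfit (k + k) X ≤ n
  chunk {q} {G} {K} us P hκ hn hG hq k>1 nP =
    let N = k + k
        k>0 = <-trans z<s k>1
        X , e , f , u , z = pick-fresh {q} {k * (k * 1) + (suc N * (k * 1) + K * (suc N * (k * 1)))} {G} N us
           (λ X → badLeft P X + (badInside N X + χ (crowded? K N X))) hn hG hq
           (small-+ (small-badLeft P hκ nP) (small-+ (small-badInside N (hκ 0 k>0) (nP 0 0 k>0)) (small-crowded K N k>1 (hκ 1 k>1))))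
        z′ = m+n≡0⇒n≡0 (badLeft P X) z
        nX = niceInside e (Fresh⇒InB f) (nP 0 0 k>0) (m+n≡0⇒m≡0 _ z′)
    in X , e , f , u , niceLeft (Fresh⇒InB f) nP nX (m+n≡0⇒m≡0 _ z)
         , ≮⇒≥ (χ-zero (crowded? K N X) (m+n≡0⇒n≡0 (badInside N X) z′))

  badMinimal : ℕ → Fin n → W → W → ℕ
  badMinimal N x rest U = ∑ (upTo (length rest)) (λ b → ∑ (upTo (suc N)) (λ j → bad (x ∷ take b rest) 0 j U))

  -- Writing the minimal non-nice word x ∷ rest around U makes every proper interval miss one of its two ends.
  edge-word : ∀ {q} us x rest N → suc (length rest) + N ≡ k → 0 < length rest → 1 < k → ¬ Nice (x ∷ rest) →
              (∀ b → b < length rest → Nice (x ∷ take b rest)) → NiceSeq rest →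
              (∀ t → t ≤ length rest → t < k → q * κ (suc t) ≤ κ t) →
              κ (suc (length rest)) * (1 + (N + (length rest * (suc N * 1) + (suc N * (k * 1) + suc N * (k * 1))))) < q →
              q * (N * N) ≤ n → q * #notFresh us ≤ n →
              ∃[ U ] length U ≡ N × All (Fresh us) U × Unique U × E (x ∷ U ++ rest) × NiceSeq (x ∷ U ++ rest)
  edge-word {q} us x rest N eq r>0 k>1 ¬nice nx nrest hκ hq hn hF =
    let U , e , (b , h) , f , u , z = pick-dense {q} {length rest * (suc N * 1) + (suc N * (k * 1) + suc N * (k * 1))} {κ (suc (length rest))} N us
          (λ U → all? InB?′ U ×-dec E? (x ∷ rest ++ U)) (λ U → badMinimal N x rest U + (badInside N U + badRight N rest U)) (λ _ → proj₁)
          dense hn hF hq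
          (small-+ (small-upTo (length rest) λ b b< → small-upTo (suc N) λ j _ →
             small-bad (x ∷ take b rest) 0 j (nx b b<) (hκ _ (s≤s′ b b<) (lt b b<)))
            (small-+ (small-badInside N (hκ 0 z≤n (<-trans z<s k>1)) n[]) (small-badRight N rest hκ nrest)))
        z′ = m+n≡0⇒n≡0 (badMinimal N x rest U) z
        nU = niceInside e b n[] (m+n≡0⇒m≡0 _ z′)
        nUrest = niceRight e b nU nrest (m+n≡0⇒n≡0 (badInside N U) z′)
    in U , e , f , u , E-↭ (prep x (++-comm rest U)) h , λ where
         (suc i) j j<k → nUrest i j j<k
         zero zero _ → n[]
         zero (suc j) j<k → start U e b (m+n≡0⇒m≡0 _ z) j j<k
    where
    n[] : Nice []
    n[] = nrest 0 0 (<-trans z<s k>1)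
    s≤s′ : ∀ b → b < length rest → suc (length (take b rest)) ≤ length rest
    s≤s′ b b< = ≤-trans (s≤s (≤-trans (≤-reflexive (length-take b rest)) (m⊓n≤m b _))) b<
    rest<k : length rest < k
    rest<k = ≤-trans (m≤m+n _ N) (≤-reflexive eq)
    lt : ∀ b → b < length rest → suc (length (take b rest)) < k
    lt b b< = ≤-<-trans (s≤s′ b b<) rest<k
    k∸ : k ∸ suc (length rest) ≡ N
    k∸ = trans (cong (_∸ suc (length rest)) (sym eq)) (m+n∸m≡n (suc (length rest)) N)
    dense : n ^ N ≤ κ (suc (length rest)) * ΣW N (λ U → χ (all? InB?′ U ×-dec E? (x ∷ rest ++ U)))
    dense = subst (λ m → n ^ m ≤ κ (suc (length rest)) * ΣW m (λ U → χ (all? InB?′ U ×-dec E? (x ∷ rest ++ U)))) k∸ (≮⇒≥ ¬nice)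
    start : ∀ U → length U ≡ N → All (InB B) U → badMinimal N x rest U ≡ 0 → ∀ j → suc j < k → Nice (x ∷ take j (U ++ rest))
    start U refl b z j j<k = subst (λ l → Nice (x ∷ l)) (sym (trans (take-app j U rest) (cong (_++ take c rest) (take-⊓ j U))))
      (Nice-↭ (prep x (++-comm (take c rest) (take (j ⊓ N) U)))
        (bad-0 {x ∷ take c rest} {0} {j ⊓ N} {U}
          (∑-upTo-0 (λ j → bad (x ∷ take c rest) 0 j U) (∑-upTo-0 (λ b → ∑ (upTo (suc N)) (λ j → bad (x ∷ take b rest) 0 j U)) z c<) (s≤s (m⊓n≤n j N)))
          b len (m⊓n≤n j N)))
      where
      c = j ∸ N
      j<′ : j < length rest + N
      j<′ = ≤-pred (≤-trans j<k (≤-reflexive (sym eq)))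
      c< : c < length rest
      c< = go (≤-total j N)
        where
        go : j ≤ N ⊎ N ≤ j → c < length rest
        go (inj₁ j≤N) = subst (_< length rest) (sym (m≤n⇒m∸n≡0 j≤N)) r>0
        go (inj₂ N≤j) = +-cancelʳ-< N c (length rest) (≤-<-trans (≤-reflexive (m∸n+n≡m N≤j)) j<′)
      len : suc (length (take c rest)) + (j ⊓ N) < k
      len = ≤-<-trans (s≤s (+-monoˡ-≤ (j ⊓ N) (≤-trans (≤-reflexive (length-take c rest)) (m⊓n≤m c _))))
        (≤-<-trans (≤-reflexive (cong suc (trans (+-comm c _) (trans (cong (_+ c) (⊓-comm j N)) (m⊓n+n∸m≡n N j))))) j<k)

  Wheel : Fin n → W → Set
  Wheel v Y = ∀ i → i ≤ k ∸ 1 → E (v ∷ take (k ∸ 1) (drop i Y))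

  weak-wheel : ∀ {q} us v → ¬ Nice [ v ] → 0 < k → q * κ 1 ≤ κ 0 → Nice [] → let m = k ∸ 1 in
               cubeConst m (κ 1) * (1 + ((m + m) + suc (m + m) * (k * 1))) < q → q * ((m + m) * (m + m)) ≤ n → q * #notFresh us ≤ n →
               ∃[ Y ] length Y ≡ m + m × All (Fresh us) Y × Unique Y × Wheel v Y × NiceSeq Y
  weak-wheel {q} us v ¬nv k>0 hκ n[] hq hn hF =
    let Y , e , (lx , c) , f , u , z = pick-dense {q} {suc (m + m) * (k * 1)} {cubeConst m (κ 1)} (m + m) us P? (badInside (m + m)) (λ {Y} → P⇒B {Y}) dense′ hn hF hq
               (small-badInside (m + m) hκ n[])
    in Y , e , f , u , wheel Y e c , niceInside e (Fresh⇒InB f) n[] z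
    where
    m = k ∸ 1
    R : W → Set
    R l = All (InB B) l × E (v ∷ l)
    R? : ∀ l → Dec (R l)
    R? l = all? InB?′ l ×-dec E? (v ∷ l)
    P : W → Set
    P Y = length Y ≡ m + m × Cube R (take m Y) (drop m Y)
    P? : ∀ Y → Dec (P Y)
    P? Y = (length Y ≟ m + m) ×-dec cube? R? (take m Y) (drop m Y)
    halves : ∀ {Y : W} → length Y ≡ m + m → length (take m Y) ≡ m × length (drop m Y) ≡ m
    halves {Y} e = trans (length-take m Y) (trans (cong (m ⊓_) e) (m≤n⇒m⊓n≡m (m≤m+n m m))) ,
                   trans (length-drop m Y) (trans (cong (_∸ m) e) (m+n∸m≡n m m))
    mixed : ∀ {Y} → length Y ≡ m + m → Cube R (take m Y) (drop m Y) → ∀ i → i ≤ m → R (take i (drop m Y) ++ drop i (take m Y))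
    mixed {Y} e c i i≤ = let a , b = halves {Y} e in cube-mixed (take m Y) (drop m Y) (trans a (sym b)) c i (subst (i ≤_) (sym a) i≤)
    P⇒B : ∀ {Y} → length Y ≡ m + m → P Y → All (InB B) Y
    P⇒B {Y} e (_ , c) = subst (All (InB B)) (take++drop≡id m Y) (Allₚ.++⁺ (proj₁ (mixed {Y} e c 0 z≤n))
      (Allₚ.++⁻ˡ (drop m Y) (subst (λ l → All (InB B) (l ++ drop m (take m Y))) (take-all′ (drop m Y) (≤-reflexive (proj₂ (halves {Y} e)))) (proj₁ (mixed {Y} e c m ≤-refl)))))
    dense : n ^ m * n ^ m ≤ cubeConst m (κ 1) * ΣW m (λ xs → ΣW m (λ ys → χ (cube? R? xs ys)))
    dense = dense-cube m (κ 1) R? n>0 (≮⇒≥ ¬nv)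
    dense′ : n ^ (m + m) ≤ cubeConst m (κ 1) * ΣW (m + m) (λ Y → χ (P? Y))
    dense′ = ≤-trans (≤-reflexive (^-distribˡ-+-* n m m)) (≤-trans dense (*-monoʳ-≤ (cubeConst m (κ 1))
      (≤-trans (ΣW-mono m (λ xs ex → ΣW-mono m (λ ys ey → χ-mono (cube? R? xs ys) (P? (xs ++ ys)) (λ c →
        trans (length-++ xs) (cong₂ _+_ ex ey) , subst₂ (Cube R) (sym (take-++ xs ys ex)) (sym (drop-++ xs ys ex)) c))))
        (≤-reflexive (sym (ΣW-++ m m (λ Y → χ (P? Y))))))))
    wheel : ∀ Y → length Y ≡ m + m → Cube R (take m Y) (drop m Y) → Wheel v Y
    wheel Y e c i i≤ = E-↭ (prep v (↭-trans (++-comm (take i (drop m Y)) (drop i (take m Y))) (↭-reflexive (sym eq)))) (proj₂ (mixed {Y} e c i i≤))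
      where
      ltx = proj₁ (halves {Y} e)
      lD : length (drop i (take m Y)) ≡ m ∸ i
      lD = trans (length-drop i (take m Y)) (cong (_∸ i) ltx)
      eq : take m (drop i Y) ≡ drop i (take m Y) ++ take i (drop m Y)
      eq = begin
        take m (drop i Y)                                 ≡⟨ cong (λ l → take m (drop i l)) (take++drop≡id m Y) ⟨
        take m (drop i (take m Y ++ drop m Y))            ≡⟨ cong (take m) (drop-app-≤ (take m Y) (drop m Y) (subst (i ≤_) (sym ltx) i≤)) ⟩
        take m (drop i (take m Y) ++ drop m Y)            ≡⟨ take-app m (drop i (take m Y)) (drop m Y) ⟩
        take m (drop i (take m Y)) ++ take (m ∸ length (drop i (take m Y))) (drop m Y)
          ≡⟨ cong₂ _++_ (take-all′ (drop i (take m Y)) (≤-trans (≤-reflexive lD) (m∸n≤m m i))) (cong (λ z → take z (drop m Y)) (trans (cong (m ∸_) lD) (m∸[m∸n]≡n i≤))) ⟩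
        drop i (take m Y) ++ take i (drop m Y)            ∎
        where open ≡-Reasoning

  NonLink? : ∀ v l → Dec (All (InB B) l × ¬ E (v ∷ l))
  NonLink? v l = all? InB?′ l ×-dec ¬? (E? (v ∷ l))

  Strong : ℕ → Fin n → Set
  Strong q v = q * ΣW (k ∸ 1) (λ l → χ (NonLink? v l)) ≤ 1 * n ^ (k ∸ 1)

  strong-wheel : ∀ {q G} us v → Strong q v → 0 < k → q * κ 1 ≤ κ 0 → Nice [] → let m = k ∸ 1 in
                 G ^ (m + m) * (1 + (suc m * 1 + suc (m + m) * (k * 1))) < q → q * ((m + m) * (m + m)) ≤ n → n ≤ G * #fresh us →
                 ∃[ Y ] length Y ≡ m + m × All (Fresh us) Y × Unique Y × Wheel v Y × NiceSeq Y
  strong-wheel {q} {G} us v strong k>0 hκ n[] hq hn hG =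
    let Y , e , f , u , z = pick-fresh {q} {suc m * 1 + suc (m + m) * (k * 1)} {G} (m + m) us (λ Y → nonlinks Y + badInside (m + m) Y) hn hG hq
               (small-+ {c = suc m * 1} (small-upTo {c = 1} (suc m) λ i i< → small-pick i m {λ l → χ (NonLink? v l)} (+-monoˡ-≤ m (≤-pred i<)) (small strong)) (small-badInside (m + m) hκ n[]))
    in Y , e , f , u , wheel Y (Fresh⇒InB f) (m+n≡0⇒m≡0 _ z) , niceInside e (Fresh⇒InB f) n[] (m+n≡0⇒n≡0 (nonlinks Y) z)
    where
    m = k ∸ 1
    nonlinks : W → ℕ
    nonlinks Y = ∑ (upTo (suc m)) (λ i → χ (NonLink? v (take m (drop i Y))))
    wheel : ∀ Y → All (InB B) Y → nonlinks Y ≡ 0 → Wheel v Y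
    wheel Y b z i i≤ = decidable-stable (E? (v ∷ take m (drop i Y))) λ ¬h →
      χ-zero (NonLink? v (take m (drop i Y))) (∑-upTo-0 (λ i → χ (NonLink? v (take m (drop i Y)))) z (s≤s i≤)) (Allₚ.take⁺ m (Allₚ.drop⁺ i b) , ¬h)

  module Codegree (k>1 : 1 < k) (codeg : ∑ (allFin n) (λ v → χ (¬? (InB? B v))) ≤ minCodegree H) where

    k>0 : 0 < k
    k>0 = <-trans z<s k>1

    #A : ℕ
    #A = ∑ (allFin n) (λ v → χ (¬? (InB?′ v)))

    nice-nil : κ 0 * (k ^ k * e H B) < n ^ k → Nice []
    nice-nil h = ≤-<-trans (*-monoʳ-≤ (κ 0) (words≤edges B)) h

    few-exceptional : ∀ {q} → Nice [] → q * κ 1 ≤ κ 0 → q * #exceptional ≤ n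
    few-exceptional {q} n[] hq = ≤-trans (*-monoʳ-≤ q (∑-mono (allFin n) (λ v → χ-mono (Exceptional? v) (all? InB?′ [ v ] ×-dec ¬? (nice? [ v ])) (λ { (b , h) → b ∷ [] , h }))))
      (≤-trans (Small.bound (small-extension {q} {[]} 0 n[] k>0 hq)) (≤-reflexive (trans (*-identityˡ _) (*-identityʳ n))))

    InBLink? : ∀ l v → Dec (InB B v × E (v ∷ l))
    InBLink? l v = InB?′ v ×-dec E? (v ∷ l)

    degB : W → ℕ
    degB l = ∑ (allFin n) (λ v → χ (InBLink? l v))

    WeakA? : ∀ q v → Dec (¬ InB B v × ¬ Strong q v)
    WeakA? q v = ¬? (InB?′ v) ×-dec ¬? (q * ΣW (k ∸ 1) (λ l → χ (NonLink? v l)) ≤? 1 * n ^ (k ∸ 1))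

    #weakA : ℕ → ℕ
    #weakA q = ∑ (allFin n) (λ v → χ (WeakA? q v))

    ∑degB : ΣW (k ∸ 1) (λ l → χ (all? InB?′ l) * degB l) ≡ cnt []
    ∑degB = begin
      ΣW m (λ l → χ (all? InB?′ l) * degB l)      ≡⟨ ΣW-cong m (λ l _ → ∑-* (χ (all? InB?′ l)) (allFin n) _) ⟨
      ΣW m (λ l → ∑ (allFin n) (λ v → χ (all? InB?′ l) * χ (InBLink? l v))) ≡⟨ ΣW-cong m (λ l _ → ∑-cong (allFin n) (λ v → sym (χ-× (all? InB?′ (v ∷ l) ×-dec E? (v ∷ l)) (all? InB?′ l) (InBLink? l v)
           (λ { (b ∷ bs , h) → bs , b , h }) (λ { bs (b , h) → b ∷ bs , h })))) ⟩
      ΣW m (λ l → ∑ (allFin n) (λ v → χ (all? InB?′ (v ∷ l) ×-dec E? (v ∷ l)))) ≡⟨ ΣW-∑ m (allFin n) _ ⟩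
      ΣW (suc m) (λ l → χ (all? InB?′ l ×-dec E? l)) ≡⟨ cong (λ z → ΣW z (λ l → χ (all? InB?′ l ×-dec E? l))) (suc-pred′ k>0) ⟩
      cnt []                                       ∎
      where
      open ≡-Reasoning
      m = k ∸ 1

    nonlinks-≤ : ∀ l → length l ≡ k ∸ 1 → ∑ (allFin n) (λ v → χ (¬? (InB?′ v)) * χ (NonLink? v l)) ≤ χ (all? InB?′ l) * degB l + n * repeat l
    nonlinks-≤ l el = go (all? InB?′ l) (unique? l)
      where
      f : Fin n → ℕ
      f v = χ (¬? (InB?′ v)) * χ (NonLink? v l)
      pt : ∀ v → (b : Dec (InB B v)) (h : Dec (E (v ∷ l))) → χ (¬? b) * χ (all? InB?′ l ×-dec ¬? h) + χ h ≤ χ (¬? b) + χ (b ×-dec h)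
      pt v b h = go′ b h (all? InB?′ l)
        where
        go′ : ∀ b h (d : Dec (All (InB B) l)) → χ (¬? b) * χ (d ×-dec ¬? h) + χ h ≤ χ (¬? b) + χ (b ×-dec h)
        go′ (yes _) (yes _) d = ≤-refl
        go′ (yes _) (no _)  d = ≤-refl
        go′ (no _)  (yes h) d = ≤-reflexive (cong (_+ 1) (trans (*-identityˡ _) (χ-no (d ×-dec ¬? (yes h)) (λ { (_ , p) → p h }))))
        go′ (no _)  (no ¬h) d = ≤-trans (≤-reflexive (trans (+-identityʳ _) (*-identityˡ _))) (χ≤1 (d ×-dec yes ¬h))
      go : Dec (All (InB B) l) → Dec (Unique l) → ∑ (allFin n) f ≤ χ (all? InB?′ l) * degB l + n * repeat l
      go (no ¬b) _ = ≤-trans (≤-reflexive (trans (∑-cong (allFin n) (λ v → trans (cong (χ (¬? (InB?′ v)) *_) (χ-no (NonLink? v l) (λ { (b , _) → ¬b b }))) (*-zeroʳ (χ (¬? (InB?′ v)))))) (∑-zero (allFin n)))) z≤n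
      go (yes _) (no ¬u) = ≤-trans (≤-trans (∑-mono (allFin n) {g = λ _ → 1} (λ v → *-mono-≤ (χ≤1 (¬? (InB?′ v))) (χ≤1 (NonLink? v l))))
         (≤-reflexive (trans (∑V-const 1) (cong (n *_) (sym (χ-yes (¬? (unique? l)) ¬u)))))) (m≤n+m _ _)
      go (yes b) (yes u) = ≤-trans (+-cancelʳ-≤ (∑ (allFin n) (λ v → χ (E? (v ∷ l)))) _ _ (begin
        ∑ (allFin n) f + ∑ (allFin n) (λ v → χ (E? (v ∷ l)))     ≡⟨ ∑-+ (allFin n) _ _ ⟨
        ∑ (allFin n) (λ v → f v + χ (E? (v ∷ l)))                ≤⟨ ∑-mono (allFin n) (λ v → pt v (InB?′ v) (E? (v ∷ l))) ⟩
        ∑ (allFin n) (λ v → χ (¬? (InB?′ v)) + χ (InBLink? l v)) ≡⟨ ∑-+ (allFin n) _ _ ⟩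
        #A + degB l                                              ≤⟨ +-monoˡ-≤ (degB l) (≤-trans codeg (codegree l u el)) ⟩
        ∑ (allFin n) (λ v → χ (E? (v ∷ l))) + degB l             ≡⟨ +-comm _ (degB l) ⟩
        degB l + ∑ (allFin n) (λ v → χ (E? (v ∷ l)))             ∎))
        (≤-trans (≤-reflexive (sym (trans (cong (_* degB l) (χ-yes (all? InB?′ l) b)) (*-identityˡ _)))) (m≤m+n _ _))
        where open ≤-Reasoning

    few-weakA : ∀ {p q} → Nice [] → 2 * (p * q) ≤ κ 0 → 2 * (p * q) * ((k ∸ 1) * (k ∸ 1)) ≤ n → p * #weakA q ≤ n
    few-weakA {p} {q} n[] h0 hn = *-cancelʳ-≤ (p * #weakA q) n (n ^ m) {{m^n≢0 n m {{>-nonZero n>0}}}} (*-cancelˡ-≤ 2 (begin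
      2 * (p * #weakA q * n ^ m)            ≡⟨ r₁ p (#weakA q) (n ^ m) ⟩
      2 * p * (n ^ m * #weakA q)            ≡⟨ cong (2 * p *_) (∑-* (n ^ m) (allFin n) _) ⟨
      2 * p * ∑ (allFin n) (λ v → n ^ m * χ (WeakA? q v)) ≤⟨ *-monoʳ-≤ (2 * p) (∑-mono (allFin n) weak-≤) ⟩
      2 * p * ∑ (allFin n) (λ v → q * (χ (¬? (InB?′ v)) * N v)) ≡⟨ cong (2 * p *_) (∑-* q (allFin n) _) ⟩
      2 * p * (q * ∑ (allFin n) (λ v → χ (¬? (InB?′ v)) * N v)) ≤⟨ *-monoʳ-≤ (2 * p) (*-monoʳ-≤ q total) ⟩
      2 * p * (q * (cnt [] + n * R))        ≡⟨ r₂ p q (cnt []) (n * R) ⟩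
      2 * (p * q) * cnt [] + 2 * (p * q) * (n * R) ≤⟨ +-mono-≤ (*-monoˡ-≤ (cnt []) h0) (*-monoʳ-≤ (2 * (p * q)) (ΣW-repeat Finₚ._≟_ uniqueV m)) ⟩
      κ 0 * cnt [] + 2 * (p * q) * (m * m * n ^ m) ≤⟨ +-mono-≤ (<⇒≤ n[]) (≤-trans (≤-reflexive (sym (*-assoc (2 * (p * q)) (m * m) (n ^ m)))) (*-monoˡ-≤ (n ^ m) hn)) ⟩
      n ^ k + n * n ^ m                     ≡⟨ cong (λ z → n ^ z + n * n ^ m) (suc-pred′ k>0) ⟨
      n * n ^ m + n * n ^ m                 ≡⟨ r₃ (n * n ^ m) ⟩
      2 * (n * n ^ m)                       ∎))
      where
      open ≤-Reasoning
      m = k ∸ 1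
      N : Fin n → ℕ
      N v = ΣW m (λ l → χ (NonLink? v l))
      R = ΣW m repeat
      r₁ : ∀ a b c → 2 * (a * b * c) ≡ 2 * a * (c * b)
      r₁ = solve-∀
      r₂ : ∀ a b c d → 2 * a * (b * (c + d)) ≡ 2 * (a * b) * c + 2 * (a * b) * d
      r₂ = solve-∀
      r₃ : ∀ a → a + a ≡ 2 * a
      r₃ = solve-∀
      weak-≤ : ∀ v → n ^ m * χ (WeakA? q v) ≤ q * (χ (¬? (InB?′ v)) * N v)
      weak-≤ v = χ-≤ (WeakA? q v) λ { (¬b , ¬s) → ≤-trans (≤-trans (≤-reflexive (sym (*-identityˡ (n ^ m)))) (<⇒≤ (≰⇒> ¬s)))
        (*-monoʳ-≤ q (≤-reflexive (sym (trans (cong (_* N v) (χ-yes (¬? (InB?′ v)) ¬b)) (*-identityˡ _))))) }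
      total : ∑ (allFin n) (λ v → χ (¬? (InB?′ v)) * N v) ≤ cnt [] + n * R
      total = begin
        ∑ (allFin n) (λ v → χ (¬? (InB?′ v)) * N v)    ≡⟨ ∑-cong (allFin n) (λ v → sym (ΣW-* m (χ (¬? (InB?′ v))) (λ l → χ (NonLink? v l)))) ⟩
        ∑ (allFin n) (λ v → ΣW m (λ l → χ (¬? (InB?′ v)) * χ (NonLink? v l))) ≡⟨ ΣW-∑ m (allFin n) (λ l v → χ (¬? (InB?′ v)) * χ (NonLink? v l)) ⟨
        ΣW m (λ l → ∑ (allFin n) (λ v → χ (¬? (InB?′ v)) * χ (NonLink? v l))) ≤⟨ ΣW-mono m nonlinks-≤ ⟩
        ΣW m (λ l → χ (all? InB?′ l) * degB l + n * repeat l) ≡⟨ ΣW-+ m (λ l → χ (all? InB?′ l) * degB l) (λ l → n * repeat l) ⟩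
        ΣW m (λ l → χ (all? InB?′ l) * degB l) + ΣW m (λ l → n * repeat l) ≡⟨ cong₂ _+_ ∑degB (ΣW-* m n repeat) ⟩
        cnt [] + n * R ∎

    #A′ : ℕ
    #A′ = ∑ (allFin n) (λ v → χ (¬? (nice? [ v ])))

    NonEdge? : ∀ S v → Dec (¬ Nice [ v ] × ¬ E (v ∷ S))
    NonEdge? S v = ¬? (nice? [ v ]) ×-dec ¬? (E? (v ∷ S))

    nonEdges : W → ℕ
    nonEdges S = ∑ (allFin n) (λ v → χ (NonEdge? S v))

    cnt-codegree : ∀ S → length S ≡ k ∸ 1 → cnt S ≡ degB S
    cnt-codegree S eS = trans (cong (λ m → ΣW m (λ U → χ (all? InB?′ U ×-dec E? (S ++ U)))) one)
      (∑-cong (allFin n) λ v → ≤-antisym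
        (χ-mono (all? InB?′ [ v ] ×-dec E? (S ++ [ v ])) (InBLink? S v) (λ { (b ∷ [] , h) → b , E-↭ (++-comm S [ v ]) h }))
        (χ-mono (InBLink? S v) (all? InB?′ [ v ] ×-dec E? (S ++ [ v ])) (λ { (b , h) → b ∷ [] , E-↭ (++-comm [ v ] S) h })))
      where
      one : k ∸ length S ≡ 1
      one = trans (cong₂ _∸_ (sym (suc-pred′ k>0)) eS) (m+n∸n≡m 1 (k ∸ 1))

    nonEdges-≤ : ∀ S → Unique S → length S ≡ k ∸ 1 → nonEdges S ≤ #exceptional + cnt S
    nonEdges-≤ S u eS = +-cancelʳ-≤ D _ _ (begin
      nonEdges S + D                  ≡⟨ ∑-+ (allFin n) _ _ ⟨
      ∑ (allFin n) (λ v → χ (NonEdge? S v) + χ (E? (v ∷ S))) ≤⟨ ∑-mono (allFin n) (λ v → pt v (InB?′ v) (E? (v ∷ S)) (nice? [ v ])) ⟩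
      ∑ (allFin n) (λ v → χ (Exceptional? v) + (χ (¬? (InB?′ v)) + χ (InBLink? S v))) ≡⟨ trans (∑-+ (allFin n) _ _) (cong (#exceptional +_) (∑-+ (allFin n) _ _)) ⟩
      #exceptional + (#A + degB S)    ≤⟨ +-monoʳ-≤ #exceptional (+-monoˡ-≤ (degB S) (≤-trans codeg (codegree S u eS))) ⟩
      #exceptional + (D + degB S)     ≡⟨ cong (λ z → #exceptional + z) (trans (+-comm D _) (cong (_+ D) (sym (cnt-codegree S eS)))) ⟩
      #exceptional + (cnt S + D)      ≡⟨ +-assoc #exceptional _ _ ⟨
      #exceptional + cnt S + D        ∎)
      where
      open ≤-Reasoning
      D = ∑ (allFin n) (λ v → χ (E? (v ∷ S)))
      pt : ∀ v → (b : Dec (InB B v)) (h : Dec (E (v ∷ S))) (c : Dec (Nice [ v ])) →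
           χ (¬? c ×-dec ¬? h) + χ h ≤ χ (b ×-dec ¬? c) + (χ (¬? b) + χ (b ×-dec h))
      pt v (yes _) (yes _) (yes _) = ≤-refl
      pt v (yes _) (yes _) (no _)  = s≤s z≤n
      pt v (yes _) (no _)  (yes _) = ≤-refl
      pt v (yes _) (no _)  (no _)  = ≤-refl
      pt v (no _)  (yes _) (yes _) = ≤-refl
      pt v (no _)  (yes _) (no _)  = ≤-refl
      pt v (no _)  (no _)  (yes _) = z≤n
      pt v (no _)  (no _)  (no _)  = ≤-refl

    A′-≤ : #A′ ≤ #exceptional + #A
    A′-≤ = ≤-trans (∑-mono (allFin n) (λ v → pt (InB?′ v) (nice? [ v ]))) (≤-reflexive (∑-+ (allFin n) _ _))
      where
      pt : ∀ {v} (b : Dec (InB B v)) (c : Dec (Nice [ v ])) → χ (¬? c) ≤ χ (b ×-dec ¬? c) + χ (¬? b)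
      pt (yes _) (yes _) = ≤-refl
      pt (yes _) (no _)  = ≤-refl
      pt (no _)  (yes _) = z≤n
      pt (no _)  (no _)  = ≤-refl

    strong-not-nice : ∀ {q v} → n ≤ 2 * ∑ (allFin n) (λ v → χ (InB?′ v)) → 4 * 2 ^ (k ∸ 1) ≤ q → 4 * 2 ^ (k ∸ 1) ≤ κ 1 →
                      Strong q v → ¬ Nice [ v ]
    strong-not-nice {q} {v} hB hq hκ s nv = <⇒≱ (m^n>0 n {{>-nonZero n>0}} m) (+-cancelʳ-≤ (n ^ m) _ _ (*-cancelˡ-≤ 2 (begin
      2 * (n ^ m + n ^ m)                      ≡⟨ r₀ (n ^ m) ⟩
      4 * n ^ m                                ≤⟨ *-monoʳ-≤ 4 (dense-all InB?′ m hB) ⟩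
      4 * (2 ^ m * ΣW m (λ l → χ (all? InB?′ l))) ≤⟨ *-monoʳ-≤ 4 (*-monoʳ-≤ (2 ^ m) (ΣW-mono m (λ l _ → χ-⊎ (all? InB?′ l) (all? InB?′ l ×-dec E? (v ∷ l)) (NonLink? v l) (split l)))) ⟩
      4 * (2 ^ m * ΣW m (λ l → χ (all? InB?′ l ×-dec E? (v ∷ l)) + χ (NonLink? v l))) ≡⟨ cong (λ z → 4 * (2 ^ m * z)) (ΣW-+ m _ _) ⟩
      4 * (2 ^ m * (cnt [ v ] + N))            ≡⟨ r₁ (2 ^ m) (cnt [ v ]) N ⟩
      4 * 2 ^ m * cnt [ v ] + 4 * 2 ^ m * N    ≤⟨ +-mono-≤ (≤-trans (*-monoˡ-≤ (cnt [ v ]) hκ) (<⇒≤ nv)) (≤-trans (*-monoˡ-≤ N hq) s) ⟩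
      n ^ m + 1 * n ^ m                        ≡⟨ r₂ (n ^ m) ⟩
      2 * (0 + n ^ m)                          ∎)))
      where
      open ≤-Reasoning
      m = k ∸ 1
      N = ΣW m (λ l → χ (NonLink? v l))
      split : ∀ l → All (InB B) l → (All (InB B) l × E (v ∷ l)) ⊎ (All (InB B) l × ¬ E (v ∷ l))
      split l b = go (E? (v ∷ l))
        where
        go : Dec (E (v ∷ l)) → _
        go (yes h) = inj₁ (b , h)
        go (no ¬h) = inj₂ (b , ¬h)
      r₀ : ∀ a → 2 * (a + a) ≡ 4 * a
      r₀ = solve-∀
      r₁ : ∀ a b c → 4 * (a * (b + c)) ≡ 4 * a * b + 4 * a * c
      r₁ = solve-∀
      r₂ : ∀ a → a + 1 * a ≡ 2 * (0 + a)
      r₂ = solve-∀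

    A-≤ : ∀ {q} → n ≤ 2 * ∑ (allFin n) (λ v → χ (InB?′ v)) → 4 * 2 ^ (k ∸ 1) ≤ q → 4 * 2 ^ (k ∸ 1) ≤ κ 1 → #A ≤ #weakA q + #A′
    A-≤ {q} hB hq hκ = ≤-trans (∑-mono (allFin n) (λ v → χ-⊎ (¬? (InB?′ v)) (WeakA? q v) (¬? (nice? [ v ])) (split v))) (≤-reflexive (∑-+ (allFin n) _ _))
      where
      split : ∀ v → ¬ InB B v → (¬ InB B v × ¬ Strong q v) ⊎ ¬ Nice [ v ]
      split v ¬b = go (q * ΣW (k ∸ 1) (λ l → χ (NonLink? v l)) ≤? 1 * n ^ (k ∸ 1))
        where
        go : Dec (Strong q v) → _
        go (yes s) = inj₂ (strong-not-nice hB hq hκ s)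
        go (no ¬s) = inj₁ (¬b , ¬s)

    Good : Fin n → Set
    Good v = Nice [ v ]

    fresh-unique : ∀ {us X} → Unique us → All (Fresh us) X → Unique X → Unique (us ++ X)
    fresh-unique uu f ux = unique-++ uu ux (All.map (proj₂ ∘ proj₂) f)

    fresh-good : ∀ {us X} → All (Fresh us) X → All Good X
    fresh-good = All.map (proj₁ ∘ proj₂)

    deficit : ℕ
    deficit = #A ∸ #A′

    InUs? : ∀ us S v → Dec (v ∈ us × Good v × E (v ∷ S))
    InUs? us S v = (v ∈? us) ×-dec nice? [ v ] ×-dec E? (v ∷ S)

    Trapped? : ∀ us S → Dec (All (InB B) S × deficit ≤ ∑ (allFin n) (λ v → χ (InUs? us S v)))
    Trapped? us S = all? InB?′ S ×-dec (deficit ≤? ∑ (allFin n) (λ v → χ (InUs? us S v)))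

    small-trapped : ∀ {C} us → 0 < deficit → length us ≤ C * deficit → Small (κ 1) C (k ∸ 1) (λ S → χ (Trapped? us S))
    small-trapped {C} us d>0 hus = small (*-cancelˡ-≤ deficit {{>-nonZero d>0}} (begin
      deficit * (κ 1 * ΣW m (λ S → χ (Trapped? us S)))   ≡⟨ x∙yz≈y∙xz deficit (κ 1) _ ⟩
      κ 1 * (deficit * ΣW m (λ S → χ (Trapped? us S)))   ≡⟨ cong (κ 1 *_) (ΣW-* m deficit _) ⟨
      κ 1 * ΣW m (λ S → deficit * χ (Trapped? us S))     ≤⟨ *-monoʳ-≤ (κ 1) (ΣW-mono m (λ S _ → χ-≤ (Trapped? us S) (λ { (b , h) → ≤-trans h (∑-mono (allFin n) (into S b)) }))) ⟩
      κ 1 * ΣW m (λ S → ∑ (allFin n) (λ v → f v * χ (all? InB?′ S ×-dec E? (v ∷ S)))) ≡⟨ cong (κ 1 *_) (ΣW-∑ m (allFin n) _) ⟩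
      κ 1 * ∑ (allFin n) (λ v → ΣW m (λ S → f v * χ (all? InB?′ S ×-dec E? (v ∷ S)))) ≡⟨ ∑-* (κ 1) (allFin n) _ ⟨
      ∑ (allFin n) (λ v → κ 1 * ΣW m (λ S → f v * χ (all? InB?′ S ×-dec E? (v ∷ S)))) ≤⟨ ∑-mono (allFin n) per ⟩
      ∑ (allFin n) (λ v → n ^ m * χ (v ∈? us))           ≡⟨ ∑-* (n ^ m) (allFin n) _ ⟩
      n ^ m * ∑ (allFin n) (λ v → χ (v ∈? us))           ≤⟨ *-monoʳ-≤ (n ^ m) (≤-trans (∑-∈? Finₚ._≟_ uniqueV us) hus) ⟩
      n ^ m * (C * deficit)                              ≡⟨ r (n ^ m) C deficit ⟩
      deficit * (C * n ^ m)                              ∎))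
      where
      open ≤-Reasoning
      m = k ∸ 1
      r : ∀ a b c → a * (b * c) ≡ c * (b * a)
      r = solve-∀
      g? : ∀ v → Dec (v ∈ us × Good v)
      g? v = (v ∈? us) ×-dec nice? [ v ]
      f : Fin n → ℕ
      f v = χ (g? v)
      into : ∀ S → All (InB B) S → ∀ v → χ (InUs? us S v) ≤ f v * χ (all? InB?′ S ×-dec E? (v ∷ S))
      into S b v = ≤-reflexive (χ-× (InUs? us S v) (g? v) (all? InB?′ S ×-dec E? (v ∷ S)) (λ { (p , q , h) → (p , q) , b , h }) (λ { (p , q) (_ , h) → p , q , h }))
      per : ∀ v → κ 1 * ΣW m (λ S → f v * χ (all? InB?′ S ×-dec E? (v ∷ S))) ≤ n ^ m * χ (v ∈? us)
      per v = go (g? v)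
        where
        go : ∀ (d : Dec (v ∈ us × Good v)) → κ 1 * ΣW m (λ S → χ d * χ (all? InB?′ S ×-dec E? (v ∷ S))) ≤ n ^ m * χ (v ∈? us)
        go (no _) = ≤-trans (≤-reflexive (trans (cong (κ 1 *_) (ΣW-zero m)) (*-zeroʳ (κ 1)))) z≤n
        go (yes (v∈ , gv)) = ≤-trans (≤-reflexive (cong (κ 1 *_) (ΣW-cong m (λ S _ → *-identityˡ (χ (all? InB?′ S ×-dec E? (v ∷ S)))))))
          (≤-trans (<⇒≤ gv) (≤-reflexive (sym (trans (cong (n ^ m *_) (χ-yes (v ∈? us) v∈)) (*-identityʳ _)))))

    free-edge : ∀ {C G} us → Unique us → 0 < deficit → length us ≤ C * deficit → κ 1 * ((k ∸ 1) * (k ∸ 1)) ≤ n → n ≤ G * #fresh us →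
                G ^ (k ∸ 1) * (1 + C) < κ 1 → ∃[ e ] length e ≡ k × E e × All Good e × Unique (us ++ e)
    free-edge {C} {G} us uu d>0 hus hn hG hq =
      let S , eS , f , uS , z = pick-fresh {κ 1} {C} {G} m us (λ S → χ (Trapped? us S)) hn hG hq (small-trapped us d>0 hus)
          ¬tr = χ-zero (Trapped? us S) z
          v , _ , lt = ∑-∃ (allFin n) (λ v → χ (InUs? us S v)) (λ v → χ (GoodEdge? S v)) (<-≤-trans (≰⇒> (λ h → ¬tr (Fresh⇒InB f , h))) (many S uS eS))
          gv , h = χ-pos (GoodEdge? S v) (≤-<-trans z≤n lt)
          v∉us : v ∉ us
          v∉us v∈ = <⇒≱ lt (≤-trans (χ≤1 (GoodEdge? S v)) (≤-reflexive (sym (χ-yes (InUs? us S v) (v∈ , gv , h)))))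
          e≡k = trans (cong suc eS) (suc-pred′ k>0)
      in v ∷ S , e≡k , h , gv ∷ fresh-good f
         , unique-++ uu (Allₚ.¬Any⇒All¬ S (E-fresh e≡k h) ∷ uS) (v∉us ∷ All.map (proj₂ ∘ proj₂) f)
      where
      m = k ∸ 1
      GoodEdge? : ∀ S v → Dec (Good v × E (v ∷ S))
      GoodEdge? S v = nice? [ v ] ×-dec E? (v ∷ S)
      many : ∀ S → Unique S → length S ≡ m → deficit ≤ ∑ (allFin n) (λ v → χ (GoodEdge? S v))
      many S u eS = m≤n+o⇒m∸n≤o #A #A′ (≤-trans (≤-trans codeg (codegree S u eS)) (≤-trans
        (∑-mono (allFin n) (λ v → χ-⊎ (E? (v ∷ S)) (¬? (nice? [ v ])) (GoodEdge? S v) (split v))) (≤-reflexive (∑-+ (allFin n) _ _))))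
        where
        split : ∀ v → E (v ∷ S) → ¬ Good v ⊎ (Good v × E (v ∷ S))
        split v h = go (nice? [ v ])
          where
          go : Dec (Good v) → _
          go (yes g) = inj₂ (g , h)
          go (no ¬g) = inj₁ ¬g

    drop-take : ∀ a j (D : W) → drop a (take j D) ≡ take (j ∸ a) (drop a D)
    drop-take zero    j       D       = refl
    drop-take (suc a) zero    D       = refl
    drop-take (suc a) (suc j) []      = sym (take-[] (j ∸ a))
    drop-take (suc a) (suc j) (x ∷ D) = drop-take a j D

    infix-infix : ∀ a b i j (e : W) → take b (drop a (take j (drop i e))) ≡ take (b ⊓ (j ∸ a)) (drop (i + a) e)
    infix-infix a b i j e = trans (cong (take b) (trans (drop-take a j (drop i e)) (cong (take (j ∸ a)) (drop-drop i a e)))) (take-take b (j ∸ a) _)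

    first-bad : ∀ e → (∀ i → Nice (take 0 (drop i e))) → ∀ j → (∀ j′ → j′ ≤ j → ∀ i → Nice (take j′ (drop i e))) ⊎
                (∃[ i ] ∃[ j′ ] ¬ Nice (take j′ (drop i e)) × (∀ j″ → j″ < j′ → ∀ i′ → Nice (take j″ (drop i′ e))))
    first-bad e h0 zero = inj₁ (λ { .0 z≤n → h0 })
    first-bad e h0 (suc j) = either step inj₂ (first-bad e h0 j)
      where
      step : (∀ j′ → j′ ≤ j → ∀ i → Nice (take j′ (drop i e))) → _
      step below = go (any? (λ i → ¬? (nice? (take (suc j) (drop i e)))) (upTo (suc (length e))))
        where
        go : Dec (Any (λ i → ¬ Nice (take (suc j) (drop i e))) (upTo (suc (length e)))) → _
        go (yes p) = let i , _ , ¬n = find p in inj₂ (i , suc j , ¬n , λ j″ lt → below j″ (≤-pred lt))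
        go (no ¬p) = inj₁ λ j′ j′≤ i → case-≤ j′ (m≤n⇒m<n∨m≡n j′≤) i
          where
          upto : ∀ i → i ≤ length e → Nice (take (suc j) (drop i e))
          upto i i≤ = decidable-stable (nice? (take (suc j) (drop i e))) (λ ¬n → ¬p (lose (∈-upTo⁺ (s≤s i≤)) ¬n))
          case-≤ : ∀ j′ → j′ < suc j ⊎ j′ ≡ suc j → ∀ i → Nice (take j′ (drop i e))
          case-≤ j′ (inj₁ lt) i = below j′ (≤-pred lt) i
          case-≤ .(suc j) (inj₂ refl) i = either (upto i) (λ ≤i → subst (λ l → Nice (take (suc j) l)) (trans (drop-all (length e) e ≤-refl) (sym (drop-all i e ≤i))) (upto (length e) ≤-refl)) (≤-total i (length e))

    record MinimalWord (e : W) : Set where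
      field
        x     : Fin n
        rest  : W
        i j   : ℕ
        eq    : take j (drop i e) ≡ x ∷ rest
        long  : 0 < length rest
        ¬nice : ¬ Nice (x ∷ rest)
        nx    : ∀ b → b < length rest → Nice (x ∷ take b rest)
        nrest : NiceSeq rest

    minimal-word : ∀ e → length e ≡ k → 0 < κ k → E e → All Good e → Nice [] → MinimalWord e
    minimal-word e ek κk h g n[] = either (λ all → ⊥-elim (notNice (all k ≤-refl 0))) found (first-bad e (λ i → n[]) k)
      where
      notNice : ¬ Nice (take k e)
      notNice ne = <⇒≱ ne′ (*-mono-≤ κk one)
        where
        ne′ : κ k * cnt e < n ^ 0
        ne′ = subst₂ (λ t z → κ t * cnt e < n ^ z) ek (trans (cong (k ∸_) ek) (n∸n≡0 k)) (subst Nice (take-all′ e (≤-reflexive ek)) ne)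
        one : 1 ≤ cnt e
        one = subst (λ z → 1 ≤ ΣW z (λ U → χ (all? InB?′ U ×-dec E? (e ++ U)))) (sym (trans (cong (k ∸_) ek) (n∸n≡0 k)))
          (≤-reflexive (sym (χ-yes (all? InB?′ [] ×-dec E? (e ++ [])) ([] , subst E (sym (++-identityʳ e)) h))))
      found : (∃[ i ] ∃[ j ] ¬ Nice (take j (drop i e)) × (∀ j″ → j″ < j → ∀ i′ → Nice (take j″ (drop i′ e)))) → MinimalWord e
      found (i , j , ¬n , min) = build (take j (drop i e)) refl ¬n
        where
        build : ∀ T → take j (drop i e) ≡ T → ¬ Nice T → MinimalWord e
        build [] eq ¬n = contradiction n[] ¬n
        build (x ∷ []) eq ¬n = contradiction (All.lookup (subst (All Good) eq (Allₚ.take⁺ j (Allₚ.drop⁺ i g))) (here refl)) ¬n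
        build (x ∷ rest@(_ ∷ _)) eq ¬n = record { x = x ; rest = rest ; i = i ; j = j ; eq = eq ; long = z<s ; ¬nice = ¬n ; nx = nx ; nrest = nrest }
          where
          T≤j : suc (length rest) ≤ j
          T≤j = ≤-trans (≤-reflexive (cong length (sym eq))) (≤-trans (≤-reflexive (length-take j (drop i e))) (m⊓n≤m j _))
          sub : ∀ a b → b ⊓ (j ∸ a) < j → Nice (take b (drop a (x ∷ rest)))
          sub a b lt = subst (λ T → Nice (take b (drop a T))) eq (subst Nice (sym (infix-infix a b i j e)) (min (b ⊓ (j ∸ a)) lt (i + a)))
          nx : ∀ b → b < length rest → Nice (x ∷ take b rest)
          nx b b< = sub 0 (suc b) (≤-<-trans (m⊓n≤m (suc b) j) (<-≤-trans (s≤s b<) T≤j))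
          nrest : NiceSeq rest
          nrest a b _ = sub (suc a) b (≤-<-trans (m⊓n≤n b (j ∸ suc a)) (shorter j (≤-trans (s≤s z≤n) T≤j)))
            where
            shorter : ∀ j → 1 ≤ j → j ∸ suc a < j
            shorter (suc j) _ = s≤s (m∸n≤m j a)

    edgeEvents : ℕ
    edgeEvents = k + (k * (suc k * 1) + (suc k * (k * 1) + suc k * (k * 1)))

    free-edge-word : ∀ {C G Q} us → Unique us → Nice [] → (∀ t → t < k → Q * (κ (suc t) * κ (suc t)) ≤ κ t) → 0 < κ k →
                     0 < deficit → length us ≤ C * deficit → n ≤ G * #fresh us → G ^ (k ∸ 1) * (1 + C) < κ 1 → 1 + edgeEvents < Q →
                     Q * κ 1 * (k * k) ≤ n → Q * κ 1 * (#exceptional + (length us + k)) ≤ n →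
                     ∃[ w ] length w ≡ k × E w × NiceSeq w × All Good w × Unique (us ++ w)
    free-edge-word {C} {G} {Q} us uu n[] hκ κk d>0 hus hG hC hQ hn hF =
      let e , ek , h , g , ue = free-edge us uu d>0 hus (≤-trans (*-mono-≤ (≤-trans (≤-reflexive (sym (*-identityˡ (κ 1)))) (*-monoˡ-≤ (κ 1) Q>0)) (*-mono-≤ (m∸n≤m k 1) (m∸n≤m k 1))) hn) hG hC
      in finish e ek g ue (minimal-word e ek κk h g n[])
      where
      Q>0 : 0 < Q
      Q>0 = ≤-<-trans z≤n hQ
      finish : ∀ e → length e ≡ k → All Good e → Unique (us ++ e) → MinimalWord e → ∃[ w ] length w ≡ k × E w × NiceSeq w × All Good w × Unique (us ++ w)
      finish e ek g ue mw =
        let U , eU , f , uU , hw , nw = edge-word {Q * κt} (us ++ e) x rest N T+N long k>1 ¬nice nx nrest hκ′ hq hn′ hF′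
            uT = unique-++ {us = us ++ T} uT₀ uU (All.map (λ fr v∈ → proj₂ (proj₂ fr) (T⊆e v∈)) f)
            p : (us ++ T) ++ U ↭ us ++ x ∷ U ++ rest
            p = ↭-trans (↭-reflexive (++-assoc us T U)) (++⁺ˡ us (prep x (++-comm rest U)))
            gT = Allₚ.take⁺ j (Allₚ.drop⁺ i g)
            gx = subst (All Good) eq gT
        in x ∷ U ++ rest , trans (cong suc (trans (length-++ U) (trans (cong (_+ length rest) eU) (+-comm N _)))) T+N , hw , nw
           , All.head gx ∷ Allₚ.++⁺ (fresh-good f) (All.tail gx) , unique-↭ p uT
        where
        open MinimalWord mw
        T = x ∷ rest
        t = suc (length rest)
        κt = κ t
        N = k ∸ t
        t≤k : t ≤ k
        t≤k = ≤-trans (≤-reflexive (cong length (sym eq))) (≤-trans (≤-reflexive (length-take j (drop i e)))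
          (≤-trans (m⊓n≤n j _) (≤-trans (≤-reflexive (length-drop i e)) (≤-trans (m∸n≤m _ i) (≤-reflexive ek)))))
        T+N : t + N ≡ k
        T+N = m+[n∸m]≡n t≤k
        hκ′ : ∀ t′ → t′ ≤ length rest → t′ < k → Q * κt * κ (suc t′) ≤ κ t′
        hκ′ t′ t′≤ t′<k = ≤-trans (≤-reflexive (*-assoc Q κt _)) (≤-trans (*-monoʳ-≤ Q (*-monoˡ-≤ (κ (suc t′)) (κ-mono (s≤s t′≤)))) (hκ t′ t′<k))
        κt>0 : 0 < κt
        κt>0 = <-≤-trans κk (κ-mono t≤k)
        N≤k : N ≤ k
        N≤k = m∸n≤m k t
        r≤k : length rest ≤ k
        r≤k = ≤-trans (n≤1+n _) t≤k
        hq : κt * (1 + (N + (length rest * (suc N * 1) + (suc N * (k * 1) + suc N * (k * 1))))) < Q * κt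
        hq = ≤-<-trans (*-monoʳ-≤ κt (s≤s (+-mono-≤ N≤k (+-mono-≤ (*-mono-≤ r≤k (*-monoˡ-≤ 1 (s≤s N≤k))) (+-mono-≤ (*-monoˡ-≤ (k * 1) (s≤s N≤k)) (*-monoˡ-≤ (k * 1) (s≤s N≤k)))))))
          (≤-<-trans (≤-reflexive (*-comm κt _)) (*-monoˡ-< κt {{>-nonZero κt>0}} hQ))
        κt≤ : Q * κt ≤ Q * κ 1
        κt≤ = *-monoʳ-≤ Q (κ-mono (s≤s z≤n))
        hn′ : Q * κt * (N * N) ≤ n
        hn′ = ≤-trans (*-mono-≤ κt≤ (*-mono-≤ N≤k N≤k)) hn
        hF′ : Q * κt * #notFresh (us ++ e) ≤ n
        hF′ = ≤-trans (*-mono-≤ κt≤ (≤-trans (#notFresh-≤ (us ++ e)) (+-monoʳ-≤ #exceptional (≤-reflexive (trans (length-++ us) (cong (length us +_) ek)))))) hF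
        e-split : e ≡ take i e ++ (take j (drop i e) ++ drop j (drop i e))
        e-split = trans (sym (take++drop≡id i e)) (cong (take i e ++_) (sym (take++drop≡id j (drop i e))))
        uT₀ : Unique (us ++ T)
        uT₀ = unique-++ uu (subst Unique eq (unique-++ˡ (take j (drop i e)) (unique-++ʳ (take i e) (subst Unique e-split (unique-++ʳ us ue)))))
          (All.tabulate (λ v∈T v∈us → disj v∈us (e⊇ v∈T)))
          where
          e⊇ : ∀ {v} → v ∈ T → v ∈ e
          e⊇ {v} v∈ = subst (v ∈_) (sym e-split) (∈-++⁺ʳ (take i e) (∈-++⁺ˡ (subst (v ∈_) (sym eq) v∈)))
          disj : ∀ {v} → v ∈ us → v ∉ e
          disj v∈us v∈e = dis us ue v∈us v∈e
            where
            dis : ∀ xs {ys} → Unique (xs ++ ys) → ∀ {v} → v ∈ xs → v ∉ ys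
            dis (x ∷ xs) (x∉ ∷ _) (here refl) v∈ys = All.lookup (Allₚ.++⁻ʳ xs x∉) v∈ys refl
            dis (x ∷ xs) (_ ∷ u) (there v∈) v∈ys = dis xs u v∈ v∈ys
        T⊆e : ∀ {v} → v ∈ us ++ T → v ∈ us ++ e
        T⊆e v∈ = either ∈-++⁺ˡ (λ p → ∈-++⁺ʳ us (subst (_ ∈_) (sym e-split) (∈-++⁺ʳ (take i e) (∈-++⁺ˡ (subst (_ ∈_) (sym eq) p))))) (∈-++⁻ us v∈)

    module Blocks (d′ t r : ℕ) (r>0 : 0 < r) (r≤d′ : r ≤ d′) (k≡ : k ≡ suc t * suc d′ + r) where

      open Units H d′ t r r>0 r≤d′ k≡ public hiding (W; windows)

      σ : ℕ
      σ = before first + after first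

      data Slot : Set where
        fixed  : Unit → Slot
        vacant : Kind → Slot

      slotSize : Slot → ℕ
      slotSize (fixed u)  = size u
      slotSize (vacant c) = before c + after c

      slotSizes : List Slot → ℕ
      slotSizes ss = ∑ ss slotSize

      FixedValid : List Slot → W → Set
      FixedValid []              l = ⊤
      FixedValid (fixed u ∷ ss)  l = Valid u l × FixedValid ss (drop (size u) l)
      FixedValid (vacant c ∷ ss) l = FixedValid ss (drop (before c + after c) l)

      fixedCentres : List Slot → W
      fixedCentres []                         = []
      fixedCentres (fixed (A-unit _ a) ∷ ss)  = a ∷ fixedCentres ss
      fixedCentres (fixed B-unit ∷ ss)        = fixedCentres ss
      fixedCentres (vacant _ ∷ ss)            = fixedCentres ss

      #vacant : List Slot → ℕ
      #vacant []              = 0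
      #vacant (fixed _ ∷ ss)  = #vacant ss
      #vacant (vacant _ ∷ ss) = suc (#vacant ss)

      slotBlocks : Slot → ℕ
      slotBlocks (fixed u)  = blocks u
      slotBlocks (vacant c) = span c

      totalBlocks : List Slot → ℕ
      totalBlocks ss = ∑ ss slotBlocks

      record State (S M : W) (ss : List Slot) : Set where
        field
          distinct : Unique (S ++ M)
          good     : All Good (S ++ M)
          nice     : NiceSeq (S ++ M)
          sized    : slotSizes ss ≡ length S
          valid    : ∀ Y → FixedValid ss (S ++ Y)

      #fresh-↭ : ∀ {us vs} → us ↭ vs → #fresh us ≡ #fresh vs
      #fresh-↭ {us} {vs} p = ∑-cong (allFin n) λ v → ≤-antisym
        (χ-mono (fresh? us v) (fresh? vs v) (λ { (b , g , v∉) → b , g , v∉ ∘ Any-resp-↭ (↭-sym p) }))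
        (χ-mono (fresh? vs v) (fresh? us v) (λ { (b , g , v∉) → b , g , v∉ ∘ Any-resp-↭ p }))

      record Room (G x : ℕ) (us : W) : Set where
        constructor room
        field enough : n + G * x ≤ G * #fresh us

      room⇒fresh : ∀ {G x us} → Room G x us → n ≤ G * #fresh us
      room⇒fresh (room h) = ≤-trans (m≤m+n n _) h

      room-++ : ∀ {G x us} X → Room G (x + length X) us → Room G x (us ++ X)
      room-++ {G} {x} {us} X (room h) = room (+-cancelʳ-≤ (G * length X) _ _ (begin
        n + G * x + G * length X          ≡⟨ trans (+-assoc n _ _) (cong (n +_) (sym (*-distribˡ-+ G x _))) ⟩
        n + G * (x + length X)            ≤⟨ h ⟩
        G * #fresh us                     ≤⟨ *-monoʳ-≤ G (#fresh-++ us X) ⟩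
        G * (#fresh (us ++ X) + length X) ≡⟨ *-distribˡ-+ G _ _ ⟩
        G * #fresh (us ++ X) + G * length X ∎))
        where open ≤-Reasoning

      room-↭ : ∀ {G x us vs} → us ↭ vs → Room G x us → Room G x vs
      room-↭ {G} {x} p (room h) = room (subst (λ z → n + G * x ≤ G * z) (#fresh-↭ p) h)

      room-≤ : ∀ {G x y us} → x ≤ y → Room G y us → Room G x us
      room-≤ {G} x≤y (room h) = room (≤-trans (+-monoʳ-≤ n (*-monoʳ-≤ G x≤y)) h)

      module Extend {Q G Nm : ℕ} (hκ : ∀ i → i < k → Q * κ (suc i) ≤ κ i) (hn : Q * (Nm * Nm) ≤ n) (G>0 : 0 < G)
                    (hQ : G ^ Nm * (1 + (k * (k * 1) + (suc Nm * (k * 1) + suc Nm * (k * 1)))) < Q) where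

        extend : ∀ N us P M → N ≤ Nm → k ≤ suc N → Room G 0 us → NiceSeq P → NiceSeq M →
                 ∃[ X ] length X ≡ N × All (Fresh us) X × Unique X × NiceSeq (P ++ X ++ M)
        extend N us P M N≤ k≤N rm nP nM = connect {Q} {G} {N} us P M hκ (≤-trans (*-monoʳ-≤ Q (*-mono-≤ N≤ N≤)) hn) (room⇒fresh rm)
          (≤-<-trans (*-mono-≤ (^-monoʳ-≤ G {{>-nonZero G>0}} N≤) (s≤s (+-monoʳ-≤ (k * (k * 1)) (+-mono-≤ (*-monoˡ-≤ (k * 1) (s≤s N≤)) (*-monoˡ-≤ (k * 1) (s≤s N≤)))))) hQ)
          k>0 k≤N nP nM

        attach : ∀ {S M ss} → State S M ss → ∀ u w → length w ≤ size u + (σ + σ) → k ≤ suc (size u + (σ + σ) ∸ length w) →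
                 size u + (σ + σ) ≤ Nm → NiceSeq w → All Good w → Unique ((S ++ M) ++ w) → (∀ Z → Valid u (w ++ Z)) →
                 Room G (length w) (S ++ M) →
                 ∃[ X ] State ((w ++ X) ++ S) M (fixed u ∷ vacant first ∷ vacant first ∷ ss) × length (w ++ X) ≡ size u + (σ + σ)
                      × (S ++ M) ++ (w ++ X) ↭ ((w ++ X) ++ S) ++ M
        attach {S} {M} {ss} st u w w≤ k≤ ≤Nm nw gw uw vu rm =
          finish (extend N ((S ++ M) ++ w) w (S ++ M) (≤-trans (m∸n≤m _ (length w)) ≤Nm) k≤ (room-++ {x = 0} w rm) nw (State.nice st))
          where
          open State st
          N = size u + (σ + σ) ∸ length w
          perm : ∀ X → (S ++ M) ++ (w ++ X) ↭ ((w ++ X) ++ S) ++ M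
          perm X = ↭-trans (++-comm (S ++ M) (w ++ X)) (↭-reflexive (sym (++-assoc (w ++ X) S M)))
          dropped : ∀ X Y → length (w ++ X) ≡ size u + (σ + σ) → drop σ (drop σ (drop (size u) (((w ++ X) ++ S) ++ Y))) ≡ S ++ Y
          dropped X Y e = begin
            drop σ (drop σ (drop (size u) (((w ++ X) ++ S) ++ Y))) ≡⟨ trans (drop-drop σ σ (drop (size u) (((w ++ X) ++ S) ++ Y))) (drop-drop (size u) (σ + σ) (((w ++ X) ++ S) ++ Y)) ⟩
            drop (size u + (σ + σ)) (((w ++ X) ++ S) ++ Y)         ≡⟨ cong (drop (size u + (σ + σ))) (++-assoc (w ++ X) S Y) ⟩
            drop (size u + (σ + σ)) ((w ++ X) ++ S ++ Y)           ≡⟨ drop-++ (w ++ X) (S ++ Y) e ⟩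
            S ++ Y                                                 ∎
            where open ≡-Reasoning
          finish : ∃[ X ] length X ≡ N × All (Fresh ((S ++ M) ++ w)) X × Unique X × NiceSeq (w ++ X ++ S ++ M) → _
          finish (X , lX , f , uX , nX) = X , record
            { distinct = unique-↭ (perm X) (subst Unique (++-assoc (S ++ M) w X) (fresh-unique uw f uX))
            ; good = All-resp-↭ (perm X) (Allₚ.++⁺ good (Allₚ.++⁺ gw (fresh-good f)))
            ; nice = subst NiceSeq (trans (sym (++-assoc w X (S ++ M))) (sym (++-assoc (w ++ X) S M))) nX
            ; sized = trans (cong₂ _+_ (refl {x = size u}) (trans (sym (+-assoc σ σ _)) (cong (σ + σ +_) sized)))
                        (trans (sym (+-assoc (size u) (σ + σ) _)) (trans (cong (_+ length S) (sym lwX)) (sym (length-++ (w ++ X)))))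
            ; valid = λ Y → subst (Valid u) (trans (sym (++-assoc w X (S ++ Y))) (sym (++-assoc (w ++ X) S Y))) (vu (X ++ S ++ Y))
                          , subst (FixedValid ss) (sym (dropped X Y lwX)) (valid Y)
            } , lwX , perm X
            where
            lwX : length (w ++ X) ≡ size u + (σ + σ)
            lwX = trans (length-++ w) (trans (cong (length w +_) lX) (m+[n∸m]≡n w≤))

        k≤σ : k ≤ σ
        k≤σ = ≤-trans (≤-reflexive k≡) (+-monoʳ-≤ (suc t * d) r≤d′)

        d≤σ : d ≤ σ
        d≤σ = ≤-trans (m≤m+n d (t * d)) (m≤m+n (suc t * d) d′)

        wheel-valid : ∀ {v Y} → length Y ≡ (k ∸ 1) + (k ∸ 1) → Wheel v Y → ∀ Z → Valid (A-unit first v) (Y ++ Z)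
        wheel-valid {v} {Y} lY wh Z i i< = subst (λ l → E (v ∷ l)) eq (wh (i * d) id≤)
          where
          id≤ : i * d ≤ k ∸ 1
          id≤ = ≤-trans (step≤before first i i<) (≤-pred (≤-trans (before<k first) (≤-reflexive (sym (suc-pred′ k>0)))))
          eq : take (k ∸ 1) (drop (i * d) Y) ≡ take (k ∸ 1) (drop (i * d) (Y ++ Z))
          eq = sym (trans (cong (take (k ∸ 1)) (drop-app-≤ Y Z (≤-trans id≤ (≤-trans (m≤m+n _ _) (≤-reflexive (sym lY))))))
            (take-app-≤ (drop (i * d) Y) Z (≤-trans (m+n≤o⇒m≤o∸n (k ∸ 1) (≤-trans (+-monoʳ-≤ (k ∸ 1) id≤) (≤-reflexive (sym lY)))) (≤-reflexive (sym (length-drop (i * d) Y))))))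

        WheelSource : W → Fin n → ℕ → Set
        WheelSource us v L = Unique us → length us ≤ L → Room G 0 us →
          ∃[ Y ] length Y ≡ (k ∸ 1) + (k ∸ 1) × All (Fresh us) Y × Unique Y × Wheel v Y × NiceSeq Y

        record Attached (S M : W) (ss : List Slot) (vs : W) (x : ℕ) : Set where
          field
            S′     : W
            ss′    : List Slot
            state  : State (S′ ++ S) M (ss′ ++ ss)
            len    : length S′ ≡ length vs * (3 * σ)
            spare  : Room G x ((S′ ++ S) ++ M)
            centre : fixedCentres (ss′ ++ ss) ≡ vs ++ fixedCentres ss
            vacancies : #vacant (ss′ ++ ss) ≡ 2 * length vs + #vacant ss
            block  : totalBlocks (ss′ ++ ss) ≡ totalBlocks ss + 3 * length vs * suc (suc t)

        attachAll : ∀ {S M ss} L → 3 * σ ≤ Nm → State S M ss → ∀ vs → (∀ v → v ∈ vs → ∀ us → WheelSource us v L) →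
                    length (S ++ M) + length vs * (3 * σ) ≤ L → ∀ x → Room G (x + length vs * (3 * σ)) (S ++ M) → Attached S M ss vs x
        attachAll {S} {M} {ss} L hN st [] src hL x rm = record
          { S′ = [] ; ss′ = [] ; state = st ; len = refl ; spare = room-≤ (≤-reflexive (sym (+-identityʳ x))) rm
          ; centre = refl ; vacancies = refl ; block = sym (+-identityʳ _) }
        attachAll {S} {M} {ss} L hN st (v ∷ vs) src hL x rm = attachOne
          (attachAll L hN st vs (λ v′ v∈ → src v′ (there v∈)) (≤-trans (+-monoʳ-≤ (length (S ++ M)) (m≤n+m _ (3 * σ))) hL)
                 (x + 3 * σ) (room-≤ (≤-reflexive (+-assoc x (3 * σ) _)) rm))
          where
          σ3 : σ + (σ + σ) ≡ 3 * σ
          σ3 = arith σ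
            where
            arith : ∀ σ → σ + (σ + σ) ≡ 3 * σ
            arith = solve-∀
          2m≤ : (k ∸ 1) + (k ∸ 1) ≤ σ + σ
          2m≤ = +-mono-≤ (≤-trans (m∸n≤m k 1) k≤σ) (≤-trans (m∸n≤m k 1) k≤σ)
          Y≤ : ∀ {Y : W} → length Y ≡ (k ∸ 1) + (k ∸ 1) → length Y ≤ σ + (σ + σ)
          Y≤ e = ≤-trans (≤-reflexive e) (≤-trans 2m≤ (m≤n+m _ σ))
          k≤′ : ∀ {Y : W} → length Y ≡ (k ∸ 1) + (k ∸ 1) → k ≤ suc (σ + (σ + σ) ∸ length Y)
          k≤′ {Y} e = ≤-trans k≤σ (≤-trans (m+n≤o⇒m≤o∸n σ (+-monoʳ-≤ σ (≤-trans (≤-reflexive e) 2m≤))) (n≤1+n _))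
          vac : ∀ a b → suc (suc (2 * a + b)) ≡ 2 * suc a + b
          vac = solve-∀
          blk : ∀ s b b′ a → b ≡ b′ + 3 * a * s → s + (s + (s + b)) ≡ b′ + 3 * suc a * s
          blk s b b′ a refl = arith s b′ a
            where
            arith : ∀ s b a → s + (s + (s + (b + 3 * a * s))) ≡ b + 3 * suc a * s
            arith = solve-∀
          attachOne : Attached S M ss vs (x + 3 * σ) → Attached S M ss (v ∷ vs) x
          attachOne at = withWheel (src v (here refl) ((S₁ ++ S) ++ M) (State.distinct st₁) len₁ (room-≤ z≤n rm₁))
            where
            open Attached at renaming (S′ to S₁; ss′ to ss₁; state to st₁; len to l₁; spare to rm₁; centre to c₁; vacancies to v₁; block to b₁)
            len₁ : length ((S₁ ++ S) ++ M) ≤ L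
            len₁ = ≤-trans (≤-reflexive (trans (cong length (++-assoc S₁ S M)) (trans (length-++ S₁) (trans (cong (_+ length (S ++ M)) l₁) (+-comm _ (length (S ++ M)))))))
                       (≤-trans (+-monoʳ-≤ (length (S ++ M)) (m≤n+m _ (3 * σ))) hL)
            withWheel : ∃[ Y ] length Y ≡ (k ∸ 1) + (k ∸ 1) × All (Fresh ((S₁ ++ S) ++ M)) Y × Unique Y × Wheel v Y × NiceSeq Y → Attached S M ss (v ∷ vs) x
            withWheel (Y , lY , f , uY , wh , nY) = withLink
              (attach st₁ (A-unit first v) Y (Y≤ {Y} lY) (k≤′ {Y} lY) (≤-trans (≤-reflexive σ3) hN) nY (fresh-good f)
                         (fresh-unique (State.distinct st₁) f uY) (wheel-valid lY wh) (room-≤ (≤-trans (Y≤ {Y} lY) (≤-trans (≤-reflexive σ3) (m≤n+m _ x))) rm₁))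
              where
              withLink : ∃[ X ] State ((Y ++ X) ++ S₁ ++ S) M (fixed (A-unit first v) ∷ vacant first ∷ vacant first ∷ ss₁ ++ ss) × length (Y ++ X) ≡ σ + (σ + σ)
                      × ((S₁ ++ S) ++ M) ++ (Y ++ X) ↭ ((Y ++ X) ++ S₁ ++ S) ++ M → Attached S M ss (v ∷ vs) x
              withLink (X , st₂ , lX , perm) = record
                { S′ = (Y ++ X) ++ S₁
                ; ss′ = fixed (A-unit first v) ∷ vacant first ∷ vacant first ∷ ss₁
                ; state = subst (λ l → State l M (fixed (A-unit first v) ∷ vacant first ∷ vacant first ∷ ss₁ ++ ss)) (sym (++-assoc (Y ++ X) S₁ S)) st₂
                ; len = trans (length-++ (Y ++ X)) (cong₂ _+_ (trans lX σ3) l₁)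
                ; spare = subst (λ l → Room G x (l ++ M)) (sym (++-assoc (Y ++ X) S₁ S)) (room-↭ perm (room-++ (Y ++ X) (room-≤ (+-monoʳ-≤ x (≤-reflexive (trans lX σ3))) rm₁)))
                ; centre = cong (v ∷_) c₁
                ; vacancies = trans (cong (suc ∘ suc) v₁) (vac (length vs) (#vacant ss))
                ; block = blk (suc (suc t)) (totalBlocks (ss₁ ++ ss)) (totalBlocks ss) (length vs) b₁ }

      s : ℕ
      s = suc (suc t)

      WeakA′? : ∀ q v → Dec (¬ Good v × (InB B v ⊎ ¬ Strong q v))
      WeakA′? q v = ¬? (nice? [ v ]) ×-dec (InB?′ v ⊎-dec ¬? (q * ΣW (k ∸ 1) (λ l → χ (NonLink? v l)) ≤? 1 * n ^ (k ∸ 1)))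

      weakList : ℕ → W
      weakList q = filter (WeakA′? q) (allFin n)

      length-weakList : ∀ q → length (weakList q) ≤ #exceptional + #weakA q
      length-weakList q = ≤-trans (≤-reflexive (length-filter (WeakA′? q) (allFin n)))
        (≤-trans (∑-mono (allFin n) (λ v → χ-⊎ (WeakA′? q v) (Exceptional? v) (WeakA? q v) (split v))) (≤-reflexive (∑-+ (allFin n) _ _)))
        where
        split : ∀ v → ¬ Good v × (InB B v ⊎ ¬ Strong q v) → (InB B v × ¬ Nice [ v ]) ⊎ (¬ InB B v × ¬ Strong q v)
        split v (¬g , inj₁ b) = inj₁ (b , ¬g)
        split v (¬g , inj₂ ¬s) = go (InB?′ v)
          where
          go : Dec (InB B v) → _
          go (yes b) = inj₁ (b , ¬g)
          go (no ¬b) = inj₂ (¬b , ¬s)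

      #B : ℕ
      #B = ∑ (allFin n) (λ v → χ (InB?′ v))

      #B-≤ : #B ≤ #fresh [] + #exceptional
      #B-≤ = ≤-trans (∑-mono (allFin n) (λ v → χ-⊎ (InB?′ v) (fresh? [] v) (Exceptional? v) (λ b → split v b (nice? [ v ])))) (≤-reflexive (∑-+ (allFin n) _ _))
        where
        split : ∀ v → InB B v → Dec (Nice [ v ]) → Fresh [] v ⊎ (InB B v × ¬ Nice [ v ])
        split v b (yes g) = inj₁ (b , g , λ ())
        split v b (no ¬g) = inj₂ (b , ¬g)

      room-[] : ∀ {G′ x} → n ≤ 2 * #B → 4 * (#exceptional + x) ≤ n → Room (suc G′ * 4) x []
      room-[] {G′} {x} hB hx = room (begin
        n + suc G′ * 4 * x        ≤⟨ m≤m+n _ (G′ * n) ⟩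
        n + suc G′ * 4 * x + G′ * n ≡⟨ arith₁ n G′ x ⟩
        suc G′ * (n + 4 * x)      ≤⟨ *-monoʳ-≤ (suc G′) core ⟩
        suc G′ * (4 * #fresh [])  ≡⟨ *-assoc (suc G′) 4 (#fresh []) ⟨
        suc G′ * 4 * #fresh []    ∎)
        where
        open ≤-Reasoning
        arith₁ : ∀ n g x → n + suc g * 4 * x + g * n ≡ suc g * (n + 4 * x)
        arith₁ = solve-∀
        arith₂ : ∀ n e x → n + 4 * x + (n + 4 * e) ≡ 2 * n + 4 * (e + x)
        arith₂ = solve-∀
        arith₃ : ∀ f e n → 2 * (2 * (f + e)) + n ≡ 4 * f + (n + 4 * e)
        arith₃ = solve-∀
        core : n + 4 * x ≤ 4 * #fresh []
        core = +-cancelʳ-≤ (n + 4 * #exceptional) _ _ (begin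
          n + 4 * x + (n + 4 * #exceptional)      ≡⟨ arith₂ n #exceptional x ⟩
          2 * n + 4 * (#exceptional + x)          ≤⟨ +-mono-≤ (*-monoʳ-≤ 2 (≤-trans hB (*-monoʳ-≤ 2 #B-≤))) hx ⟩
          2 * (2 * (#fresh [] + #exceptional)) + n ≡⟨ arith₃ (#fresh []) #exceptional n ⟩
          4 * #fresh [] + (n + 4 * #exceptional)  ∎)

      record Constants : Set where
        field
          Q G′ Nm q₀ L : ℕ
        G : ℕ
        G = suc G′ * 4
        field
          hκ₂   : ∀ i → i < k → Q * (κ (suc i) * κ (suc i)) ≤ κ i
          κk>0  : 0 < κ k
          hn    : Q * (Nm * Nm) ≤ n
          hQ    : G ^ Nm * (1 + (k * (k * 1) + (suc Nm * (k * 1) + suc Nm * (k * 1)))) < Q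
          3σ≤   : 3 * σ ≤ Nm
          nil   : Nice []
          hC    : G ^ (k ∸ 1) * (1 + (2 * σ + s * (d + 2 * σ))) < κ 1
          hQe   : 1 + edgeEvents < Q
          hnk   : Q * κ 1 * (k * k) ≤ n
          hF    : Q * κ 1 * (#exceptional + (L + k)) ≤ n
          hq₀κ  : q₀ * κ 1 ≤ κ 0
          hq₀   : let m = k ∸ 1 in cubeConst m (κ 1) * (1 + ((m + m) + suc (m + m) * (k * 1))) < q₀
          hq₀n  : let m = k ∸ 1 in q₀ * ((m + m) * (m + m)) ≤ n
          hq₀F  : q₀ * (#exceptional + L) ≤ n
        hκ : ∀ i → i < k → Q * κ (suc i) ≤ κ i
        hκ i i<k = ≤-trans (*-monoʳ-≤ Q (≤-trans (≤-reflexive (sym (*-identityʳ _))) (*-monoʳ-≤ (κ (suc i)) (<-≤-trans κk>0 (κ-mono i<k))))) (hκ₂ i i<k)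
        G>0 : 0 < G
        G>0 = z<s
        open Extend {Q} {G} {Nm} hκ hn G>0 hQ public

      module Phase0 (C : Constants) where
        open Constants C public

        record Zoned (g x : ℕ) : Set where
          field
            S         : W
            ss        : List Slot
            state     : State S [] ss
            len       : length S ≡ 2 * σ + g * (d + 2 * σ)
            spare     : Room G x (S ++ [])
            centre    : fixedCentres ss ≡ []
            vacancies : #vacant ss ≡ 2 + 2 * g
            block     : totalBlocks ss ≡ 2 * s + g * (1 + 2 * s)

        niceSeq-[] : NiceSeq []
        niceSeq-[] i j _ = subst Nice (sym (trans (cong (take j) (drop-[] i)) (take-[] j))) nil

        seed : ∀ x → Room G (x + 2 * σ) [] → Zoned 0 x
        seed x rm = finish (extend (2 * σ) [] [] [] 2σ≤ k≤ (room-≤ z≤n rm) niceSeq-[] niceSeq-[])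
          where
          2σ≤ : 2 * σ ≤ Nm
          2σ≤ = ≤-trans (m≤n+m (2 * σ) σ) 3σ≤
          k≤ : k ≤ suc (2 * σ)
          k≤ = ≤-trans k≤σ (≤-trans (m≤m+n σ _) (n≤1+n _))
          finish : ∃[ X ] length X ≡ 2 * σ × All (Fresh []) X × Unique X × NiceSeq ([] ++ X ++ []) → Zoned 0 x
          finish (X , lX , f , uX , nX) = record
            { S = X ; ss = vacant first ∷ vacant first ∷ []
            ; state = record
              { distinct = subst Unique (sym (++-identityʳ X)) uX
              ; good = subst (All Good) (sym (++-identityʳ X)) (fresh-good f)
              ; nice = nX
              ; sized = trans (arith σ) (sym lX)
              ; valid = λ Y → tt }
            ; len = trans lX (sym (+-identityʳ _))
            ; spare = subst (Room G x) (sym (++-identityʳ X)) (room-++ {us = []} X (subst (λ z → Room G (x + z) []) (sym lX) rm))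
            ; centre = refl ; vacancies = refl ; block = arith₂ s }
            where
            arith : ∀ σ → σ + (σ + 0) ≡ 2 * σ
            arith = solve-∀
            arith₂ : ∀ s → s + (s + 0) ≡ 2 * s + 0
            arith₂ = solve-∀

        addEdges : ∀ g x → 0 < deficit ⊎ g ≡ 0 → g ≤ s * deficit → 2 * σ + g * (d + 2 * σ) ≤ L → Room G (x + 2 * σ + g * (d + 2 * σ)) [] → Zoned g x
        addEdges zero x _ _ _ rm = seed x (room-≤ (≤-reflexive (sym (+-identityʳ _))) rm)
        addEdges (suc g) x (inj₁ d>0) g≤ hL rm = step (addEdges g (x + (d + 2 * σ)) (inj₁ d>0) (≤-trans (n≤1+n g) g≤)
            (≤-trans (+-monoʳ-≤ (2 * σ) (m≤n+m _ (d + 2 * σ))) hL) (room-≤ (≤-reflexive (arith x σ (g * (d + 2 * σ)) (d + 2 * σ))) rm))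
          where
          arith : ∀ x σ y z → x + z + 2 * σ + y ≡ x + 2 * σ + (z + y)
          arith = solve-∀
          step : Zoned g (x + (d + 2 * σ)) → Zoned (suc g) x
          step z = withWord (free-edge-word {2 * σ + s * (d + 2 * σ)} {G} {Q} (S ++ []) (State.distinct state) nil hκ₂ κk>0 d>0 hus
                      (room⇒fresh spare) hC hQe hnk (≤-trans (*-monoʳ-≤ (Q * κ 1) (+-monoʳ-≤ #exceptional (+-monoˡ-≤ k lenL))) hF))
            where
            open Zoned z
            lenS : length (S ++ []) ≡ 2 * σ + g * (d + 2 * σ)
            lenS = trans (cong length (++-identityʳ S)) len
            lenL : length (S ++ []) ≤ L
            lenL = ≤-trans (≤-reflexive lenS) (≤-trans (+-monoʳ-≤ (2 * σ) (m≤n+m _ (d + 2 * σ))) hL)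
            hus : length (S ++ []) ≤ (2 * σ + s * (d + 2 * σ)) * deficit
            hus = ≤-trans (≤-reflexive lenS) (≤-trans (+-mono-≤ (≤-trans (≤-reflexive (sym (*-identityʳ (2 * σ)))) (*-monoʳ-≤ (2 * σ) d>0))
              (≤-trans (*-monoˡ-≤ (d + 2 * σ) (≤-trans (n≤1+n g) g≤)) (≤-reflexive (arith₂ s deficit (d + 2 * σ))))) (≤-reflexive (sym (*-distribʳ-+ deficit (2 * σ) _))))
              where
              arith₂ : ∀ a b c → a * b * c ≡ a * c * b
              arith₂ = solve-∀
            withWord : ∃[ w ] length w ≡ k × E w × NiceSeq w × All Good w × Unique ((S ++ []) ++ w) → Zoned (suc g) x
            withWord (w , lw , hw , nw , gw , uw) = withLink (attach state B-unit w w≤ k≤ (≤-trans (+-monoˡ-≤ (σ + σ) d≤σ) (≤-trans (≤-reflexive σ3) 3σ≤)) nw gw uw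
                (λ Z → subst E (sym (take-++ w Z lw)) hw) (room-≤ (≤-trans (≤-reflexive lw) (≤-trans k≤2σ (≤-trans (m≤n+m (2 * σ) d) (m≤n+m _ x)))) spare))
              where
              σ3 : σ + (σ + σ) ≡ 3 * σ
              σ3 = arith₃ σ
                where
                arith₃ : ∀ σ → σ + (σ + σ) ≡ 3 * σ
                arith₃ = solve-∀
              k≤2σ : k ≤ 2 * σ
              k≤2σ = ≤-trans k≤σ (m≤m+n σ _)
              w≤ : length w ≤ d + (σ + σ)
              w≤ = ≤-trans (≤-reflexive lw) (≤-trans k≤σ (≤-trans (m≤m+n σ σ) (m≤n+m _ d)))
              k≤ : k ≤ suc (d + (σ + σ) ∸ length w)
              k≤ = ≤-trans (m+n≤o⇒m≤o∸n k (≤-trans (+-mono-≤ k≤σ (≤-trans (≤-reflexive lw) k≤σ)) (m≤n+m _ d))) (n≤1+n _)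
              withLink : ∃[ X ] State ((w ++ X) ++ S) [] (fixed B-unit ∷ vacant first ∷ vacant first ∷ ss) × length (w ++ X) ≡ d + (σ + σ)
                         × (S ++ []) ++ (w ++ X) ↭ ((w ++ X) ++ S) ++ [] → Zoned (suc g) x
              withLink (X , st , lX , perm) = record
                { S = (w ++ X) ++ S ; ss = fixed B-unit ∷ vacant first ∷ vacant first ∷ ss ; state = st
                ; len = trans (length-++ (w ++ X)) (trans (cong₂ _+_ lX len) (arith₄ d σ (g * (d + 2 * σ))))
                ; spare = room-↭ perm (room-++ (w ++ X) (room-≤ (+-monoʳ-≤ x (≤-reflexive (trans lX (cong (d +_) (cong (σ +_) (sym (+-identityʳ σ))))))) spare))
                ; centre = centre
                ; vacancies = trans (cong (suc ∘ suc) vacancies) (arith₅ g)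
                ; block = trans (cong (λ b → 1 + (s + (s + b))) block) (arith₆ s g) }
                where
                arith₄ : ∀ d σ y → d + (σ + σ) + (2 * σ + y) ≡ 2 * σ + (d + 2 * σ + y)
                arith₄ = solve-∀
                arith₅ : ∀ g → suc (suc (2 + 2 * g)) ≡ 2 + 2 * suc g
                arith₅ = solve-∀
                arith₆ : ∀ s g → 1 + (s + (s + (2 * s + g * (1 + 2 * s)))) ≡ 2 * s + suc g * (1 + 2 * s)
                arith₆ = solve-∀

        weak-source : ∀ v → ¬ Good v → ∀ us → WheelSource us v L
        weak-source v ¬g us uu us≤ rm = weak-wheel us v ¬g k>0 hq₀κ nil hq₀ hq₀n
          (≤-trans (*-monoʳ-≤ q₀ (≤-trans (#notFresh-≤ us) (+-monoʳ-≤ #exceptional us≤))) hq₀F)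

        record Special : Set where
          field
            S         : W
            ss        : List Slot
            state     : State S [] ss
            len       : length S ≡ 2 * σ + s * deficit * (d + 2 * σ) + length (weakList Q) * (3 * σ)
            centre    : fixedCentres ss ≡ weakList Q
            vacancies : #vacant ss ≡ 2 + 2 * (s * deficit) + 2 * length (weakList Q)
            block     : totalBlocks ss ≡ 2 * s + s * deficit * (1 + 2 * s) + 3 * length (weakList Q) * s

        special : n ≤ 2 * #B → 4 * (#exceptional + L) ≤ n → 2 * σ + s * deficit * (d + 2 * σ) + length (weakList Q) * (3 * σ) ≤ L → Special
        special hB h4 hL = weaken (addEdges g w (pos deficit) ≤-refl (≤-trans (m≤m+n _ w) hL)
            (room-[] {G′} hB (≤-trans (*-monoʳ-≤ 4 (+-monoʳ-≤ #exceptional (≤-trans (≤-reflexive (trans (+-assoc w (2 * σ) _) (+-comm w _))) hL))) h4)))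
          where
          g = s * deficit
          w = length (weakList Q) * (3 * σ)
          pos : ∀ q → 0 < q ⊎ s * q ≡ 0
          pos zero = inj₂ (*-zeroʳ s)
          pos (suc q) = inj₁ z<s
          weaken : Zoned g w → Special
          weaken z = wrap (attachAll L 3σ≤ (Zoned.state z) (weakList Q) (λ v v∈ → weak-source v (proj₁ (proj₂ (∈-filter⁻ (WeakA′? Q) {xs = allFin n} v∈))))
                       (≤-trans (+-monoˡ-≤ w (≤-reflexive (trans (cong length (++-identityʳ (Zoned.S z))) (Zoned.len z)))) hL) 0 (Zoned.spare z))
            where
            wrap : Attached (Zoned.S z) [] (Zoned.ss z) (weakList Q) 0 → Special
            wrap at = record
              { S = S′ ++ Zoned.S z ; ss = ss′ ++ Zoned.ss z ; state = state
              ; len = trans (length-++ S′) (trans (cong₂ _+_ len (Zoned.len z)) (+-comm w _))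
              ; centre = trans centre (trans (cong (weakList Q ++_) (Zoned.centre z)) (++-identityʳ _))
              ; vacancies = trans vacancies (trans (cong (2 * length (weakList Q) +_) (Zoned.vacancies z)) (+-comm (2 * length (weakList Q)) _))
              ; block = trans block (cong (_+ 3 * length (weakList Q) * s) (Zoned.block z)) }
              where open Attached at

      unique-length : ∀ {l : W} → Unique l → length l ≤ n
      unique-length {l} u = ≤-trans (≤-reflexive (sym (∑-unique l u))) (≤-trans (∑-mono (allFin n) (λ v → χ≤1 (v ∈? l)))
        (≤-reflexive (trans (∑V-const 1) (*-identityʳ n))))

      flat : List (W × W) → W
      flat []             = []
      flat ((u , v) ∷ cs) = (u ++ v) ++ flat cs

      flat-++ : ∀ cs ds → flat (cs ++ ds) ≡ flat cs ++ flat ds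
      flat-++ []             ds = refl
      flat-++ ((u , v) ∷ cs) ds = trans (cong ((u ++ v) ++_) (flat-++ cs ds)) (sym (++-assoc (u ++ v) (flat cs) (flat ds)))

      record Chunk (K : ℕ) (c : W × W) : Set where
        field
          lengthˡ : length (proj₁ c) ≡ k
          lengthʳ : length (proj₂ c) ≡ k
          inB     : All (InB B) (proj₁ c ++ proj₂ c)
          uncrowded : K * totalMisfit (k + k) (proj₁ c ++ proj₂ c) ≤ n

      mis : Fin n → W → ℕ
      mis a []      = 0
      mis a (x ∷ l) = χ (¬? (E? (a ∷ take (k ∸ 1) (x ∷ l)))) + mis a l

      mis-≤-length : ∀ a l → mis a l ≤ length l
      mis-≤-length a []      = z≤n
      mis-≤-length a (x ∷ l) = +-mono-≤ (χ≤1 (¬? (E? (a ∷ take (k ∸ 1) (x ∷ l))))) (mis-≤-length a l)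

      ∑mis : W → ℕ
      ∑mis l = ∑ (allFin n) (λ a → χ (¬? (nice? [ a ])) * mis a l)

      ∑mis-∷ : ∀ x l → ∑mis (x ∷ l) ≡ nonEdges (take (k ∸ 1) (x ∷ l)) + ∑mis l
      ∑mis-∷ x l = trans (∑-cong (allFin n) (λ a → trans (*-distribˡ-+ (χ (¬? (nice? [ a ]))) _ (mis a l))
          (cong (_+ χ (¬? (nice? [ a ])) * mis a l) (sym (χ-× (NonEdge? (take (k ∸ 1) (x ∷ l)) a) (¬? (nice? [ a ])) (¬? (E? (a ∷ take (k ∸ 1) (x ∷ l)))) id _,_)))))
        (∑-+ (allFin n) _ _)

      ∑mis-≤ : ∀ {Q} → (∀ T → Unique T → length T ≡ k ∸ 1 → Nice T → Q * nonEdges T ≤ 2 * n) →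
               ∀ l → Unique l → NiceSeq l → Q * ∑mis l ≤ length l * (2 * n) + Q * ((length l ⊓ k) * n)
      ∑mis-≤ {Q} h [] u nl = ≤-reflexive (trans (cong (Q *_) (trans (∑-cong (allFin n) (λ a → *-zeroʳ (χ (¬? (nice? [ a ]))))) (∑-zero (allFin n)))) refl)
      ∑mis-≤ {Q} h (x ∷ l) u@(_ ∷ ul) nl = ≤-trans (≤-reflexive (trans (cong (Q *_) (∑mis-∷ x l)) (*-distribˡ-+ Q _ _))) (go (k ∸ 1 ≤? length (x ∷ l)))
        where
        open ≤-Reasoning
        m = k ∸ 1
        T = take m (x ∷ l)
        IH : Q * ∑mis l ≤ length l * (2 * n) + Q * ((length l ⊓ k) * n)
        IH = ∑mis-≤ {Q} h l ul (niceSeq-++ʳ [ x ] nl)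
        go : Dec (m ≤ length (x ∷ l)) → Q * nonEdges T + Q * ∑mis l ≤ length (x ∷ l) * (2 * n) + Q * ((length (x ∷ l) ⊓ k) * n)
        go (yes m≤) = begin
          Q * nonEdges T + Q * ∑mis l
            ≤⟨ +-mono-≤ (h T (subst Unique refl (unique-++ˡ T (subst Unique (sym (take++drop≡id m (x ∷ l))) u))) (length-take-≤ (x ∷ l) m≤) (nl 0 m (≤-reflexive (suc-pred′ k>0)))) IH ⟩
          2 * n + (length l * (2 * n) + Q * ((length l ⊓ k) * n)) ≡⟨ +-assoc (2 * n) _ _ ⟨
          length (x ∷ l) * (2 * n) + Q * ((length l ⊓ k) * n)
            ≤⟨ +-monoʳ-≤ (length (x ∷ l) * (2 * n)) (*-monoʳ-≤ Q (*-monoˡ-≤ n (⊓-monoˡ-≤ k (n≤1+n (length l))))) ⟩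
          length (x ∷ l) * (2 * n) + Q * ((length (x ∷ l) ⊓ k) * n) ∎
        go (no ¬m≤) = begin
          Q * nonEdges T + Q * ∑mis l
            ≤⟨ +-mono-≤ (*-monoʳ-≤ Q (≤-trans (∑-mono (allFin n) (λ v → χ≤1 (NonEdge? T v))) (≤-reflexive (∑V-const 1)))) IH ⟩
          Q * (n * 1) + (length l * (2 * n) + Q * ((length l ⊓ k) * n))
            ≡⟨ cong (λ z → Q * (n * 1) + (length l * (2 * n) + Q * (z * n))) (m≤n⇒m⊓n≡m (<⇒≤ sl<k)) ⟩
          Q * (n * 1) + (length l * (2 * n) + Q * (length l * n)) ≤⟨ m≤n+m _ (2 * n) ⟩
          2 * n + (Q * (n * 1) + (length l * (2 * n) + Q * (length l * n))) ≡⟨ arith Q n (length l) ⟩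
          length (x ∷ l) * (2 * n) + Q * (suc (length l) * n)
            ≡⟨ cong (λ z → length (x ∷ l) * (2 * n) + Q * (z * n)) (m≤n⇒m⊓n≡m sl<k) ⟨
          length (x ∷ l) * (2 * n) + Q * ((length (x ∷ l) ⊓ k) * n) ∎
          where
          sl<k : suc (length l) ≤ k
          sl<k = ≤-trans (<⇒≤ (≰⇒> ¬m≤)) (m∸n≤m k 1)
          arith : ∀ Q n l → 2 * n + (Q * (n * 1) + (l * (2 * n) + Q * (l * n))) ≡ suc l * (2 * n) + Q * (suc l * n)
          arith = solve-∀

      record RingConstants (C : Constants) : Set where
        open Constants C
        G₁ : ℕ
        G₁ = suc G′ * 2
        field
          Kc Ko  : ℕ
          hChunk : G₁ ^ (k + k) * (1 + (k * (k * 1) + (suc (k + k) * (k * 1) + Kc * (suc (k + k) * (k * 1))))) < Q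
          hWheel : G ^ ((k ∸ 1) + (k ∸ 1)) * (1 + (suc (k ∸ 1) * 1 + suc ((k ∸ 1) + (k ∸ 1)) * (k * 1))) < Q
          2k≤Nm  : k + k ≤ Nm
          hQk    : Q * k ≤ n
          hMis   : ∀ T → Unique T → length T ≡ k ∸ 1 → Nice T → Q * nonEdges T ≤ 2 * n
          -- the vertices used after the chunks, including the last chunk
          hAfter : ∀ a b → Q * a ≤ 3 * Ko * n → Kc * b ≤ 4 * n → G * ((k + k) + (k + b * suc k + a * (3 * σ))) ≤ n

      module Phase1 (C : Constants) (R : RingConstants C) where
        open Phase0 C public
        open RingConstants R public

        record Chunked (S : W) (ss : List Slot) : Set where
          field
            cs    : List (W × W)
            state : State S (flat cs) ss
            shape : All (Chunk Kc) cs
            full  : G₁ * #fresh (S ++ flat cs) < n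
            lower : n ≤ G₁ * (#fresh (S ++ flat cs) + (k + k))

        fill : ∀ {S ss} fuel cs → State S (flat cs) ss → All (Chunk Kc) cs → n < length (S ++ flat cs) + fuel →
               n ≤ G₁ * (#fresh (S ++ flat cs) + (k + k)) → Chunked S ss
        fill {S} zero cs st sh hf lo = contradiction (unique-length (State.distinct st)) (<⇒≱ (subst (n <_) (+-identityʳ _) hf))
        fill {S} {ss} (suc fuel) cs st sh hf lo = go (G₁ * #fresh (S ++ flat cs) <? n)
          where
          P = S ++ flat cs
          go : Dec (G₁ * #fresh P < n) → Chunked S ss
          go (yes p) = record { cs = cs ; state = st ; shape = sh ; full = p ; lower = lo }
          go (no ¬p) = add (chunk {Q} {G₁} {Kc} P P hκ (≤-trans (*-monoʳ-≤ Q (*-mono-≤ 2k≤Nm 2k≤Nm)) hn) (≮⇒≥ ¬p) hChunk k>1 (State.nice st))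
            where
            add : ∃[ X ] length X ≡ k + k × All (Fresh P) X × Unique X × NiceSeq (P ++ X) × Kc * totalMisfit (k + k) X ≤ n → Chunked S ss
            add (X , lX , f , uX , nX , h) = fill fuel cs′ (record
                { distinct = subst Unique eq (fresh-unique (State.distinct st) f uX)
                ; good = subst (All Good) eq (Allₚ.++⁺ (State.good st) (fresh-good f))
                ; nice = subst NiceSeq eq nX
                ; sized = State.sized st ; valid = State.valid st })
                (Allₚ.++⁺ sh (record
                  { lengthˡ = length-take-≤ X (≤-trans (m≤m+n k k) (≤-reflexive (sym lX)))
                  ; lengthʳ = trans (length-drop k X) (trans (cong (_∸ k) lX) (m+n∸m≡n k k))
                  ; inB = subst (All (InB B)) (sym (take++drop≡id k X)) (Fresh⇒InB f)
                  ; uncrowded = subst (λ l → Kc * totalMisfit (k + k) l ≤ n) (sym (take++drop≡id k X)) h } ∷ []))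
                (subst (λ l → n < length l + fuel) eq (≤-trans hf (≤-trans (≤-reflexive (+-suc _ fuel)) (+-monoˡ-≤ fuel longer))))
                (≤-trans (≮⇒≥ ¬p) (*-monoʳ-≤ G₁ (≤-trans (#fresh-++ P X) (≤-reflexive (cong₂ (λ l z → #fresh l + z) eq lX)))))
              where
              cs′ = cs ++ (take k X , drop k X) ∷ []
              eq : P ++ X ≡ S ++ flat cs′
              eq = trans (++-assoc S (flat cs) X) (cong (S ++_) (trans (cong (flat cs ++_) (trans (sym (take++drop≡id k X)) (sym (++-identityʳ _)))) (sym (flat-++ cs _))))
              longer : suc (length P) ≤ length (P ++ X)
              longer = ≤-trans (≤-reflexive (+-comm 1 _)) (≤-trans (+-monoʳ-≤ (length P) (≤-trans (≤-trans k>0 (m≤m+n k k)) (≤-reflexive (sym lX)))) (≤-reflexive (sym (length-++ P))))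

        OverA? : ∀ cs a → Dec (¬ Good a × a ∉ weakList Q × n < Ko * mis a (flat cs))
        OverA? cs a = ¬? (nice? [ a ]) ×-dec ¬? (a ∈? weakList Q) ×-dec (n <? Ko * mis a (flat cs))

        overA : List (W × W) → W
        overA cs = filter (OverA? cs) (allFin n)

        few-overA : ∀ cs → Unique (flat cs) → NiceSeq (flat cs) → Q * length (overA cs) ≤ 3 * Ko * n
        few-overA cs u nl = *-cancelʳ-≤ _ _ n {{>-nonZero n>0}} (begin
          Q * length (overA cs) * n                 ≡⟨ trans (*-assoc Q _ n) (cong (Q *_) (trans (*-comm _ n) (cong (n *_) (length-filter (OverA? cs) (allFin n))))) ⟩
          Q * (n * ∑ (allFin n) (λ a → χ (OverA? cs a))) ≡⟨ cong (Q *_) (∑-* n (allFin n) _) ⟨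
          Q * ∑ (allFin n) (λ a → n * χ (OverA? cs a)) ≤⟨ *-monoʳ-≤ Q (∑-mono (allFin n) per) ⟩
          Q * ∑ (allFin n) (λ a → Ko * (χ (¬? (nice? [ a ])) * mis a (flat cs))) ≡⟨ cong (Q *_) (∑-* Ko (allFin n) _) ⟩
          Q * (Ko * ∑mis (flat cs))                 ≡⟨ x∙yz≈y∙xz Q Ko _ ⟩
          Ko * (Q * ∑mis (flat cs))                 ≤⟨ *-monoʳ-≤ Ko (∑mis-≤ {Q} hMis (flat cs) u nl) ⟩
          Ko * (length (flat cs) * (2 * n) + Q * ((length (flat cs) ⊓ k) * n))
            ≤⟨ *-monoʳ-≤ Ko (+-mono-≤ (*-monoˡ-≤ (2 * n) (unique-length u)) (≤-trans (*-monoʳ-≤ Q (*-monoˡ-≤ n (m⊓n≤n (length (flat cs)) k))) (≤-trans (≤-reflexive (sym (*-assoc Q k n))) (*-monoˡ-≤ n hQk)))) ⟩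
          Ko * (n * (2 * n) + n * n)                ≡⟨ arith Ko n ⟩
          3 * Ko * n * n                            ∎)
          where
          open ≤-Reasoning
          arith : ∀ K n → K * (n * (2 * n) + n * n) ≡ 3 * K * n * n
          arith = solve-∀
          per : ∀ a → n * χ (OverA? cs a) ≤ Ko * (χ (¬? (nice? [ a ])) * mis a (flat cs))
          per a = χ-≤ (OverA? cs a) λ { (¬g , _ , h) → ≤-trans (<⇒≤ h) (*-monoʳ-≤ Ko (≤-reflexive (sym (trans (cong (_* mis a (flat cs)) (χ-yes (¬? (nice? [ a ])) ¬g)) (*-identityˡ _))))) }

        ∑misfit : List (W × W) → Fin n → ℕ
        ∑misfit cs x = ∑ cs (λ c → misfit (k + k) (proj₁ c ++ proj₂ c) x)

        OverB? : ∀ cs b → Dec (Good b × length cs < 4 * ∑misfit cs b)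
        OverB? cs b = nice? [ b ] ×-dec (length cs <? 4 * ∑misfit cs b)

        overB : List (W × W) → W
        overB cs = filter (OverB? cs) (allFin n)

        few-overB : ∀ cs → All (Chunk Kc) cs → 0 < length cs → Kc * length (overB cs) ≤ 4 * n
        few-overB cs sh cs>0 = *-cancelʳ-≤ _ _ (length cs) {{>-nonZero cs>0}} (begin
          Kc * length (overB cs) * length cs        ≡⟨ trans (*-assoc Kc _ _) (cong (Kc *_) (trans (*-comm _ (length cs)) (cong (length cs *_) (length-filter (OverB? cs) (allFin n))))) ⟩
          Kc * (length cs * ∑ (allFin n) (λ b → χ (OverB? cs b))) ≡⟨ cong (Kc *_) (∑-* (length cs) (allFin n) _) ⟨
          Kc * ∑ (allFin n) (λ b → length cs * χ (OverB? cs b)) ≤⟨ *-monoʳ-≤ Kc (∑-mono (allFin n) per) ⟩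
          Kc * ∑ (allFin n) (λ b → 4 * (χ (nice? [ b ]) * ∑misfit cs b)) ≡⟨ cong (Kc *_) (∑-* 4 (allFin n) _) ⟩
          Kc * (4 * ∑ (allFin n) (λ b → χ (nice? [ b ]) * ∑misfit cs b)) ≡⟨ x∙yz≈y∙xz Kc 4 _ ⟩
          4 * (Kc * ∑ (allFin n) (λ b → χ (nice? [ b ]) * ∑misfit cs b))
            ≡⟨ cong (λ z → 4 * (Kc * z)) (trans (∑-cong (allFin n) (λ b → sym (∑-* (χ (nice? [ b ])) cs _))) (∑-swap (allFin n) cs _)) ⟩
          4 * (Kc * ∑ cs (λ c → totalMisfit (k + k) (proj₁ c ++ proj₂ c))) ≡⟨ cong (4 *_) (∑-* Kc cs _) ⟨
          4 * ∑ cs (λ c → Kc * totalMisfit (k + k) (proj₁ c ++ proj₂ c)) ≤⟨ *-monoʳ-≤ 4 (∑-mono∈ cs (λ c c∈ → Chunk.uncrowded (All.lookup sh c∈))) ⟩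
          4 * ∑ cs (λ _ → n)                        ≡⟨ cong (4 *_) (∑-const cs n) ⟩
          4 * (length cs * n)                       ≡⟨ arith (length cs) n ⟩
          4 * n * length cs                         ∎)
          where
          open ≤-Reasoning
          arith : ∀ a n → 4 * (a * n) ≡ 4 * n * a
          arith = solve-∀
          per : ∀ b → length cs * χ (OverB? cs b) ≤ 4 * (χ (nice? [ b ]) * ∑misfit cs b)
          per b = χ-≤ (OverB? cs b) λ { (g , h) → ≤-trans (<⇒≤ h) (*-monoʳ-≤ 4 (≤-reflexive (sym (trans (cong (_* ∑misfit cs b) (χ-yes (nice? [ b ]) g)) (*-identityˡ _))))) }

        strong-source : ∀ cs L v → v ∈ overA cs → ∀ us → WheelSource us v L
        strong-source cs L v v∈ us uu us≤ rm = go (proj₂ (∈-filter⁻ (OverA? cs) {xs = allFin n} v∈))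
          where
          go : ¬ Good v × v ∉ weakList Q × n < Ko * mis v (flat cs) → _
          go (¬g , v∉ , _) = strong-wheel {Q} {G} us v strong k>0 (hκ 0 k>0) nil hWheel
              (≤-trans (*-monoʳ-≤ Q (*-mono-≤ mm mm)) hn) (room⇒fresh rm)
            where
            mm : (k ∸ 1) + (k ∸ 1) ≤ Nm
            mm = ≤-trans (+-mono-≤ (m∸n≤m k 1) (m∸n≤m k 1)) 2k≤Nm
            strong : Strong Q v
            strong = decidable-stable (_ ≤? _) (λ ¬s → v∉ (∈-filter⁺ (WeakA′? Q) (∈-allFin v) (¬g , inj₂ ¬s)))

        record Appended (S M : W) (ss : List Slot) (bs : W) (x : ℕ) : Set where
          field
            M′    : W
            state : State S (M ++ M′) ss
            len   : length M′ ≤ length bs * suc k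
            all∈  : All (_∈ S ++ (M ++ M′)) bs
            spare : Room G x (S ++ (M ++ M′))

        appendAll : ∀ {S M ss} bs x → All Good bs → State S M ss → Room G (x + length bs * suc k) (S ++ M) → Appended S M ss bs x
        appendAll {S} {M} {ss} [] x gs st rm = record { M′ = [] ; state = subst (λ l → State S l ss) (sym (++-identityʳ M)) st ; len = z≤n ; all∈ = []
                                       ; spare = subst (λ l → Room G x (S ++ l)) (sym (++-identityʳ M)) (room-≤ (m≤m+n x 0) rm) }
        appendAll {S} {M} {ss} (b ∷ bs) x (gb ∷ gs) st rm = go (appendAll bs (x + suc k) gs st (room-≤ (≤-reflexive (+-assoc x (suc k) _)) rm))
          where
          go : Appended S M ss bs (x + suc k) → Appended S M ss (b ∷ bs) x
          go ap = decide (b ∈? (S ++ (M ++ M′)))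
            where
            open Appended ap
            P = S ++ (M ++ M′)
            decide : Dec (b ∈ P) → Appended S M ss (b ∷ bs) x
            decide (yes b∈) = record { M′ = M′ ; state = state ; len = ≤-trans len (m≤n+m _ (suc k)) ; all∈ = b∈ ∷ all∈ ; spare = room-≤ (m≤m+n x _) spare }
            decide (no b∉) = add (extend k (P ++ [ b ]) P [ b ] (≤-trans (m≤m+n k k) 2k≤Nm) (n≤1+n k) (room-++ {x = 0} [ b ] (room-≤ (≤-trans (s≤s z≤n) (m≤n+m (suc k) x)) spare))
                                   (State.nice state) (niceSeq-single nil gb))
              where
              add : ∃[ X ] length X ≡ k × All (Fresh (P ++ [ b ])) X × Unique X × NiceSeq (P ++ X ++ [ b ]) → Appended S M ss (b ∷ bs) x
              add (X , lX , f , uX , nX) = record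
                { M′ = M′ ++ X ++ [ b ]
                ; state = record
                  { distinct = subst Unique eq (unique-↭ perm (fresh-unique (unique-++ (State.distinct state) ([] ∷ []) (b∉ ∷ [])) f uX))
                  ; good = subst (All Good) eq (Allₚ.++⁺ (State.good state) (Allₚ.++⁺ (fresh-good f) (gb ∷ [])))
                  ; nice = subst NiceSeq eq nX
                  ; sized = State.sized state ; valid = State.valid state }
                ; len = ≤-trans (≤-reflexive (trans (length-++ M′) (trans (cong (length M′ +_) lXb) (+-comm (length M′) _)))) (+-monoʳ-≤ (suc k) len)
                ; all∈ = subst (b ∈_) eq (∈-++⁺ʳ P (∈-++⁺ʳ X (here refl))) ∷ All.map (λ v∈ → subst (_ ∈_) eq (∈-++⁺ˡ v∈)) all∈
                ; spare = subst (Room G x) eq (room-++ (X ++ [ b ]) (room-≤ (+-monoʳ-≤ x (≤-reflexive lXb)) spare)) }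
                where
                lXb : length (X ++ [ b ]) ≡ suc k
                lXb = trans (length-++ X) (trans (cong (_+ 1) lX) (+-comm k 1))
                eq : P ++ X ++ [ b ] ≡ S ++ (M ++ (M′ ++ X ++ [ b ]))
                eq = trans (++-assoc S (M ++ M′) _) (cong (S ++_) (++-assoc M M′ _))
                perm : (P ++ [ b ]) ++ X ↭ P ++ X ++ [ b ]
                perm = ↭-trans (↭-reflexive (++-assoc P [ b ] X)) (++⁺ˡ P (++-comm [ b ] X))

        record Closed : Set where
          field
            base    : Special
            chunked : Chunked (Special.S base) (Special.ss base)
          cs : List (W × W)
          cs = Chunked.cs chunked
          field
            prefix   : W
            ss       : List Slot
            post X   : W
          S : W
          S = prefix ++ Special.S base
          field
            distinct : Unique (S ++ flat cs ++ post ++ X)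
            good     : All Good (S ++ flat cs ++ post ++ X)
            ring     : NiceSeq (S ++ flat cs ++ post ++ X ++ S)
            sized    : slotSizes ss ≡ length S
            valid    : ∀ Y → FixedValid ss (S ++ Y)
            lenS     : length prefix ≡ length (overA cs) * (3 * σ)
            lenPost  : length post ≤ length (overB cs) * suc k
            lenX     : length X ≡ k
            covers   : All (_∈ S ++ flat cs ++ post) (overB cs)
            centre   : fixedCentres ss ≡ overA cs ++ weakList Q
            vacancies : #vacant ss ≡ 2 * length (overA cs) + #vacant (Special.ss base)
            block    : totalBlocks ss ≡ totalBlocks (Special.ss base) + 3 * length (overA cs) * s
            fewA     : Q * length (overA cs) ≤ 3 * Ko * n
            fewB     : Kc * length (overB cs) ≤ 4 * n

        room-after : ∀ {S cs x} → n ≤ G₁ * (#fresh (S ++ flat cs) + (k + k)) → G * ((k + k) + x) ≤ n → Room G x (S ++ flat cs)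
        room-after {S} {cs} {x} lo hx = room (+-cancelʳ-≤ n _ _ (+-cancelʳ-≤ (G * (k + k)) _ _ (begin
          n + G * x + n + G * (k + k)     ≡⟨ arith₁ n (G * x) (G * (k + k)) ⟩
          2 * n + (G * (k + k) + G * x)   ≡⟨ cong (2 * n +_) (*-distribˡ-+ G (k + k) x) ⟨
          2 * n + G * ((k + k) + x)       ≤⟨ +-mono-≤ (*-monoʳ-≤ 2 lo) hx ⟩
          2 * (G₁ * (f + (k + k))) + n    ≡⟨ arith₂ G′ f (k + k) n ⟩
          G * f + n + G * (k + k)         ∎)))
          where
          open ≤-Reasoning
          f = #fresh (S ++ flat cs)
          arith₁ : ∀ n a b → n + a + n + b ≡ 2 * n + (b + a)
          arith₁ = solve-∀
          arith₂ : ∀ g f c n → 2 * (suc g * 2 * (f + c)) + n ≡ suc g * 4 * f + n + suc g * 4 * c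
          arith₂ = solve-∀

        close : (sp : Special) (ch : Chunked (Special.S sp) (Special.ss sp)) → 0 < length (Chunked.cs ch) → Closed
        close sp ch cs>0 = withA (attachAll (length P + length (overA cs) * (3 * σ)) 3σ≤ state (overA cs) (strong-source cs _) ≤-refl (k + length (overB cs) * suc k) rm)
          where
          open Chunked ch
          P = Special.S sp ++ flat cs
          uflat : Unique (flat cs)
          uflat = unique-++ʳ (Special.S sp) (State.distinct state)
          fA : Q * length (overA cs) ≤ 3 * Ko * n
          fA = few-overA cs uflat (niceSeq-++ʳ (Special.S sp) (State.nice state))
          fB : Kc * length (overB cs) ≤ 4 * n
          fB = few-overB cs shape cs>0
          rm : Room G (k + length (overB cs) * suc k + length (overA cs) * (3 * σ)) P
          rm = room-after {Special.S sp} {cs} lower (hAfter (length (overA cs)) (length (overB cs)) fA fB)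
          withA : Attached (Special.S sp) (flat cs) (Special.ss sp) (overA cs) (k + length (overB cs) * suc k) → Closed
          withA at = withB (appendAll (overB cs) k (All.tabulate (λ b∈ → proj₁ (proj₂ (∈-filter⁻ (OverB? cs) {xs = allFin n} b∈)))) (Attached.state at) (Attached.spare at))
            where
            S₁ = Attached.S′ at ++ Special.S sp
            ss₁ = Attached.ss′ at ++ Special.ss sp
            withB : Appended S₁ (flat cs) ss₁ (overB cs) k → Closed
            withB ap = withX (extend k P₁ P₁ P₁ (≤-trans (m≤m+n k k) 2k≤Nm) (n≤1+n k) (room-≤ z≤n (Appended.spare ap)) (State.nice (Appended.state ap)) (State.nice (Appended.state ap)))
              where
              post = Appended.M′ ap
              P₁ = S₁ ++ (flat cs ++ post)
              withX : ∃[ X ] length X ≡ k × All (Fresh P₁) X × Unique X × NiceSeq (P₁ ++ X ++ P₁) → Closed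
              withX (X , lX , f , uX , nX) = record
                { base = sp ; chunked = ch ; prefix = Attached.S′ at ; ss = ss₁ ; post = post ; X = X
                ; distinct = subst Unique eq (fresh-unique (State.distinct (Appended.state ap)) f uX)
                ; good = subst (All Good) eq (Allₚ.++⁺ (State.good (Appended.state ap)) (fresh-good f))
                ; ring = niceSeq-++ˡ (S₁ ++ flat cs ++ post ++ X ++ S₁) (subst NiceSeq eq₂ nX)
                ; sized = State.sized (Appended.state ap) ; valid = State.valid (Appended.state ap)
                ; lenS = Attached.len at
                ; lenPost = Appended.len ap ; lenX = lX ; covers = Appended.all∈ ap
                ; centre = trans (Attached.centre at) (cong (overA cs ++_) (Special.centre sp))
                ; vacancies = Attached.vacancies at ; block = Attached.block at ; fewA = fA ; fewB = fB }
                where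
                eq : P₁ ++ X ≡ S₁ ++ flat cs ++ post ++ X
                eq = trans (++-assoc S₁ (flat cs ++ post) X) (cong (S₁ ++_) (++-assoc (flat cs) post X))
                eq₂ : P₁ ++ X ++ P₁ ≡ (S₁ ++ flat cs ++ post ++ X ++ S₁) ++ (flat cs ++ post)
                eq₂ = trans (cong (λ z → P₁ ++ X ++ z) refl) (trans (sym (++-assoc P₁ X P₁)) (trans (cong (_++ P₁) eq) (trans (sym (++-assoc (S₁ ++ flat cs ++ post ++ X) S₁ _))
                  (cong (_++ (flat cs ++ post)) (trans (++-assoc S₁ _ S₁) (cong (S₁ ++_) (trans (++-assoc (flat cs) _ S₁) (cong (flat cs ++_) (++-assoc post X S₁)))))))))

      mis-insert : ∀ a U x Z → mis a (U ++ x ∷ Z) ≤ mis a (U ++ Z) + suc (length U ⊓ (k ∸ 1))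
      mis-insert a []      x Z = ≤-trans (+-monoˡ-≤ (mis a Z) (χ≤1 (¬? (E? (a ∷ take (k ∸ 1) (x ∷ Z)))))) (≤-reflexive (+-comm 1 _))
      mis-insert a (y ∷ U) x Z = go (k ∸ 1 ≤? length (y ∷ U))
        where
        open ≤-Reasoning
        m = k ∸ 1
        c : W → ℕ
        c l = χ (¬? (E? (a ∷ take m l)))
        go : Dec (m ≤ length (y ∷ U)) → c (y ∷ U ++ x ∷ Z) + mis a (U ++ x ∷ Z) ≤ c (y ∷ U ++ Z) + mis a (U ++ Z) + suc (suc (length U) ⊓ m)
        go (yes m≤) = begin
          c (y ∷ U ++ x ∷ Z) + mis a (U ++ x ∷ Z)
            ≤⟨ +-mono-≤ (≤-reflexive (cong (λ T → χ (¬? (E? (a ∷ T)))) (trans (take-app-≤ (y ∷ U) (x ∷ Z) m≤) (sym (take-app-≤ (y ∷ U) Z m≤))))) (mis-insert a U x Z) ⟩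
          c (y ∷ U ++ Z) + (mis a (U ++ Z) + suc (length U ⊓ m))    ≡⟨ +-assoc (c (y ∷ U ++ Z)) _ _ ⟨
          c (y ∷ U ++ Z) + mis a (U ++ Z) + suc (length U ⊓ m)      ≤⟨ +-monoʳ-≤ (c (y ∷ U ++ Z) + mis a (U ++ Z)) (s≤s (⊓-monoˡ-≤ m (n≤1+n (length U)))) ⟩
          c (y ∷ U ++ Z) + mis a (U ++ Z) + suc (suc (length U) ⊓ m) ∎
        go (no ¬m≤) = begin
          c (y ∷ U ++ x ∷ Z) + mis a (U ++ x ∷ Z)                   ≤⟨ +-mono-≤ (χ≤1 (¬? (E? (a ∷ take m (y ∷ U ++ x ∷ Z))))) (mis-insert a U x Z) ⟩
          1 + (mis a (U ++ Z) + suc (length U ⊓ m))                 ≡⟨ cong (λ z → 1 + (mis a (U ++ Z) + suc z)) (m≤n⇒m⊓n≡m (<⇒≤ U<m)) ⟩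
          1 + (mis a (U ++ Z) + suc (length U))                     ≡⟨ +-suc (mis a (U ++ Z)) (suc (length U)) ⟨
          mis a (U ++ Z) + suc (suc (length U))                     ≡⟨ cong (λ z → mis a (U ++ Z) + suc z) (m≤n⇒m⊓n≡m U<m) ⟨
          mis a (U ++ Z) + suc (suc (length U) ⊓ m)                 ≤⟨ +-monoˡ-≤ _ (m≤n+m _ (c (y ∷ U ++ Z))) ⟩
          c (y ∷ U ++ Z) + mis a (U ++ Z) + suc (suc (length U) ⊓ m) ∎
          where
          U<m : length U < m
          U<m = <⇒≤ (≰⇒> ¬m≤)

      mis-++ʳ : ∀ a U Z → mis a (U ++ Z) ≤ length U + mis a Z
      mis-++ʳ a []      Z = ≤-refl
      mis-++ʳ a (x ∷ U) Z = +-mono-≤ (χ≤1 (¬? (E? (a ∷ take (k ∸ 1) (x ∷ U ++ Z))))) (mis-++ʳ a U Z)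

      mis-++ˡ : ∀ a U Z → mis a (U ++ Z) ≤ mis a U + length Z
      mis-++ˡ a []      Z = mis-≤-length a Z
      mis-++ˡ a (x ∷ U) Z = ≤-trans (+-mono-≤ (χ-mono (¬? (E? (a ∷ take m (x ∷ U ++ Z)))) (¬? (E? (a ∷ take m (x ∷ U)))) shrink) (mis-++ˡ a U Z))
          (≤-reflexive (sym (+-assoc (χ (¬? (E? (a ∷ take m (x ∷ U))))) (mis a U) (length Z))))
        where
        m = k ∸ 1
        shrink : ¬ E (a ∷ take m (x ∷ U ++ Z)) → ¬ E (a ∷ take m (x ∷ U))
        shrink ¬h h = ¬h (subst (λ T → E (a ∷ T)) (sym (take-app-≤ (x ∷ U) Z m≤)) h)
          where
          m≤ : m ≤ length (x ∷ U)
          m≤ = ≤-pred (≤-trans (≤-reflexive (suc-pred′ k>0)) (≤-trans (E-length {a ∷ take m (x ∷ U)} h) (s≤s (≤-trans (≤-reflexive (length-take m (x ∷ U))) (m⊓n≤n m _)))))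

      Item : Set
      Item = W × W × W

      flatI : List Item → W
      flatI []                 = []
      flatI ((u , o , v) ∷ is) = (u ++ o ++ v) ++ flatI is

      flatI-++ : ∀ is js → flatI (is ++ js) ≡ flatI is ++ flatI js
      flatI-++ []                 js = refl
      flatI-++ ((u , o , v) ∷ is) js = trans (cong ((u ++ o ++ v) ++_) (flatI-++ is js)) (sym (++-assoc (u ++ o ++ v) (flatI is) (flatI js)))

      outer : Item → W × W
      outer (u , _ , v) = u , v

      occupancy : Item → ℕ
      occupancy (_ , o , _) = length o

      start : List (W × W) → List Item
      start = map (λ { (u , v) → u , [] , v })

      flatI-start : ∀ cs → flatI (start cs) ≡ flat cs
      flatI-start []             = refl
      flatI-start ((u , v) ∷ cs) = cong ((u ++ v) ++_) (flatI-start cs)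

      outer-start : ∀ cs → map outer (start cs) ≡ cs
      outer-start []             = refl
      outer-start ((u , v) ∷ cs) = cong ((u , v) ∷_) (outer-start cs)

      occupancy-start : ∀ cs → ∑ (start cs) occupancy ≡ 0
      occupancy-start []             = refl
      occupancy-start ((u , v) ∷ cs) = occupancy-start cs

      module Insertion (nil : Nice []) {Kc : ℕ} (cs : List (W × W)) (shape : All (Chunk Kc) cs) (pre suf : W) (nice₀ : NiceSeq (pre ++ flat cs ++ suf)) where

        mf : Fin n → W × W → ℕ
        mf x c = misfit (k + k) (proj₁ c ++ proj₂ c) x

        record Inserted (xs : W) : Set where
          field
            items : List Item
            same  : map outer items ≡ cs
            used  : ∑ items occupancy ≡ length xs
            perm  : flatI items ↭ xs ++ flat cs
            nice  : NiceSeq (pre ++ flatI items ++ suf)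
            misₐ  : ∀ a → mis a (flatI items) ≤ mis a (flat cs) + length xs * k

        insertAll : ∀ xs → All Good xs → All (λ x → 4 * ∑ cs (mf x) ≤ length cs) xs → 4 * length xs < 3 * length cs → Inserted xs
        insertAll [] _ _ _ = record
          { items = start cs ; same = outer-start cs ; used = occupancy-start cs ; perm = ↭-reflexive (flatI-start cs)
          ; nice = subst (λ l → NiceSeq (pre ++ l ++ suf)) (sym (flatI-start cs)) nice₀
          ; misₐ = λ a → ≤-reflexive (trans (cong (mis a) (flatI-start cs)) (sym (+-identityʳ _))) }
        insertAll (x ∷ xs) (gx ∷ gs) (hx ∷ hs) lt = one (insertAll xs gs hs (≤-<-trans (*-monoʳ-≤ 4 (n≤1+n (length xs))) lt))
          where
          one : Inserted xs → Inserted (x ∷ xs)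
          one ins = found (∑-∃ items (λ i → occupancy i + mf x (outer i)) (λ _ → 1) few)
            where
            open Inserted ins
            few : ∑ items (λ i → occupancy i + mf x (outer i)) < ∑ items (λ _ → 1)
            few = *-cancelˡ-< 4 _ _ (begin-strict
              4 * ∑ items (λ i → occupancy i + mf x (outer i))  ≡⟨ cong (4 *_) (trans (∑-+ items occupancy _) (cong₂ _+_ used (trans (sym (∑-map outer items (mf x))) (cong (λ z → ∑ z (mf x)) same)))) ⟩
              4 * (length xs + ∑ cs (mf x))                     ≡⟨ *-distribˡ-+ 4 (length xs) _ ⟩
              4 * length xs + 4 * ∑ cs (mf x)                   ≤⟨ +-monoʳ-≤ (4 * length xs) hx ⟩
              4 * length xs + length cs                         <⟨ +-monoˡ-< (length cs) (≤-<-trans (*-monoʳ-≤ 4 (n≤1+n (length xs))) lt) ⟩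
              3 * length cs + length cs                         ≡⟨ arith (length cs) ⟩
              4 * length cs                                     ≡⟨ cong (4 *_) (trans (cong length (sym same)) (trans (length-map outer items) (sym (∑-length items)))) ⟩
              4 * ∑ items (λ _ → 1)                             ∎)
              where
              open ≤-Reasoning
              arith : ∀ a → 3 * a + a ≡ 4 * a
              arith = solve-∀
            found : ∃[ i ] i ∈ items × occupancy i + mf x (outer i) < 1 → Inserted (x ∷ xs)
            found ((u , y ∷ o , v) , i∈ , s≤s ())
            found ((u , [] , v) , i∈ , h) = place (∈-∃++ i∈)
              where
              mf0 : mf x (u , v) ≡ 0
              mf0 = n<1⇒n≡0 h
              ch : Chunk Kc (u , v)
              ch = All.lookup shape (subst ((u , v) ∈_) same (∈-map⁺ outer i∈))
              place : ∃[ is₁ ] ∃[ is₂ ] items ≡ is₁ ++ (u , [] , v) ∷ is₂ → Inserted (x ∷ xs)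
              place (is₁ , is₂ , eq) = record
                { items = items′
                ; same = trans (trans (map-++ outer is₁ _) (sym (map-++ outer is₁ _))) (trans (cong (map outer) (sym eq)) same)
                ; used = trans (∑-++ is₁ _ occupancy) (trans (+-suc (∑ is₁ occupancy) (∑ is₂ occupancy)) (cong suc (trans (sym (∑-++ is₁ ((u , [] , v) ∷ is₂) occupancy)) (trans (cong (λ z → ∑ z occupancy) (sym eq)) used))))
                ; perm = ↭-trans (↭-reflexive new) (↭-trans (shift x (F₁ ++ u) (v ++ F₂)) (prep x (↭-trans (↭-reflexive (sym old)) perm)))
                ; nice = subst NiceSeq (sym newS) (niceSeq-glue (A ++ u ++ [ x ]) v kv left right)
                ; misₐ = λ a → ≤-trans (≤-reflexive (cong (mis a) new)) (≤-trans (mis-insert a (F₁ ++ u) x (v ++ F₂)) (≤-trans (+-mono-≤ (≤-trans (≤-reflexive (cong (mis a) (sym old))) (misₐ a)) (≤-trans (s≤s (m⊓n≤n _ (k ∸ 1))) (≤-reflexive (suc-pred′ k>0)))) (≤-reflexive (trans (+-assoc (mis a (flat cs)) (length xs * k) k) (cong (mis a (flat cs) +_) (+-comm (length xs * k) k)))))) }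
                where
                items′ = is₁ ++ (u , [ x ] , v) ∷ is₂
                F₁ = flatI is₁
                F₂ = flatI is₂
                A = pre ++ F₁
                Z = F₂ ++ suf
                old : flatI items ≡ (F₁ ++ u) ++ v ++ F₂
                old = trans (cong flatI eq) (trans (flatI-++ is₁ _) (trans (cong (F₁ ++_) (++-assoc u v F₂)) (sym (++-assoc F₁ u _))))
                new : flatI items′ ≡ (F₁ ++ u) ++ x ∷ v ++ F₂
                new = trans (flatI-++ is₁ _) (trans (cong (F₁ ++_) (++-assoc u (x ∷ v) F₂)) (sym (++-assoc F₁ u _)))
                assemble : ∀ w → pre ++ ((F₁ ++ u) ++ w ++ F₂) ++ suf ≡ A ++ u ++ w ++ Z
                assemble w = begin
                  pre ++ ((F₁ ++ u) ++ w ++ F₂) ++ suf   ≡⟨ cong (pre ++_) (++-assoc (F₁ ++ u) _ suf) ⟩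
                  pre ++ (F₁ ++ u) ++ (w ++ F₂) ++ suf   ≡⟨ cong (λ z → pre ++ (F₁ ++ u) ++ z) (++-assoc w F₂ suf) ⟩
                  pre ++ (F₁ ++ u) ++ w ++ Z             ≡⟨ cong (pre ++_) (++-assoc F₁ u _) ⟩
                  pre ++ F₁ ++ u ++ w ++ Z               ≡⟨ ++-assoc pre F₁ _ ⟨
                  A ++ u ++ w ++ Z                       ∎
                  where open ≡-Reasoning
                oldN : NiceSeq (A ++ u ++ v ++ Z)
                oldN = subst NiceSeq (trans (cong (λ z → pre ++ z ++ suf) old) (assemble v)) nice
                newS : pre ++ flatI items′ ++ suf ≡ (A ++ u ++ [ x ]) ++ v ++ Z
                newS = trans (cong (λ z → pre ++ z ++ suf) new) (trans (assemble (x ∷ v)) (trans (cong (A ++_) (sym (++-assoc u [ x ] (v ++ Z)))) (sym (++-assoc A (u ++ [ x ]) _))))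
                kv : k ≤ suc (length v)
                kv = ≤-trans (≤-reflexive (sym (Chunk.lengthʳ ch))) (n≤1+n _)
                right : NiceSeq (v ++ Z)
                right = niceSeq-++ʳ u (niceSeq-++ʳ A oldN)
                Au : NiceSeq (A ++ u)
                Au = niceSeq-++ˡ (A ++ u) (subst NiceSeq (sym (++-assoc A u (v ++ Z))) oldN)
                uv : NiceSeq (u ++ v)
                uv = niceSeq-++ˡ (u ++ v) (subst NiceSeq (sym (++-assoc u v Z)) (niceSeq-++ʳ A oldN))
                uxv : NiceSeq (u ++ x ∷ v)
                uxv = niceSeq-insert u v x (Chunk.lengthˡ ch) (Chunk.lengthʳ ch) nil gx (Chunk.inB ch) uv mf0
                left : NiceSeq ((A ++ u ++ [ x ]) ++ v)
                left = subst NiceSeq (trans (cong (A ++_) (sym (++-assoc u [ x ] v))) (sym (++-assoc A (u ++ [ x ]) v)))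
                  (niceSeq-glue A u (≤-trans (≤-reflexive (sym (Chunk.lengthˡ ch))) (n≤1+n _)) Au uxv)

      Site : Set
      Site = Kind × W

      sites : List Slot → W → List Site
      sites []              l = []
      sites (fixed u ∷ ss)  l = sites ss (drop (size u) l)
      sites (vacant c ∷ ss) l = (c , l) ∷ sites ss (drop (before c + after c) l)

      BadSite : Fin n → Site → Set
      BadSite a (c , l) = Any (λ i → ¬ E (a ∷ take (k ∸ 1) (drop (i * d) l))) (upTo (span c))

      badSite? : ∀ a s → Dec (BadSite a s)
      badSite? a (c , l) = any? (λ i → ¬? (E? (a ∷ take (k ∸ 1) (drop (i * d) l)))) (upTo (span c))

      length-sites : ∀ ss l → length (sites ss l) ≡ #vacant ss
      length-sites []              l = refl
      length-sites (fixed u ∷ ss)  l = length-sites ss (drop (size u) l)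
      length-sites (vacant c ∷ ss) l = cong suc (length-sites ss (drop (before c + after c) l))

      record Filled (ss : List Slot) (l as : W) : Set where
        field
          units  : List Unit
          valid  : AllValid units l
          sized  : sizes units ≡ slotSizes ss
          block  : ∑blocks units ≡ totalBlocks ss
          centre : centres units ↭ fixedCentres ss ++ as

      fillSites : ∀ ss l ps → map proj₂ ps ≡ sites ss l → FixedValid ss l → All (λ p → ¬ BadSite (proj₁ p) (proj₂ p)) ps → Filled ss l (map proj₁ ps)
      fillSites [] l [] e v g = record { units = [] ; valid = tt ; sized = refl ; block = refl ; centre = ↭-refl }
      fillSites (fixed u@(A-unit c a) ∷ ss) l ps e (v , vs) g = record
        { units = u ∷ units ; valid = v , valid ; sized = cong (size u +_) sized ; block = cong (blocks u +_) block ; centre = prep a centre }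
        where open Filled (fillSites ss (drop (size u) l) ps e vs g)
      fillSites (fixed B-unit ∷ ss) l ps e (v , vs) g = record
        { units = B-unit ∷ units ; valid = v , valid ; sized = cong (d +_) sized ; block = cong (1 +_) block ; centre = centre }
        where open Filled (fillSites ss (drop d l) ps e vs g)
      fillSites (vacant c ∷ ss) l ((a , s) ∷ ps) e vs (¬b ∷ g) = record
        { units = A-unit c a ∷ units
        ; valid = (λ i i< → decidable-stable (E? (a ∷ take (k ∸ 1) (drop (i * d) l))) (λ ¬h → ¬b (subst (BadSite a) (sym (∷-injectiveˡ e)) (lose (∈-upTo⁺ i<) ¬h)))) , valid
        ; sized = cong (before c + after c +_) sized ; block = cong (span c +_) block
        ; centre = ↭-trans (prep a centre) (↭-sym (shift a (fixedCentres ss) (map proj₁ ps))) }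
        where open Filled (fillSites ss (drop (before c + after c) l) ps (∷-injectiveʳ e) vs g)

      mis-drop₀ : ∀ a m l → mis a (drop m l) ≤ mis a l
      mis-drop₀ a zero    l       = ≤-refl
      mis-drop₀ a (suc m) []      = ≤-refl
      mis-drop₀ a (suc m) (x ∷ l) = ≤-trans (mis-drop₀ a m l) (m≤n+m _ (χ (¬? (E? (a ∷ take (k ∸ 1) (x ∷ l))))))

      mis-drop : ∀ a p m l → p < m → p < length l → χ (¬? (E? (a ∷ take (k ∸ 1) (drop p l)))) + mis a (drop m l) ≤ mis a l
      mis-drop a zero    (suc m) (x ∷ l) _ _ = +-monoʳ-≤ (χ (¬? (E? (a ∷ take (k ∸ 1) (x ∷ l))))) (mis-drop₀ a m l)
      mis-drop a (suc p) (suc m) (x ∷ l) (s≤s p<m) (s≤s p<l) = ≤-trans (mis-drop a p m l p<m p<l) (m≤n+m _ (χ (¬? (E? (a ∷ take (k ∸ 1) (x ∷ l))))))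

      d′>0 : 0 < d′
      d′>0 = <-≤-trans r>0 r≤d′

      step<size : ∀ c i → i < span c → i * d < before c + after c
      step<size first i i< = ≤-<-trans (step≤before first i i<) (m<m+n (before first) d′>0)
      step<size last  i (s≤s i≤) = ≤-<-trans (*-monoˡ-≤ d i≤) (≤-trans (m<m+n (t * d) d′>0) (≤-reflexive (sym (+-identityʳ _))))

      bad-sites-≤ : ∀ a ss l → slotSizes ss ≤ length l → ∑ (sites ss l) (λ s → χ (badSite? a s)) ≤ mis a l
      bad-sites-≤ a [] l h = z≤n
      bad-sites-≤ a (fixed u ∷ ss) l h = ≤-trans (bad-sites-≤ a ss (drop (size u) l) (≤-trans (m+n≤o⇒m≤o∸n (slotSizes ss) (≤-trans (≤-reflexive (+-comm (slotSizes ss) (size u))) h)) (≤-reflexive (sym (length-drop (size u) l)))))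
        (mis-drop₀ a (size u) l)
      bad-sites-≤ a (vacant c ∷ ss) l h = ≤-trans (+-monoʳ-≤ (χ (badSite? a (c , l))) (bad-sites-≤ a ss l′ (≤-trans (m+n≤o⇒m≤o∸n (slotSizes ss) (≤-trans (≤-reflexive (+-comm (slotSizes ss) z)) h)) (≤-reflexive (sym (length-drop z l))))))
          (go (badSite? a (c , l)))
        where
        z = before c + after c
        l′ = drop z l
        go : (b : Dec (BadSite a (c , l))) → χ b + mis a l′ ≤ mis a l
        go (no _) = mis-drop₀ a z l
        go (yes b) = at (find b)
          where
          at : ∃[ i ] i ∈ upTo (span c) × ¬ E (a ∷ take (k ∸ 1) (drop (i * d) l)) → 1 + mis a l′ ≤ mis a l
          at (i , i∈ , ¬h) = ≤-trans (≤-reflexive (cong (_+ mis a l′) (sym (χ-yes (¬? (E? (a ∷ take (k ∸ 1) (drop (i * d) l)))) ¬h))))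
            (mis-drop a (i * d) z l (step<size c i (∈-upTo⁻ i∈)) (<-≤-trans (step<size c i (∈-upTo⁻ i∈)) (≤-trans (m≤m+n z _) h)))

      Regular : W → Set
      Regular l = ∀ p → p + k ≤ length l → Unique (take (k ∸ 1) (drop p l)) × Nice (take (k ∸ 1) (drop p l))

      bad-site-≤ : ∀ {Q} → (∀ T → Unique T → length T ≡ k ∸ 1 → Nice T → Q * nonEdges T ≤ 2 * n) → ∀ c l → Regular l → before c + after c + k ≤ length l →
                   Q * ∑ (allFin n) (λ a → χ (¬? (nice? [ a ]) ×-dec badSite? a (c , l))) ≤ s * (2 * n)
      bad-site-≤ {Q} h c l reg len = begin
        Q * ∑ (allFin n) (λ a → χ (¬? (nice? [ a ]) ×-dec badSite? a (c , l)))
          ≤⟨ *-monoʳ-≤ Q (∑-mono (allFin n) per) ⟩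
        Q * ∑ (allFin n) (λ a → ∑ (upTo (span c)) (λ i → χ (NonEdge? (T i) a))) ≡⟨ cong (Q *_) (∑-swap (allFin n) (upTo (span c)) _) ⟩
        Q * ∑ (upTo (span c)) (λ i → nonEdges (T i))     ≡⟨ ∑-* Q (upTo (span c)) _ ⟨
        ∑ (upTo (span c)) (λ i → Q * nonEdges (T i))     ≤⟨ ∑-mono∈ (upTo (span c)) (λ i i∈ → each i (∈-upTo⁻ i∈)) ⟩
        ∑ (upTo (span c)) (λ _ → 2 * n)                  ≡⟨ ∑-const (upTo (span c)) (2 * n) ⟩
        length (upTo (span c)) * (2 * n)                 ≡⟨ cong (_* (2 * n)) (length-upTo (span c)) ⟩
        span c * (2 * n)                                 ≤⟨ *-monoˡ-≤ (2 * n) (span≤ c) ⟩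
        s * (2 * n)                                      ∎
        where
        open ≤-Reasoning
        T : ℕ → W
        T i = take (k ∸ 1) (drop (i * d) l)
        span≤ : ∀ c → span c ≤ s
        span≤ first = ≤-refl
        span≤ last = n≤1+n _
        each : ∀ i → i < span c → Q * nonEdges (T i) ≤ 2 * n
        each i i< = h (T i) (proj₁ (reg (i * d) p)) (length-take-≤ (drop (i * d) l) (≤-trans (m∸n≤m k 1) (≤-trans (m+n≤o⇒m≤o∸n k (≤-trans (≤-reflexive (+-comm k (i * d))) p)) (≤-reflexive (sym (length-drop (i * d) l)))))) (proj₂ (reg (i * d) p))
          where
          p : i * d + k ≤ length l
          p = ≤-trans (+-monoˡ-≤ k (<⇒≤ (step<size c i i<))) len
        per : ∀ a → χ (¬? (nice? [ a ]) ×-dec badSite? a (c , l)) ≤ ∑ (upTo (span c)) (λ i → χ (NonEdge? (T i) a))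
        per a = go (¬? (nice? [ a ]) ×-dec badSite? a (c , l))
          where
          go : (b : Dec (¬ Good a × BadSite a (c , l))) → χ b ≤ ∑ (upTo (span c)) (λ i → χ (NonEdge? (T i) a))
          go (no _) = z≤n
          go (yes (¬g , b)) = at (find b)
            where
            at : ∃[ i ] i ∈ upTo (span c) × ¬ E (a ∷ T i) → 1 ≤ ∑ (upTo (span c)) (λ i → χ (NonEdge? (T i) a))
            at (i , i∈ , ¬h) = ≤-trans (≤-reflexive (sym (χ-yes (NonEdge? (T i) a) (¬g , ¬h)))) (∑-∈ (λ i → χ (NonEdge? (T i) a)) i∈)

      vacants : ℕ → ℕ → List Slot
      vacants α β = replicate α (vacant first) ++ replicate β (vacant last)

      ∑-replicate : ∀ {A : Set} m (x : A) f → ∑ (replicate m x) f ≡ m * f x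
      ∑-replicate zero    x f = refl
      ∑-replicate (suc m) x f = cong (f x +_) (∑-replicate m x f)

      #vacant-++ : ∀ ss ss′ → #vacant (ss ++ ss′) ≡ #vacant ss + #vacant ss′
      #vacant-++ []              ss′ = refl
      #vacant-++ (fixed _ ∷ ss)  ss′ = #vacant-++ ss ss′
      #vacant-++ (vacant _ ∷ ss) ss′ = cong suc (#vacant-++ ss ss′)

      #vacant-replicate : ∀ m c → #vacant (replicate m (vacant c)) ≡ m
      #vacant-replicate zero    c = refl
      #vacant-replicate (suc m) c = cong suc (#vacant-replicate m c)

      centres-replicate : ∀ m c ss → fixedCentres (replicate m (vacant c) ++ ss) ≡ fixedCentres ss
      centres-replicate zero    c ss = refl
      centres-replicate (suc m) c ss = centres-replicate m c ss

      centres-++ : ∀ ss α β → fixedCentres (ss ++ vacants α β) ≡ fixedCentres ss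
      centres-++ []                            α β = trans (centres-replicate α first (replicate β (vacant last)))
        (trans (cong fixedCentres (sym (++-identityʳ (replicate β (vacant last))))) (centres-replicate β last []))
      centres-++ (fixed (A-unit _ a) ∷ ss)     α β = cong (a ∷_) (centres-++ ss α β)
      centres-++ (fixed B-unit ∷ ss)           α β = centres-++ ss α β
      centres-++ (vacant _ ∷ ss)               α β = centres-++ ss α β

      valid-replicate : ∀ m c ss → (∀ l → FixedValid ss l) → ∀ l → FixedValid (replicate m (vacant c) ++ ss) l
      valid-replicate zero    c ss h l = h l
      valid-replicate (suc m) c ss h l = valid-replicate m c ss h (drop (before c + after c) l)

      valid-++ : ∀ ss α β l → FixedValid ss l → FixedValid (ss ++ vacants α β) l
      valid-++ []              α β l _        = valid-replicate α first (replicate β (vacant last))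
        (λ l → subst (λ z → FixedValid z l) (++-identityʳ (replicate β (vacant last))) (valid-replicate β last [] (λ _ → tt) l)) l
      valid-++ (fixed u ∷ ss)  α β l (v , vs) = v , valid-++ ss α β (drop (size u) l) vs
      valid-++ (vacant c ∷ ss) α β l vs       = valid-++ ss α β (drop (before c + after c) l) vs

      blocks-sizes : ∀ ss → totalBlocks ss * d ≡ slotSizes ss + #vacant ss + length (fixedCentres ss)
      blocks-sizes [] = refl
      blocks-sizes (fixed (A-unit c a) ∷ ss) = trans (*-distribʳ-+ d (span c) (totalBlocks ss)) (trans (cong₂ _+_ (span-size c) (blocks-sizes ss))
        (arith (before c + after c) (slotSizes ss) (#vacant ss) (length (fixedCentres ss))))
        where
        arith : ∀ a b c e → suc a + (b + c + e) ≡ a + b + c + suc e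
        arith = solve-∀
      blocks-sizes (fixed B-unit ∷ ss) = trans (*-distribʳ-+ d 1 (totalBlocks ss)) (trans (cong₂ _+_ (+-identityʳ d) (blocks-sizes ss))
        (arith d (slotSizes ss) (#vacant ss) (length (fixedCentres ss))))
        where
        arith : ∀ a b c e → a + (b + c + e) ≡ a + b + c + e
        arith = solve-∀
      blocks-sizes (vacant c ∷ ss) = trans (*-distribʳ-+ d (span c) (totalBlocks ss)) (trans (cong₂ _+_ (span-size c) (blocks-sizes ss))
        (arith (before c + after c) (slotSizes ss) (#vacant ss) (length (fixedCentres ss))))
        where
        arith : ∀ a b c e → suc a + (b + c + e) ≡ a + b + suc c + e
        arith = solve-∀

      sites-∈ : ∀ ss l {c l′} → (c , l′) ∈ sites ss l → slotSizes ss + k ≤ length l → (∃[ p ] l′ ≡ drop p l) × before c + after c + k ≤ length l′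
      sites-∈ (fixed u ∷ ss) l {c} s∈ h = shiftBy {c} (sites-∈ ss (drop (size u) l) s∈
          (≤-trans (m+n≤o⇒m≤o∸n _ (≤-trans (≤-reflexive (trans (+-comm _ (size u)) (sym (+-assoc (size u) _ k)))) h)) (≤-reflexive (sym (length-drop (size u) l)))))
        where
        shiftBy : ∀ {c} {l′ : W} → (∃[ p ] l′ ≡ drop p (drop (size u) l)) × before c + after c + k ≤ length l′ → (∃[ p ] l′ ≡ drop p l) × before c + after c + k ≤ length l′
        shiftBy ((p , e) , b) = (size u + p , trans e (drop-drop (size u) p l)) , b
      sites-∈ (vacant c ∷ ss) l (here refl) h = (0 , refl) , ≤-trans (+-monoˡ-≤ k (m≤m+n (before c + after c) (slotSizes ss))) h
      sites-∈ (vacant c₀ ∷ ss) l {c} (there s∈) h = shiftBy {c} (sites-∈ ss (drop z l) s∈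
          (≤-trans (m+n≤o⇒m≤o∸n _ (≤-trans (≤-reflexive (trans (+-comm _ z) (sym (+-assoc z _ k)))) h)) (≤-reflexive (sym (length-drop z l)))))
        where
        z = before c₀ + after c₀
        shiftBy : ∀ {c} {l′ : W} → (∃[ p ] l′ ≡ drop p (drop z l)) × before c + after c + k ≤ length l′ → (∃[ p ] l′ ≡ drop p l) × before c + after c + k ≤ length l′
        shiftBy ((p , e) , b) = (z + p , trans e (drop-drop z p l)) , b

      unique-intervals : ∀ {l : W} → Unique l → Intervals k Unique l
      unique-intervals {l} u i j _ = unique-++ˡ (take j (drop i l)) (subst Unique (sym (take++drop≡id j (drop i l)))
        (unique-++ʳ (take i l) (subst Unique (sym (take++drop≡id i l)) u)))

      module Conclusion (C : Constants) (R : RingConstants C) where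
        open Phase1 C R public

        leftover : Closed → W
        leftover c = filter (λ x → nice? [ x ] ×-dec ¬? (x ∈? (S ++ flat cs ++ post ++ X))) (allFin n)
          where open Closed c

        remaining : Closed → W
        remaining c = filter (λ a → ¬? (nice? [ a ]) ×-dec ¬? (a ∈? fixedCentres (Closed.ss c))) (allFin n)

        conclude : (c : Closed) → ∀ m → n ≡ m * d → k + k ≤ n → m ≤ s * #A →
                   (#vacant (Closed.ss c) + (s * #A′ + s * deficit ∸ m) ≤ length (remaining c)) →
                   (∀ y → Q * y ≤ s * (2 * n) → 2 * y < length (remaining c)) →
                   (∀ z → Ko * z ≤ n → 2 * (length (Closed.S c) + (z + length (leftover c) * k + (length (Closed.post c) + (k + length (Closed.S c))))) < length (remaining c)) →
                   4 * length (leftover c) < 3 * length (Closed.cs c) → HasHamiltonCycle (k ∸ d) H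
        conclude c m n≡ 2k≤n m≤ F1 F2 F3 F4 = withInserted (insertAll xs (All.tabulate (λ x∈ → proj₁ (left∈ x∈))) (All.tabulate light) F4)
          where
          open Closed c
          open Insertion nil cs (Chunked.shape chunked) S (post ++ X ++ S) ring
          xs = leftover c
          as = remaining c
          P = S ++ flat cs ++ post ++ X
          left∈ : ∀ {x} → x ∈ xs → Good x × x ∉ P
          left∈ x∈ = proj₂ (∈-filter⁻ (λ x → nice? [ x ] ×-dec ¬? (x ∈? P)) {xs = allFin n} x∈)
          rem∈ : ∀ {a} → a ∈ as → ¬ Good a × a ∉ fixedCentres ss
          rem∈ a∈ = proj₂ (∈-filter⁻ (λ a → ¬? (nice? [ a ]) ×-dec ¬? (a ∈? fixedCentres ss)) {xs = allFin n} a∈)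
          light : ∀ {x} → x ∈ xs → 4 * ∑ cs (mf x) ≤ length cs
          light {x} x∈ = ≮⇒≥ λ h → proj₂ (left∈ x∈) (subst (x ∈_) (trans (++-assoc S (flat cs ++ post) X) (cong (S ++_) (++-assoc (flat cs) post X)))
            (∈-++⁺ˡ (All.lookup covers (∈-filter⁺ (OverB? cs) (∈-allFin x) (proj₁ (left∈ x∈) , h)))))
          β = s * #A′ + s * deficit ∸ m
          α = length as ∸ (#vacant ss + β)
          ssF = ss ++ vacants α β
          fixed-bad : ∀ {v} → v ∈ fixedCentres ss → ¬ Good v
          fixed-bad {v} v∈ = either (λ p → proj₁ (proj₂ (∈-filter⁻ (OverA? cs) {xs = allFin n} p))) (λ p → proj₁ (proj₂ (∈-filter⁻ (WeakA′? Q) {xs = allFin n} p)))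
            (∈-++⁻ (overA cs) (subst (v ∈_) centre v∈))
          bad∈ : ∀ {v} → v ∈ fixedCentres ss ++ as → ¬ Good v
          bad∈ v∈ = either fixed-bad (λ p → proj₁ (rem∈ p)) (∈-++⁻ (fixedCentres ss) v∈)
          bad-all : ∀ v → ¬ Good v → v ∈ fixedCentres ss ++ as
          bad-all v ¬g = classify (v ∈? fixedCentres ss)
            where
            classify : Dec (v ∈ fixedCentres ss) → v ∈ fixedCentres ss ++ as
            classify (yes p) = ∈-++⁺ˡ p
            classify (no ¬p) = ∈-++⁺ʳ (fixedCentres ss) (∈-filter⁺ (λ a → ¬? (nice? [ a ]) ×-dec ¬? (a ∈? fixedCentres ss)) (∈-allFin v) (¬g , ¬p))
          ucentres : Unique (fixedCentres ss ++ as)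
          ucentres = unique-++ (subst Unique (sym centre) (unique-++ (Uniqₚ.filter⁺ (OverA? cs) uniqueV) (Uniqₚ.filter⁺ (WeakA′? Q) uniqueV)
              (All.tabulate (λ w∈ o∈ → proj₁ (proj₂ (proj₂ (∈-filter⁻ (OverA? cs) {xs = allFin n} o∈))) w∈))))
            (Uniqₚ.filter⁺ (λ a → ¬? (nice? [ a ]) ×-dec ¬? (a ∈? fixedCentres ss)) uniqueV) (All.tabulate (λ a∈ → proj₂ (rem∈ a∈)))
          count-as : length (fixedCentres ss) + length as ≡ #A′
          count-as = trans (sym (length-++ (fixedCentres ss))) (trans (sym (∑-unique (fixedCentres ss ++ as) ucentres)) (∑-cong (allFin n) (λ v → ≤-antisym
              (χ-mono (v ∈? (fixedCentres ss ++ as)) (¬? (nice? [ v ])) bad∈)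
              (χ-mono (¬? (nice? [ v ])) (v ∈? (fixedCentres ss ++ as)) (bad-all v)))))
          vac : #vacant ssF ≡ length as
          vac = trans (#vacant-++ ss _) (trans (cong (#vacant ss +_) (trans (#vacant-++ (replicate α (vacant first)) _) (cong₂ _+_ (#vacant-replicate α first) (#vacant-replicate β last))))
            (trans (arith (#vacant ss) α β) (m+[n∸m]≡n F1)))
            where
            arith : ∀ v a b → v + (a + b) ≡ v + b + a
            arith = solve-∀
          β+m : β + m ≡ s * #A′ + s * deficit
          β+m = m∸n+n≡m (≤-trans m≤ (≤-trans (*-monoʳ-≤ s (m≤n+m∸n #A #A′)) (≤-reflexive (*-distribˡ-+ s #A′ deficit))))
          totalF : totalBlocks ssF ≡ m
          totalF = +-cancelʳ-≡ β _ _ (begin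
            totalBlocks ssF + β            ≡⟨ cong (_+ β) (trans (∑-++ ss _ slotBlocks) (cong (totalBlocks ss +_) (trans (∑-++ (replicate α (vacant first)) _ slotBlocks)
                                                  (cong₂ _+_ (∑-replicate α (vacant first) slotBlocks) (∑-replicate β (vacant last) slotBlocks))))) ⟩
            totalBlocks ss + (α * s + β * suc t) + β ≡⟨ cong (λ z → z + (α * s + β * suc t) + β) (trans block (cong (_+ 3 * lA * s) (Special.block base))) ⟩
            2 * s + g * (1 + 2 * s) + 3 * lW * s + 3 * lA * s + (α * s + β * suc t) + β ≡⟨ arith t g lW lA α β ⟩
            s * (lA + lW + (2 * lA + (2 + 2 * g + 2 * lW) + β + α)) + g ≡⟨ cong (λ z → s * z + g) (trans (cong₂ (λ x y → x + (y + β + α)) (sym lfix) (sym lvac))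
                                                  (trans (cong (length (fixedCentres ss) +_) (m+[n∸m]≡n F1)) count-as)) ⟩
            s * #A′ + g                    ≡⟨ β+m ⟨
            β + m                          ≡⟨ +-comm β m ⟩
            m + β                          ∎)
            where
            open ≡-Reasoning
            g = s * deficit
            lA = length (overA cs)
            lW = length (weakList Q)
            lfix : length (fixedCentres ss) ≡ lA + lW
            lfix = trans (cong length centre) (length-++ (overA cs))
            lvac : #vacant ss ≡ 2 * lA + (2 + 2 * g + 2 * lW)
            lvac = trans vacancies (cong (2 * lA +_) (Special.vacancies base))
            arith : ∀ t g w a α β → 2 * suc (suc t) + g * (1 + 2 * suc (suc t)) + 3 * w * suc (suc t) + 3 * a * suc (suc t) + (α * suc (suc t) + β * suc t) + β
                    ≡ suc (suc t) * (a + w + (2 * a + (2 + 2 * g + 2 * w) + β + α)) + g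
            arith = solve-∀
          S≥k : k ≤ length S
          S≥k = ≤-trans k≤σ (≤-trans (m≤m+n σ (σ + 0)) (≤-trans (≤-trans (m≤m+n (2 * σ) _) (m≤m+n _ _)) (≤-trans (≤-reflexive (sym (Special.len base)))
            (≤-trans (m≤n+m _ (length prefix)) (≤-reflexive (sym (length-++ prefix)))))))
          withInserted : Inserted xs → HasHamiltonCycle (k ∸ d) H
          withInserted ins = withMatching (perfect-matching badSite? as (sites ssF l) (sym lsites) hx hs)
            where
            open Inserted ins
            F = flatI items
            bs = S ++ F ++ post ++ X
            l = bs ++ S
            l≡ : l ≡ S ++ F ++ post ++ X ++ S
            l≡ = trans (++-assoc S _ S) (cong (S ++_) (trans (++-assoc F _ S) (cong (F ++_) (++-assoc post X S))))
            permP : bs ↭ xs ++ P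
            permP = ↭-trans (++⁺ˡ S (++⁺ʳ (post ++ X) perm)) (↭-trans (↭-reflexive (cong (S ++_) (++-assoc xs (flat cs) (post ++ X)))) (shifts S xs))
            ubs : Unique bs
            ubs = unique-↭ (↭-sym permP) (unique-↭ (++-comm P xs) (unique-++ distinct (Uniqₚ.filter⁺ (λ x → nice? [ x ] ×-dec ¬? (x ∈? P)) uniqueV) (All.tabulate (λ x∈ → proj₂ (left∈ x∈)))))
            good∈ : ∀ v → v ∈ bs → Good v
            good∈ v v∈ = either (λ p → proj₁ (left∈ p)) (All.lookup good) (∈-++⁻ xs (∈-resp-↭ permP v∈))
            good-all : ∀ v → Good v → v ∈ bs
            good-all v g = ∈-resp-↭ (↭-sym permP) (place (v ∈? P))
              where
              place : Dec (v ∈ P) → v ∈ xs ++ P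
              place (yes p) = ∈-++⁺ʳ xs p
              place (no ¬p) = ∈-++⁺ˡ (∈-filter⁺ (λ x → nice? [ x ] ×-dec ¬? (x ∈? P)) (∈-allFin v) (g , ¬p))
            everything : bs ++ (fixedCentres ss ++ as) ↭ allFin n
            everything = full-unique-↭ (unique-++ ubs ucentres (All.tabulate (λ c∈ b∈ → bad∈ c∈ (good∈ _ b∈)))) all
              where
              all : ∀ v → v ∈ bs ++ (fixedCentres ss ++ as)
              all v = side (nice? [ v ])
                where
                side : Dec (Good v) → _
                side (yes g) = ∈-++⁺ˡ (good-all v g)
                side (no ¬g) = ∈-++⁺ʳ bs (bad-all v ¬g)
            count : length bs + (length (fixedCentres ss) + length as) ≡ n
            count = trans (cong (length bs +_) (sym (length-++ (fixedCentres ss)))) (trans (sym (length-++ bs)) (trans (↭-length everything) (length-tabulate id)))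
            sizedF : slotSizes ssF ≡ length bs
            sizedF = +-cancelʳ-≡ (length (fixedCentres ss) + length as) _ _ (begin
              slotSizes ssF + (length (fixedCentres ss) + length as) ≡⟨ arith (slotSizes ssF) (length (fixedCentres ss)) (length as) ⟩
              slotSizes ssF + length as + length (fixedCentres ss)   ≡⟨ cong₂ (λ x y → slotSizes ssF + x + length y) vac (centres-++ ss α β) ⟨
              slotSizes ssF + #vacant ssF + length (fixedCentres ssF) ≡⟨ blocks-sizes ssF ⟨
              totalBlocks ssF * d                                    ≡⟨ cong (_* d) totalF ⟩
              m * d                                                  ≡⟨ n≡ ⟨
              n                                                      ≡⟨ count ⟨
              length bs + (length (fixedCentres ss) + length as)     ∎)
              where
              open ≡-Reasoning
              arith : ∀ a b c → a + (b + c) ≡ a + c + b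
              arith = solve-∀
            lenl : length l ≡ length bs + length S
            lenl = length-++ bs
            lsites : length (sites ssF l) ≡ length as
            lsites = trans (length-sites ssF l) vac
            nicel : NiceSeq l
            nicel = subst NiceSeq (sym l≡) nice
            uniql : Intervals k Unique l
            uniql = subst (Intervals k Unique) (trans (sym (++-assoc U X S)) (cong (_++ S) U≡))
              (intervals-glue {k = k} {P = Unique} U X (≤-trans (≤-reflexive (sym lenX)) (n≤1+n _)) (unique-intervals (subst Unique (sym U≡) ubs)) (unique-intervals uXS))
              where
              U = S ++ F ++ post
              U≡ : U ++ X ≡ bs
              U≡ = trans (++-assoc S (F ++ post) X) (cong (S ++_) (++-assoc F post X))
              uXS : Unique (X ++ S)
              uXS = unique-++ʳ (F ++ post) (unique-↭ (↭-trans (++-comm S (F ++ post ++ X)) (↭-reflexive (trans (cong (_++ S) (sym (++-assoc F post X))) (++-assoc (F ++ post) X S)))) ubs)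
            regular : ∀ p → Regular (drop p l)
            regular p q _ = subst (λ z → Unique (take (k ∸ 1) z)) (sym (drop-drop p q l)) (uniql (p + q) (k ∸ 1) k-1<k) , subst (λ z → Nice (take (k ∸ 1) z)) (sym (drop-drop p q l)) (nicel (p + q) (k ∸ 1) k-1<k)
              where
              k-1<k : k ∸ 1 < k
              k-1<k = ≤-reflexive (suc-pred′ k>0)
            hx : ∀ a → a ∈ as → 2 * ∑ (sites ssF l) (λ s → χ (badSite? a s)) < length (sites ssF l)
            hx a a∈ = ≤-<-trans (*-monoʳ-≤ 2 (≤-trans (bad-sites-≤ a ssF l (≤-trans (≤-reflexive sizedF) (≤-trans (m≤m+n _ _) (≤-reflexive (sym lenl))))) bound))
                (<-≤-trans (F3 (mis a (flat cs)) (≮⇒≥ notOver)) (≤-reflexive (sym lsites)))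
              where
              notOver : ¬ (n < Ko * mis a (flat cs))
              notOver h = proj₂ (rem∈ a∈) (subst (a ∈_) (sym centre) (place (a ∈? weakList Q)))
                where
                place : Dec (a ∈ weakList Q) → a ∈ overA cs ++ weakList Q
                place (yes p) = ∈-++⁺ʳ (overA cs) p
                place (no ¬p) = ∈-++⁺ˡ (∈-filter⁺ (OverA? cs) (∈-allFin a) (proj₁ (rem∈ a∈) , ¬p , h))
              bound : mis a l ≤ length S + (mis a (flat cs) + length xs * k + (length post + (k + length S)))
              bound = ≤-trans (≤-reflexive (cong (mis a) l≡)) (≤-trans (mis-++ʳ a S _) (+-monoʳ-≤ (length S) (≤-trans (mis-++ˡ a F _)
                (+-mono-≤ (misₐ a) (≤-reflexive (trans (length-++ post) (cong (length post +_) (trans (length-++ X) (cong (_+ length S) lenX)))))))))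
            hs : ∀ s′ → s′ ∈ sites ssF l → 2 * ∑ as (λ a → χ (badSite? a s′)) < length (sites ssF l)
            hs (c′ , l′) s∈ = at (sites-∈ ssF l s∈ (≤-trans (+-mono-≤ (≤-reflexive sizedF) S≥k) (≤-reflexive (sym lenl))))
              where
              at : (∃[ p ] l′ ≡ drop p l) × before c′ + after c′ + k ≤ length l′ → 2 * ∑ as (λ a → χ (badSite? a (c′ , l′))) < length (sites ssF l)
              at ((p , refl) , b) = <-≤-trans (F2 _ (≤-trans (*-monoʳ-≤ Q (≤-trans (≤-reflexive (∑-filter _ (allFin n) _)) (∑-mono (allFin n) weaken)))
                  (bad-site-≤ {Q} hMis c′ (drop p l) (regular p) b))) (≤-reflexive (sym lsites))
                where
                weaken : ∀ a → χ (¬? (nice? [ a ]) ×-dec ¬? (a ∈? fixedCentres ss)) * χ (badSite? a (c′ , drop p l)) ≤ χ (¬? (nice? [ a ]) ×-dec badSite? a (c′ , drop p l))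
                weaken a = ≤-trans (≤-reflexive (sym (χ-× (both? a) (¬? (nice? [ a ]) ×-dec ¬? (a ∈? fixedCentres ss)) (badSite? a (c′ , drop p l)) id _,_)))
                  (χ-mono (both? a) (¬? (nice? [ a ]) ×-dec badSite? a (c′ , drop p l)) (λ { ((g , _) , b) → g , b }))
                  where
                  both? : ∀ a → Dec ((¬ Good a × a ∉ fixedCentres ss) × BadSite a (c′ , drop p l))
                  both? a = (¬? (nice? [ a ]) ×-dec ¬? (a ∈? fixedCentres ss)) ×-dec badSite? a (c′ , drop p l)
            withMatching : ∃[ ps ] map proj₁ ps ↭ as × map proj₂ ps ≡ sites ssF l × All (λ p → ¬ BadSite (proj₁ p) (proj₂ p)) ps → HasHamiltonCycle (k ∸ d) H
            withMatching (ps , pa , pe , pg) = units⇒cycle m units bs S n≡ (trans block′ totalF) 2k≤n (trans sized′ sizedF) (≤-trans kdS (≤-trans (m≤m+n (length S) _) (≤-reflexive (sym (length-++ S)))))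
                (sym (take-app-≤ S _ kdS)) kdS valid′ (↭-trans (++⁺ˡ bs (↭-trans centre′ (++⁺ (↭-reflexive (centres-++ ss α β)) pa))) everything)
              where
              open Filled (fillSites ssF l ps pe (valid-++ ss α β l (subst (FixedValid ss) (sym l≡) (valid (F ++ post ++ X ++ S)))) pg)
                renaming (valid to valid′; sized to sized′; block to block′; centre to centre′)
              kdS : k ∸ d ≤ length S
              kdS = ≤-trans (m∸n≤m k d) S≥k

      module Construct (hierarchy : Numbers.Hierarchy k d′ t κ) (hn₀ : Numbers.n₀ k d′ t ≤ n)
                       (hE : κ 0 * (k ^ k * e H B) < n ^ k) (hB : n ≤ 2 * #B) (m : ℕ) (n≡ : n ≡ m * d)
                       (m≤ : m ≤ s * #A) (≤m+s : s * #A ≤ m + s) where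

        module N = Numbers k d′ t
        open Numbers.Hierarchy hierarchy renaming (budget to Z-budget)

        nil : Nice []
        nil = nice-nil hE

        e₁ w₁ lW L₀ U₀ : ℕ
        e₁ = #exceptional
        w₁ = #weakA N.Q
        lW = length (weakList N.Q)
        L₀ = 2 * σ + s * deficit * (d + 2 * σ) + lW * (3 * σ)
        U₀ = e₁ + w₁ + 1

        Ze₁ : N.Z * e₁ ≤ n
        Ze₁ = few-exceptional {N.Z} nil Zκ₁≤κ₀

        Z≤n : N.Z ≤ n
        Z≤n = ≤-trans N.n₅≤n₀ hn₀

        Zw₁ : N.Z * w₁ ≤ n
        Zw₁ = few-weakA {N.Z} {N.Q} nil 2ZQ≤κ₀ (≤-trans N.n₆≤n₀ hn₀)

        4pow≤Q : 4 * 2 ^ (k ∸ 1) ≤ N.Q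
        4pow≤Q = <⇒≤ N.q₆<Q

        4pow≤κ : 4 * 2 ^ (k ∸ 1) ≤ κ 1
        4pow≤κ = ≤-trans 4pow≤Q Q≤κ₁

        A≤ : #A ≤ w₁ + #A′
        A≤ = A-≤ hB 4pow≤Q 4pow≤κ

        deficit≤ : deficit ≤ w₁
        deficit≤ = m≤n+o⇒m∸n≤o #A #A′ (≤-trans A≤ (≤-reflexive (+-comm w₁ #A′)))

        lW≤ : lW ≤ e₁ + w₁
        lW≤ = length-weakList N.Q

        L₀-≤ : ∀ U → 1 ≤ U → w₁ ≤ U → e₁ ≤ U → L₀ ≤ N.c₀ * U
        L₀-≤ U 1≤ w≤ e≤ = begin
          2 * σ + s * deficit * (d + 2 * σ) + lW * (3 * σ)
            ≤⟨ +-mono-≤ (+-mono-≤ (≤-trans (≤-reflexive (sym (*-identityʳ (2 * σ)))) (*-monoʳ-≤ (2 * σ) 1≤)) (*-monoˡ-≤ (d + 2 * σ) (*-monoʳ-≤ s (≤-trans deficit≤ w≤))))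
                 (*-monoˡ-≤ (3 * σ) (≤-trans lW≤ (+-mono-≤ e≤ w≤))) ⟩
          2 * σ * U + s * U * (d + 2 * σ) + (U + U) * (3 * σ) ≡⟨ arith σ U s d ⟩
          (8 * σ + s * (d + 2 * σ)) * U ≡⟨ cong (_* U) N.c₀≡ ⟨
          N.c₀ * U ∎
          where
          open ≤-Reasoning
          arith : ∀ σ U s d → 2 * σ * U + s * U * (d + 2 * σ) + (U + U) * (3 * σ) ≡ (8 * σ + s * (d + 2 * σ)) * U
          arith = solve-∀

        1≤U₀ : 1 ≤ U₀
        1≤U₀ = m≤n+m 1 (e₁ + w₁)
        w≤U₀ : w₁ ≤ U₀
        w≤U₀ = m≤n⇒m≤n+o 1 (m≤n+m w₁ e₁)
        e≤U₀ : e₁ ≤ U₀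
        e≤U₀ = m≤n⇒m≤n+o 1 (m≤m+n e₁ w₁)

        budget : (N.Q * κ 1 + N.q₀ + 4) * (e₁ + (L₀ + k)) ≤ n
        budget = *-cancelˡ-≤ 3 (begin
          3 * (X * (e₁ + (L₀ + k)))                      ≤⟨ *-monoʳ-≤ 3 (*-monoʳ-≤ X (+-mono-≤ e≤U₀ (+-mono-≤ (L₀-≤ U₀ 1≤U₀ w≤U₀ e≤U₀) (≤-trans (≤-reflexive (sym (*-identityʳ k))) (*-monoʳ-≤ k 1≤U₀))))) ⟩
          3 * (X * (U₀ + (N.c₀ * U₀ + k * U₀)))          ≡⟨ arith X U₀ N.c₀ k ⟩
          3 * (X * (N.c₀ + k + 1)) * U₀                  ≤⟨ *-monoˡ-≤ U₀ Z-budget ⟩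
          N.Z * (e₁ + w₁ + 1)                            ≡⟨ arith₂ N.Z e₁ w₁ ⟩
          N.Z * e₁ + N.Z * w₁ + N.Z                      ≤⟨ +-mono-≤ (+-mono-≤ Ze₁ Zw₁) Z≤n ⟩
          n + n + n                                      ≡⟨ arith₃ n ⟩
          3 * n                                          ∎)
          where
          open ≤-Reasoning
          X = N.Q * κ 1 + N.q₀ + 4
          arith : ∀ X U c k → 3 * (X * (U + (c * U + k * U))) ≡ 3 * (X * (c + k + 1)) * U
          arith = solve-∀
          arith₂ : ∀ Z a b → Z * (a + b + 1) ≡ Z * a + Z * b + Z
          arith₂ = solve-∀
          arith₃ : ∀ n → n + n + n ≡ 3 * n
          arith₃ = solve-∀

        C : Constants
        C = record
          { Q = N.Q ; G′ = N.G′ ; Nm = N.Nm ; q₀ = N.q₀ ; L = L₀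
          ; hκ₂ = square ; κk>0 = bottom ; hn = ≤-trans N.n₁≤n₀ hn₀ ; hQ = N.q₃<Q ; 3σ≤ = N.3σ≤Nm ; nil = nil
          ; hC = <-≤-trans N.q₄<Q Q≤κ₁ ; hQe = N.q₅<Q ; hnk = ≤-trans Qκ₁≤n₀ hn₀
          ; hF = ≤-trans (*-monoˡ-≤ (e₁ + (L₀ + k)) (m≤n⇒m≤n+o 4 (m≤m+n (N.Q * κ 1) N.q₀))) budget
          ; hq₀κ = q₀κ₁≤κ₀ ; hq₀ = cube ; hq₀n = ≤-trans N.n₃≤n₀ hn₀
          ; hq₀F = ≤-trans (*-mono-≤ (m≤n⇒m≤n+o 4 (m≤n+m N.q₀ (N.Q * κ 1))) (+-monoʳ-≤ e₁ (m≤m+n L₀ k))) budget }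

        4e₁L₀ : 4 * (e₁ + L₀) ≤ n
        4e₁L₀ = ≤-trans (*-mono-≤ (m≤n+m 4 (N.Q * κ 1 + N.q₀)) (+-monoʳ-≤ e₁ (m≤m+n L₀ k))) budget

        3Ko≢0 : NonZero (3 * N.Ko)
        3Ko≢0 = >-nonZero (≤-trans N.Ko>0 (m≤m+n N.Ko (2 * N.Ko)))

        few-edges-missed : ∀ T → Unique T → length T ≡ k ∸ 1 → Nice T → N.Q * nonEdges T ≤ 2 * n
        few-edges-missed T u lT nT = begin
          N.Q * nonEdges T                 ≤⟨ *-monoʳ-≤ N.Q (nonEdges-≤ T u lT) ⟩
          N.Q * (e₁ + cnt T)               ≡⟨ *-distribˡ-+ N.Q e₁ (cnt T) ⟩
          N.Q * e₁ + N.Q * cnt T           ≤⟨ +-mono-≤ (≤-trans (*-monoˡ-≤ e₁ N.z₂≤Z) Ze₁) last-level ⟩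
          n + n                            ≡⟨ cong (n +_) (sym (+-identityʳ n)) ⟩
          2 * n                            ∎
          where
          open ≤-Reasoning
          k∸T : k ∸ length T ≡ 1
          k∸T = trans (cong₂ _∸_ (sym (suc-pred′ k>0)) lT) (m+n∸n≡m 1 (k ∸ 1))
          Q≤κ : N.Q ≤ κ (length T)
          Q≤κ = ≤-trans (≤-trans (≤-reflexive (sym (*-identityʳ N.Q))) (*-monoʳ-≤ N.Q (*-mono-≤ bottom bottom)))
            (≤-trans (≤-reflexive (cong (λ z → N.Q * (κ z * κ z)) (sym (trans (cong suc lT) (suc-pred′ k>0))))) (square (length T) (≤-trans (≤-reflexive (cong suc lT)) (≤-reflexive (suc-pred′ k>0)))))
          last-level : N.Q * cnt T ≤ n
          last-level = ≤-trans (*-monoˡ-≤ (cnt T) Q≤κ) (<⇒≤ (<-≤-trans nT (≤-reflexive (trans (cong (n ^_) k∸T) (*-identityʳ n)))))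

        after-chunks : ∀ a b → N.Q * a ≤ 3 * N.Ko * n → N.Kc * b ≤ 4 * n → N.G * ((k + k) + (k + b * suc k + a * (3 * σ))) ≤ n
        after-chunks a b hA hb = *-cancelˡ-≤ 3 (begin
          3 * (N.G * ((k + k) + (k + b * suc k + a * (3 * σ))))  ≡⟨ arith N.G k b a σ ⟩
          9 * N.G * k + 3 * N.G * suc k * b + 9 * N.G * σ * a    ≤⟨ +-mono-≤ (+-mono-≤ (≤-trans N.n₇≤n₀ hn₀) b-part) a-part ⟩
          n + n + n                                              ≡⟨ arith₃ n ⟩
          3 * n                                                  ∎)
          where
          open ≤-Reasoning
          arith : ∀ G k b a σ → 3 * (G * ((k + k) + (k + b * suc k + a * (3 * σ)))) ≡ 9 * G * k + 3 * G * suc k * b + 9 * G * σ * a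
          arith = solve-∀
          arith₃ : ∀ n → n + n + n ≡ 3 * n
          arith₃ = solve-∀
          b-part : 3 * N.G * suc k * b ≤ n
          b-part = *-cancelˡ-≤ 4 (≤-trans (≤-trans (≤-reflexive (arith₄ N.G (suc k) b)) (*-monoˡ-≤ b N.12G≤Kc)) hb)
            where
            arith₄ : ∀ G k b → 4 * (3 * G * k * b) ≡ 12 * G * k * b
            arith₄ = solve-∀
          a-part : 9 * N.G * σ * a ≤ n
          a-part = *-cancelˡ-≤ (3 * N.Ko) {{3Ko≢0}} (≤-trans (≤-trans (≤-reflexive (arith₅ N.Ko N.G σ a)) (*-monoˡ-≤ a (<⇒≤ N.q₈<Q))) hA)
            where
            arith₅ : ∀ K G σ a → 3 * K * (9 * G * σ * a) ≡ 27 * K * G * σ * a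
            arith₅ = solve-∀

        R : RingConstants C
        R = record
          { Kc = N.Kc ; Ko = N.Ko ; hChunk = N.q₁<Q ; hWheel = N.q₂<Q ; 2k≤Nm = N.2k≤Nm ; hQk = ≤-trans N.n₄≤n₀ hn₀
          ; hMis = few-edges-missed ; hAfter = after-chunks }

        open Conclusion C R hiding (nil)

        #B-us : ∀ us → #B ≤ #fresh us + (#exceptional + length us)
        #B-us us = ≤-trans (∑-mono (allFin n) (λ v → χ-⊎ (InB?′ v) (fresh? us v) (NotFresh? us v) (split v (fresh? us v))))
          (≤-trans (≤-reflexive (∑-+ (allFin n) _ _)) (+-monoʳ-≤ (#fresh us) (#notFresh-≤ us)))
          where
          split : ∀ v → Dec (Fresh us v) → InB B v → Fresh us v ⊎ (InB B v × ¬ Fresh us v)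
          split v (yes f) b = inj₁ f
          split v (no ¬f) b = inj₂ (b , ¬f)

        lower₀ : (sp : Special) → let S₀ = Special.S sp in n ≤ N.G₁ * (#fresh (S₀ ++ []) + (k + k))
        lower₀ sp = ≤-trans (+-cancelʳ-≤ n _ _ (begin
            n + n                               ≤⟨ +-mono-≤ hB hB ⟩
            2 * #B + 2 * #B                     ≡⟨ arith #B ⟩
            4 * #B                              ≤⟨ *-monoʳ-≤ 4 (≤-trans (#B-us (S₀ ++ [])) (≤-reflexive (cong (λ z → #fresh (S₀ ++ []) + (e₁ + z)) (trans (cong length (++-identityʳ S₀)) (Special.len sp))))) ⟩
            4 * (#fresh (S₀ ++ []) + (e₁ + L₀)) ≡⟨ *-distribˡ-+ 4 (#fresh (S₀ ++ [])) _ ⟩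
            4 * #fresh (S₀ ++ []) + 4 * (e₁ + L₀) ≤⟨ +-monoʳ-≤ (4 * #fresh (S₀ ++ [])) 4e₁L₀ ⟩
            4 * #fresh (S₀ ++ []) + n           ∎))
          (*-mono-≤ 4≤G₁ (m≤m+n (#fresh (S₀ ++ [])) (k + k)))
          where
          S₀ = Special.S sp
          open ≤-Reasoning
          arith : ∀ b → 2 * b + 2 * b ≡ 4 * b
          arith = solve-∀
          4≤G₁ : 4 ≤ N.G₁
          4≤G₁ = *-monoˡ-≤ 2 (s≤s (subst (0 <_) (sym N.G′≡) N.P₈>0))

        module WithChunks (sp : Special) (ch : Chunked (Special.S sp) (Special.ss sp)) where

          S₀ : W
          S₀ = Special.S sp

          cs : List (W × W)
          cs = Chunked.cs ch

          f : ℕ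
          f = #fresh (S₀ ++ flat cs)

          length-flat : ∀ cs → All (Chunk N.Kc) cs → length (flat cs) ≡ length cs * (k + k)
          length-flat [] [] = refl
          length-flat ((u , v) ∷ cs) (c ∷ sh) = trans (length-++ (u ++ v)) (cong₂ _+_ (trans (length-++ u) (cong₂ _+_ (Chunk.lengthˡ c) (Chunk.lengthʳ c))) (length-flat cs sh))

          n-chunks : n ≤ 2 * (f + (e₁ + (L₀ + length cs * (k + k))))
          n-chunks = ≤-trans hB (*-monoʳ-≤ 2 (≤-trans (#B-us (S₀ ++ flat cs)) (≤-reflexive (cong (λ z → f + (e₁ + z)) (trans (length-++ S₀) (cong₂ _+_ (Special.len sp) (length-flat cs (Chunked.shape ch))))))))

          8P-e₁ : N.P₈ * e₁ ≤ n
          8P-e₁ = ≤-trans (*-monoˡ-≤ e₁ N.z₁≤Z) Ze₁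
          8P-w₁ : N.P₈ * w₁ ≤ n
          8P-w₁ = ≤-trans (*-monoˡ-≤ w₁ N.z₁≤Z) Zw₁
          8P-1 : N.P₈ * 1 ≤ n
          8P-1 = ≤-trans (≤-reflexive (*-identityʳ N.P₈)) (≤-trans N.z₁≤Z Z≤n)
          8P-f : N.P₈ * f ≤ n
          8P-f = ≤-trans (*-monoˡ-≤ f N.P₈≤G₁) (<⇒≤ (Chunked.full ch))
          8P-0 : N.P₈ * 0 ≤ n
          8P-0 = ≤-trans (≤-reflexive (*-zeroʳ N.P₈)) z≤n

          T : ℕ → ℕ → ℕ → ℕ
          T a b v = a + (b + (e₁ + (w₁ + (f + (1 + v)))))

          module Bounds (a b v : ℕ) where
            U : ℕ
            U = T a b v
            a≤ : a ≤ U
            a≤ = m≤m+n a _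
            b≤ : b ≤ U
            b≤ = ≤-trans (m≤m+n b _) (m≤n+m _ a)
            e≤ : e₁ ≤ U
            e≤ = ≤-trans (≤-trans (m≤m+n e₁ _) (m≤n+m _ b)) (m≤n+m _ a)
            w≤ : w₁ ≤ U
            w≤ = ≤-trans (≤-trans (≤-trans (m≤m+n w₁ _) (m≤n+m _ e₁)) (m≤n+m _ b)) (m≤n+m _ a)
            f≤ : f ≤ U
            f≤ = ≤-trans (≤-trans (≤-trans (≤-trans (m≤m+n f _) (m≤n+m _ w₁)) (m≤n+m _ e₁)) (m≤n+m _ b)) (m≤n+m _ a)
            1≤ : 1 ≤ U
            1≤ = ≤-trans (≤-trans (≤-trans (≤-trans (≤-trans (m≤m+n 1 v) (m≤n+m _ f)) (m≤n+m _ w₁)) (m≤n+m _ e₁)) (m≤n+m _ b)) (m≤n+m _ a)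
            v≤ : v ≤ U
            v≤ = ≤-trans (≤-trans (≤-trans (≤-trans (≤-trans (m≤n+m v 1) (m≤n+m _ f)) (m≤n+m _ w₁)) (m≤n+m _ e₁)) (m≤n+m _ b)) (m≤n+m _ a)
            c≤ : ∀ c → c ≤ c * U
            c≤ c = ≤-trans (≤-reflexive (sym (*-identityʳ c))) (*-monoʳ-≤ c 1≤)
            L≤ : L₀ ≤ N.c₀ * U
            L≤ = L₀-≤ U 1≤ w≤ e≤

          PT : ∀ {a b v} → N.P₈ * a ≤ n → N.P₈ * b ≤ n → N.P₈ * v ≤ n → N.P * T a b v < n
          PT ha hb hv = seven-small N.P N.P₈≡ n>0 ha hb 8P-e₁ 8P-w₁ 8P-f 8P-1 hv

          P≥ : ∀ {x} → x ≤ 32 * k + 12 + 6 * N.c₀ → x ≤ N.P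
          P≥ h = ≤-trans h N.tail≤P

          cs>0 : 0 < length cs
          cs>0 = go (length cs) refl
            where
            open Bounds 0 0 0
            go : ∀ c → c ≡ length cs → 0 < length cs
            go (suc c) h = subst (0 <_) h z<s
            go zero h = contradiction (≤-<-trans n-chunks (≤-<-trans small-part (PT 8P-0 8P-0 8P-0))) (<-irrefl refl)
              where
              open ≤-Reasoning
              arith : ∀ c U → 2 * (U + (U + (c * U + 0))) ≡ (4 + 2 * c) * U
              arith = solve-∀
              small-part : 2 * (f + (e₁ + (L₀ + length cs * (k + k)))) ≤ N.P * T 0 0 0
              small-part = begin
                2 * (f + (e₁ + (L₀ + length cs * (k + k))))  ≡⟨ cong (λ z → 2 * (f + (e₁ + (L₀ + z * (k + k))))) h ⟨
                2 * (f + (e₁ + (L₀ + 0)))                    ≤⟨ *-monoʳ-≤ 2 (+-mono-≤ f≤ (+-mono-≤ e≤ (+-monoˡ-≤ 0 L≤))) ⟩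
                2 * (U + (U + (N.c₀ * U + 0)))               ≡⟨ arith N.c₀ U ⟩
                (4 + 2 * N.c₀) * U                           ≤⟨ *-monoˡ-≤ U (P≥ (+-mono-≤ (≤-trans (m≤m+n 4 8) (m≤n+m 12 (32 * k))) (*-monoˡ-≤ N.c₀ (m≤m+n 2 4)))) ⟩
                N.P * U                                      ∎

        module WithClosed (c : Closed) where

          open WithChunks (Closed.base c) (Closed.chunked c)

          sp : Special
          sp = Closed.base c

          open Closed c using (prefix; ss; post) renaming (S to S₁)

          lA lB lL lR : ℕ
          lA = length (overA cs)
          lB = length (overB cs)
          lL = length (leftover c)
          lR = length (remaining c)

          8P-A : N.P₈ * lA ≤ n
          8P-A = *-cancelˡ-≤ (3 * N.Ko) {{3Ko≢0}} (≤-trans (≤-trans (≤-reflexive (trans (cong (λ z → 3 * N.Ko * (z * lA)) N.P₈≡) (arith N.Ko N.P lA))) (*-monoˡ-≤ lA (<⇒≤ N.q₇<Q))) (Closed.fewA c))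
            where
            arith : ∀ K P a → 3 * K * (8 * P * a) ≡ 24 * P * K * a
            arith = solve-∀

          8P-B : N.P₈ * lB ≤ n
          8P-B = *-cancelˡ-≤ 4 (≤-trans (≤-trans (≤-reflexive (trans (cong (λ z → 4 * (z * lB)) N.P₈≡) (arith N.P lB))) (*-monoˡ-≤ lB N.32P≤Kc)) (Closed.fewB c))
            where
            arith : ∀ P a → 4 * (8 * P * a) ≡ 32 * P * a
            arith = solve-∀

          left≤ : lL ≤ f + w₁
          left≤ = ≤-trans (≤-reflexive (length-filter Left? (allFin n))) (≤-trans (∑-mono (allFin n) (λ v → χ-⊎ (Left? v) (fresh? (S₀ ++ flat cs) v) (WeakA? N.Q v) (λ p → split v p (InB?′ v))))
              (≤-reflexive (∑-+ (allFin n) _ _)))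
            where
            ringList = S₁ ++ flat cs ++ post ++ Closed.X c
            Left? : ∀ x → Dec (Good x × x ∉ ringList)
            Left? x = nice? [ x ] ×-dec ¬? (x ∈? ringList)
            split : ∀ v → Good v × v ∉ ringList → Dec (InB B v) → Fresh (S₀ ++ flat cs) v ⊎ (¬ InB B v × ¬ Strong N.Q v)
            split v (g , v∉) (no ¬b) = inj₂ (¬b , λ st → strong-not-nice hB 4pow≤Q 4pow≤κ st g)
            split v (g , v∉) (yes b) = inj₁ (b , g , λ v∈ → v∉ (either (λ p → ∈-++⁺ˡ (∈-++⁺ʳ prefix p)) (λ p → ∈-++⁺ʳ S₁ (∈-++⁺ˡ p)) (∈-++⁻ S₀ v∈)))

          centres≡ : length (fixedCentres ss) ≡ lA + lW
          centres≡ = trans (cong length (Closed.centre c)) (length-++ (overA cs))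

          A′≤ : #A′ ≤ lR + (lA + lW)
          A′≤ = ≤-trans (∑-mono (allFin n) (λ v → χ-⊎ (¬? (nice? [ v ])) (Rem? v) (v ∈? fixedCentres ss) (λ ¬g → split v ¬g (v ∈? fixedCentres ss))))
              (≤-trans (≤-reflexive (∑-+ (allFin n) _ _)) (+-mono-≤ (≤-reflexive (sym (length-filter Rem? (allFin n)))) (≤-trans (∑-∈? Finₚ._≟_ uniqueV (fixedCentres ss)) (≤-reflexive centres≡))))
            where
            Rem? : ∀ a → Dec (¬ Good a × a ∉ fixedCentres ss)
            Rem? a = ¬? (nice? [ a ]) ×-dec ¬? (a ∈? fixedCentres ss)
            split : ∀ v → ¬ Good v → Dec (v ∈ fixedCentres ss) → (¬ Good v × v ∉ fixedCentres ss) ⊎ v ∈ fixedCentres ss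
            split v ¬g (yes p) = inj₂ p
            split v ¬g (no ¬p) = inj₁ (¬g , ¬p)

          win : ∀ v q X → N.P₈ * v ≤ n → q ≤ N.c₁ + N.c₂ + N.c₃ → X + (lA + lW + w₁) ≤ q * T lA lB v → X < lR
          win v q X hv q≤ hX = +-cancelʳ-< (lA + lW + w₁) X lR (<-≤-trans below (≤-trans A≤ (≤-trans (+-monoʳ-≤ w₁ A′≤) (≤-reflexive (arith w₁ lR (lA + lW))))))
            where
            open ≤-Reasoning
            arith : ∀ w r x → w + (r + x) ≡ r + (x + w)
            arith = solve-∀
            arith₂ : ∀ a b c → a * b * c ≡ a * c * b
            arith₂ = solve-∀
            below : X + (lA + lW + w₁) < #A
            below = *-cancelˡ-< (s * d) _ _ (begin-strict
              s * d * (X + (lA + lW + w₁))      ≤⟨ *-monoʳ-≤ (s * d) hX ⟩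
              s * d * (q * T lA lB v)           ≡⟨ *-assoc (s * d) q _ ⟨
              s * d * q * T lA lB v             ≤⟨ *-monoˡ-≤ (T lA lB v) (≤-trans (*-monoʳ-≤ (s * d) q≤) N.sd≤P) ⟩
              N.P * T lA lB v                   <⟨ PT 8P-A 8P-B hv ⟩
              n                                 ≡⟨ n≡ ⟩
              m * d                             ≤⟨ *-monoˡ-≤ d m≤ ⟩
              s * #A * d                        ≡⟨ arith₂ s #A d ⟩
              s * d * #A                        ∎)

          fixed≤ : ∀ v → lA + lW + w₁ ≤ 4 * T lA lB v
          fixed≤ v = ≤-trans (+-mono-≤ (+-mono-≤ a≤ (≤-trans lW≤ (+-mono-≤ e≤ w≤))) w≤) (≤-reflexive (arith U))
            where
            open Bounds lA lB v
            arith : ∀ U → U + (U + U) + U ≡ 4 * U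
            arith = solve-∀

          F1 : #vacant ss + (s * #A′ + s * deficit ∸ m) ≤ lR
          F1 = <⇒≤ (win 0 N.c₁ _ 8P-0 (≤-trans (m≤m+n N.c₁ N.c₂) (m≤m+n _ N.c₃)) (begin
            #vacant ss + β + (lA + lW + w₁)   ≤⟨ +-mono-≤ (+-mono-≤ vac β≤) (fixed≤ 0) ⟩
            2 * U + (2 * U + 2 * (s * U) + 2 * (U + U)) + (s * U + s * U) + 4 * U ≡⟨ arith s U ⟩
            (12 + 4 * s) * U                  ≡⟨ cong (_* U) N.c₁≡ ⟨
            N.c₁ * U                          ∎))
            where
            open ≤-Reasoning
            open Bounds lA lB 0
            β = s * #A′ + s * deficit ∸ m
            arith : ∀ s U → 2 * U + (2 * U + 2 * (s * U) + 2 * (U + U)) + (s * U + s * U) + 4 * U ≡ (12 + 4 * s) * U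
            arith = solve-∀
            vac : #vacant ss ≤ 2 * U + (2 * U + 2 * (s * U) + 2 * (U + U))
            vac = ≤-trans (≤-reflexive (trans (Closed.vacancies c) (cong (2 * lA +_) (Special.vacancies sp))))
              (+-mono-≤ (*-monoʳ-≤ 2 a≤) (+-mono-≤ (+-mono-≤ (c≤ 2) (*-monoʳ-≤ 2 (*-monoʳ-≤ s (≤-trans deficit≤ w≤)))) (*-monoʳ-≤ 2 (≤-trans lW≤ (+-mono-≤ e≤ w≤)))))
            β≤ : β ≤ s * U + s * U
            β≤ = m≤n+o⇒m∸n≤o (s * #A′ + s * deficit) m (begin
              s * #A′ + s * deficit     ≡⟨ *-distribˡ-+ s #A′ deficit ⟨
              s * (#A′ + (#A ∸ #A′))    ≤⟨ *-monoʳ-≤ s top ⟩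
              s * (e₁ + #A)             ≡⟨ *-distribˡ-+ s e₁ #A ⟩
              s * e₁ + s * #A           ≤⟨ +-mono-≤ (*-monoʳ-≤ s e≤) (≤-trans ≤m+s (+-monoʳ-≤ m (c≤ s))) ⟩
              s * U + (m + s * U)       ≡⟨ arith₂ (s * U) m ⟩
              m + (s * U + s * U)       ∎)
              where
              arith₂ : ∀ a m → a + (m + a) ≡ m + (a + a)
              arith₂ = solve-∀
              top : #A′ + (#A ∸ #A′) ≤ e₁ + #A
              top = go (≤-total #A′ #A)
                where
                go : #A′ ≤ #A ⊎ #A ≤ #A′ → #A′ + (#A ∸ #A′) ≤ e₁ + #A
                go (inj₁ h) = ≤-trans (≤-reflexive (m+[n∸m]≡n h)) (m≤n+m #A e₁)
                go (inj₂ h) = ≤-trans (≤-reflexive (trans (cong (#A′ +_) (m≤n⇒m∸n≡0 h)) (+-identityʳ #A′))) A′-≤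

          F2 : ∀ y → N.Q * y ≤ s * (2 * n) → 2 * y < lR
          F2 y hy = win y N.c₂ (2 * y) 8Py (≤-trans (m≤n+m N.c₂ N.c₁) (m≤m+n _ N.c₃)) (≤-trans (+-mono-≤ (*-monoʳ-≤ 2 v≤) (fixed≤ y)) (≤-reflexive (trans (sym (*-distribʳ-+ U 2 4)) (cong (_* U) (sym N.c₂≡)))))
            where
            open Bounds lA lB y
            8Py : N.P₈ * y ≤ n
            8Py = *-cancelˡ-≤ (2 * s) (begin
              2 * s * (N.P₈ * y)       ≡⟨ trans (cong (λ z → 2 * s * (z * y)) N.P₈≡) (arith s N.P y) ⟩
              16 * N.P * s * y         ≤⟨ *-monoˡ-≤ y (<⇒≤ N.q₉<Q) ⟩
              N.Q * y                  ≤⟨ hy ⟩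
              s * (2 * n)              ≡⟨ arith₂ s n ⟩
              2 * s * n                ∎)
              where
              open ≤-Reasoning
              arith : ∀ s P y → 2 * s * (8 * P * y) ≡ 16 * P * s * y
              arith = solve-∀
              arith₂ : ∀ s n → s * (2 * n) ≡ 2 * s * n
              arith₂ = solve-∀

          S₁≤ : ∀ v → length S₁ ≤ (N.c₀ + 3 * σ) * T lA lB v
          S₁≤ v = ≤-trans (≤-reflexive (trans (length-++ prefix) (cong₂ _+_ (Closed.lenS c) (Special.len sp))))
            (≤-trans (+-mono-≤ (*-monoˡ-≤ (3 * σ) a≤) L≤) (≤-reflexive (arith N.c₀ σ U)))
            where
            open Bounds lA lB v
            arith : ∀ c σ U → U * (3 * σ) + c * U ≡ (c + 3 * σ) * U
            arith = solve-∀

          F3 : ∀ z → N.Ko * z ≤ n → 2 * (length S₁ + (z + lL * k + (length post + (k + length S₁)))) < lR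
          F3 z hz = win z N.c₃ _ (subst (λ x → x * z ≤ n) N.Ko≡ hz) (m≤n+m N.c₃ (N.c₁ + N.c₂)) (≤-trans (+-mono-≤ (*-monoʳ-≤ 2 (+-mono-≤ (S₁≤ z) (+-mono-≤ (+-mono-≤ v≤ (*-monoˡ-≤ k (≤-trans left≤ (+-mono-≤ f≤ w≤))))
              (+-mono-≤ (≤-trans (Closed.lenPost c) (*-monoˡ-≤ (suc k) b≤)) (+-mono-≤ (c≤ k) (S₁≤ z)))))) (fixed≤ z)) (≤-reflexive (trans (arith (N.c₀ + 3 * σ) k U) (cong (_* U) (sym N.c₃≡)))))
            where
            open Bounds lA lB z
            arith : ∀ c k U → 2 * (c * U + (U + (U + U) * k + (U * suc k + (k * U + c * U)))) + 4 * U ≡ (2 * (c + (1 + 2 * k + (suc k + (k + c)))) + 4) * U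
            arith = solve-∀

          F4 : 4 * lL < 3 * length cs
          F4 = ≰⇒> λ h → <-irrefl refl (≤-<-trans (m≤m+n n (2 * n)) (≤-<-trans (triple h) (PT 8P-0 8P-0 8P-0)))
            where
            open ≤-Reasoning
            open Bounds 0 0 0
            arith₁ : ∀ f e L c k → 3 * (2 * (f + (e + (L + c * (k + k))))) ≡ 6 * (f + (e + L)) + 4 * k * (3 * c)
            arith₁ = solve-∀
            arith₂ : ∀ c k U → 6 * (U + (U + c * U)) + 4 * k * (4 * (U + U)) ≡ (32 * k + 12 + 6 * c) * U
            arith₂ = solve-∀
            triple : 3 * length cs ≤ 4 * lL → 3 * n ≤ N.P * U
            triple h = begin
              3 * n                                                  ≤⟨ *-monoʳ-≤ 3 n-chunks ⟩
              3 * (2 * (f + (e₁ + (L₀ + length cs * (k + k)))))      ≡⟨ arith₁ f e₁ L₀ (length cs) k ⟩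
              6 * (f + (e₁ + L₀)) + 4 * k * (3 * length cs)          ≤⟨ +-mono-≤ (*-monoʳ-≤ 6 (+-mono-≤ f≤ (+-mono-≤ e≤ L≤))) (*-monoʳ-≤ (4 * k) (≤-trans h (*-monoʳ-≤ 4 (≤-trans left≤ (+-mono-≤ f≤ w≤))))) ⟩
              6 * (U + (U + N.c₀ * U)) + 4 * k * (4 * (U + U))       ≡⟨ arith₂ N.c₀ k U ⟩
              (32 * k + 12 + 6 * N.c₀) * U                           ≤⟨ *-monoˡ-≤ U (P≥ ≤-refl) ⟩
              N.P * U                                                ∎

          hamilton : HasHamiltonCycle (k ∸ d) H
          hamilton = conclude c m n≡ (≤-trans N.n₈≤n₀ hn₀) m≤ F1 F2 F3 F4

        chunks : (sp : Special) → Chunked (Special.S sp) (Special.ss sp)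
        chunks sp = fill (suc n) [] (Special.state sp) [] (≤-trans (n<1+n n) (m≤n+m (suc n) _)) (lower₀ sp)

        hamilton : HasHamiltonCycle (k ∸ d) H
        hamilton = build (special hB 4e₁L₀ ≤-refl)
          where
          build : Special → HasHamiltonCycle (k ∸ d) H
          build sp = seal (chunks sp)
            where
            seal : Chunked (Special.S sp) (Special.ss sp) → HasHamiltonCycle (k ∸ d) H
            seal ch = WithClosed.hamilton (close sp ch (WithChunks.cs>0 sp ch))

open import Data.Integer.Base using (+_)

pos-+*+ : ∀ a b c → + (a + b * c) ≡ + a ℤ.+ + b ℤ.* + c
pos-+*+ a b c = trans (ℤₚ.pos-+ a (b * c)) (cong (λ z → (+ a) ℤ.+ z) (ℤₚ.pos-* b c))

toℚᵘ-/ : ∀ a q .{{_ : NonZero q}} → toℚᵘ ((+ a) ℚ./ q) ℚᵘ.≃ mkℚᵘ (+ a) (pred q)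
toℚᵘ-/ a (suc q) = ℚₚ.toℚᵘ-fromℚᵘ (mkℚᵘ (+ a) q)

/≤fromℕ : ∀ {a b} q .{{_ : NonZero q}} → (+ a) ℚ./ q ℚ.≤ fromℕ b → a ≤ b * q
/≤fromℕ {a} {b} (suc q) h = ℤₚ.drop‿+≤+ (subst₂ ℤ._≤_ (ℤₚ.*-identityʳ (+ a)) (sym (ℤₚ.pos-* b (suc q)))
  (ℚᵘₚ.drop-*≤* (ℚᵘₚ.≤-respˡ-≃ (toℚᵘ-/ a (suc q)) (ℚᵘₚ.≤-respʳ-≃ (toℚᵘ-/ b 1) (ℚₚ.toℚᵘ-mono-≤ h)))))

fromℕ≤/* : ∀ {a b} q → fromℕ a ℚ.≤ (+ 1) ℚ./ suc q ℚ.* fromℕ b → suc q * a ≤ b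
fromℕ≤/* {a} {b} q h = ℤₚ.drop‿+≤+ (subst₂ ℤ._≤_ left right (ℚᵘₚ.drop-*≤* inequality))
  where
  inequality : mkℚᵘ (+ a) 0 ℚᵘ.≤ mkℚᵘ (+ 1) q ℚᵘ.* mkℚᵘ (+ b) 0
  inequality = ℚᵘₚ.≤-respˡ-≃ (toℚᵘ-/ a 1) (ℚᵘₚ.≤-respʳ-≃ (ℚᵘₚ.≃-trans (ℚₚ.toℚᵘ-homo-* ((+ 1) ℚ./ suc q) (fromℕ b))
    (ℚᵘₚ.*-cong (toℚᵘ-/ 1 (suc q)) (toℚᵘ-/ b 1))) (ℚₚ.toℚᵘ-mono-≤ h))
  left : + a ℤ.* ℚᵘ.↧ (mkℚᵘ (+ 1) q ℚᵘ.* mkℚᵘ (+ b) 0) ≡ + (suc q * a)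
  left = trans (sym (ℤₚ.pos-* a _)) (cong +_ (trans (*-comm a _) (cong (_* a) (*-identityʳ (suc q)))))
  right : ℚᵘ.↥ (mkℚᵘ (+ 1) q ℚᵘ.* mkℚᵘ (+ b) 0) ℤ.* + 1 ≡ + b
  right = trans (ℤₚ.*-identityʳ _) (ℤₚ.*-identityˡ (+ b))

floor-bounds : ∀ p {a q b} → toℚᵘ p ℚᵘ.≃ mkℚᵘ (+ a) q → + b ≡ floor p → b * suc q ≤ a × a < suc b * suc q
floor-bounds p@(mkℚ num den _) {a} {q} {b} (ℚᵘ.*≡* eq) b≡ = lower , upper
  where
  D = suc den
  ρ = num ℤ.% + D
  ρ<D : ρ < D
  ρ<D = ℤ-DivMod.n%d<d num (+ D)
  num≡ : num ≡ + (ρ + b * D)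
  num≡ = trans (ℤ-DivMod.a≡a%n+[a/n]*n num (+ D)) (trans (cong (λ z → + ρ ℤ.+ z ℤ.* + D) (sym b≡)) (sym (pos-+*+ ρ b D)))
  cross : (ρ + b * D) * suc q ≡ a * D
  cross = ℤₚ.+-injective (trans (ℤₚ.pos-* (ρ + b * D) (suc q)) (trans (cong (ℤ._* + suc q) (sym num≡)) (trans eq (sym (ℤₚ.pos-* a D)))))
  swapped : ∀ b D q → b * D * q ≡ b * q * D
  swapped = solve-∀
  lower : b * suc q ≤ a
  lower = *-cancelʳ-≤ (b * suc q) a D (≤-trans (≤-reflexive (sym (swapped b D (suc q)))) (≤-trans (*-monoˡ-≤ (suc q) (m≤n+m (b * D) ρ)) (≤-reflexive cross)))
  upper : a < suc b * suc q
  upper = *-cancelʳ-< D a (suc b * suc q) (≤-<-trans (≤-reflexive (sym cross)) (<-≤-trans (*-monoˡ-< (suc q) (+-monoˡ-< (b * D) ρ<D)) (≤-reflexive (swapped (suc b) D (suc q)))))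

one-minus : ∀ n q → toℚᵘ ((1ℚ ℚ.- (+ 1) ℚ./ suc q) ℚ.* fromℕ n) ℚᵘ.≃ mkℚᵘ (+ (q * n)) q
one-minus n q = ℚᵘₚ.≃-trans (ℚₚ.toℚᵘ-homo-* (1ℚ ℚ.- y) (fromℕ n)) (ℚᵘₚ.≃-trans
    (ℚᵘₚ.*-cong (ℚᵘₚ.≃-trans (ℚₚ.toℚᵘ-homo-+ 1ℚ (ℚ.- y)) (ℚᵘₚ.+-congʳ (toℚᵘ 1ℚ) (ℚᵘₚ.≃-trans (ℚₚ.toℚᵘ-homo‿- y) (ℚᵘₚ.-‿cong (toℚᵘ-/ 1 (suc q)))))) (toℚᵘ-/ n 1))
    (ℚᵘ.*≡* evaluate))
  where
  y = (+ 1) ℚ./ suc q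
  X = (mkℚᵘ (+ 1) 0 ℚᵘ.+ ℚᵘ.- mkℚᵘ (+ 1) q) ℚᵘ.* mkℚᵘ (+ n) 0
  numerator : ∀ x n → (ℤ.1ℤ ℤ.* (ℤ.1ℤ ℤ.+ x) ℤ.+ ℤ.- ℤ.1ℤ ℤ.* ℤ.1ℤ) ℤ.* n ≡ x ℤ.* n
  numerator = ℤ-Solver.solve-∀
  evaluate : ℚᵘ.↥ X ℤ.* + suc q ≡ + (q * n) ℤ.* ℚᵘ.↧ X
  evaluate = cong₂ ℤ._*_ (trans (numerator (+ q) (+ n)) (sym (ℤₚ.pos-* q n)))
    (cong +_ (sym (trans (*-identityʳ (suc (q + 0))) (cong suc (+-identityʳ q)))))

half-bound : ∀ q n b → 4 ≤ suc q → 2 ≤ n → q * n < suc b * suc q → n ≤ 2 * b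
half-bound 0 n b (s≤s ()) n≥2 h
half-bound 1 n b (s≤s (s≤s ())) n≥2 h
half-bound 2 n b (s≤s (s≤s (s≤s ()))) n≥2 h
half-bound (suc (suc (suc x))) n b _ n≥2 h = ≮⇒≥ λ 2b<n → <-irrefl refl (begin-strict
  (4 + x) * n + (4 + x)          ≤⟨ +-monoʳ-≤ ((4 + x) * n) (≤-trans (m≤m+n (4 + x) x) (≤-trans (≤-reflexive (a₁ x)) (*-monoʳ-≤ (2 + x) n≥2))) ⟩
  (4 + x) * n + (2 + x) * n      ≡⟨ a₂ x n ⟩
  2 * ((3 + x) * n)              <⟨ *-monoʳ-< 2 h ⟩
  2 * (suc b * (4 + x))          ≡⟨ a₃ x b ⟩
  (4 + x) * (suc (2 * b)) + (4 + x) ≤⟨ +-monoˡ-≤ (4 + x) (*-monoʳ-≤ (4 + x) 2b<n) ⟩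
  (4 + x) * n + (4 + x)          ∎)
  where
  open ≤-Reasoning
  a₁ : ∀ x → 4 + x + x ≡ (2 + x) * 2
  a₁ = solve-∀
  a₂ : ∀ x n → (4 + x) * n + (2 + x) * n ≡ 2 * ((3 + x) * n)
  a₂ = solve-∀
  a₃ : ∀ x b → 2 * (suc b * (4 + x)) ≡ (4 + x) * (suc (2 * b)) + (4 + x)
  a₃ = solve-∀

module _ {k n : ℕ} (H : Hypergraph k n) (B : Subset n) where

  open EdgeWords H

  #inB #outB : ℕ
  #inB  = ∑ (allFin n) (λ v → χ (InB? B v))
  #outB = ∑ (allFin n) (λ v → χ (¬? (InB? B v)))

  #inB≡ : #inB ≡ ∣ B ∣
  #inB≡ = sym (trans (card-∑ B) (∑-cong (allFin n) (λ v → ≤-antisym (χ-mono (v Subₚ.∈? B) (InB? B v) id) (χ-mono (InB? B v) (v Subₚ.∈? B) id))))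

  partition : #outB + #inB ≡ n
  partition = trans (sym (∑-+ (allFin n) _ _)) (trans (∑-cong (allFin n) (λ v → one (InB? B v))) (trans (∑V-const 1) (*-identityʳ n)))
    where
    one : ∀ {P : Set} (b : Dec P) → χ (¬? b) + χ b ≡ 1
    one (yes _) = refl
    one (no _)  = refl

  -- Both bounds on the size of the complement of B come from the definition of the floor.
  module Sizes (d t m b : ℕ) (d≥2 : 2 ≤ d) (n≡ : n ≡ m * d) (n≥2 : 2 ≤ n) (b≡ : ∣ B ∣ ≡ b) where

    s q′ : ℕ
    s = suc (suc t)
    q′ = pred (s * d)

    q≡ : suc q′ ≡ s * d
    q≡ = suc-pred (s * d) {{>-nonZero (≤-trans (≤-trans z<s d≥2) (m≤m+n d _))}}

    module _ (lo : b * suc q′ ≤ q′ * n) (hi : q′ * n < suc b * suc q′) where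

      total : suc q′ * #outB + suc q′ * b ≡ n + q′ * n
      total = trans (sym (*-distribˡ-+ (suc q′) #outB b)) (cong (suc q′ *_) (trans (cong (λ z → #outB + z) (sym (trans #inB≡ b≡))) partition))

      n≤ : n ≤ suc q′ * #outB
      n≤ = +-cancelʳ-≤ (suc q′ * b) _ _ (≤-trans (+-monoʳ-≤ n (≤-trans (≤-reflexive (*-comm (suc q′) b)) lo)) (≤-reflexive (sym total)))

      <n+q : suc q′ * #outB < n + suc q′
      <n+q = +-cancelʳ-< (suc q′ * b) _ _ (≤-<-trans (≤-reflexive total) (<-≤-trans (+-monoʳ-< n hi) (≤-reflexive (arith n (suc q′) b))))
        where
        arith : ∀ n q b → n + suc b * q ≡ n + q + q * b
        arith = solve-∀

      sd : ∀ x → suc q′ * x ≡ s * x * d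
      sd x = trans (cong (_* x) q≡) (arith s d x)
        where
        arith : ∀ s d x → s * d * x ≡ s * x * d
        arith = solve-∀

      instance
        d≢0 : NonZero d
        d≢0 = >-nonZero (≤-trans z<s d≥2)

      m≤s#out : m ≤ s * #outB
      m≤s#out = *-cancelʳ-≤ m (s * #outB) d (≤-trans (≤-reflexive (sym n≡)) (≤-trans n≤ (≤-reflexive (sd #outB))))

      s#out≤ : s * #outB ≤ m + s
      s#out≤ = *-cancelʳ-≤ (s * #outB) (m + s) d (≤-trans (≤-reflexive (sym (sd #outB))) (≤-trans (<⇒≤ <n+q)
        (≤-reflexive (trans (cong₂ _+_ n≡ q≡) (sym (*-distribʳ-+ d m s))))))

      out≤ : ∀ δ → n ≤ δ * suc q′ → #outB ≤ δ
      out≤ δ h = ≤-pred (*-cancelˡ-< (suc q′) _ _ (<-≤-trans <n+q (≤-trans (+-monoˡ-≤ (suc q′) h) (≤-reflexive (arith δ (suc q′))))))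
        where
        arith : ∀ δ q → δ * q + q ≡ q * suc δ
        arith = solve-∀

      n≤2#in : n ≤ 2 * #inB
      n≤2#in = ≤-trans (half-bound q′ n b (≤-trans (*-mono-≤ (m≤m+n 2 t) d≥2) (≤-reflexive (sym q≡))) n≥2 hi) (≤-reflexive (cong (2 *_) (sym (trans #inB≡ b≡))))

ceiling≡ : ∀ k {d} d′ t r .{{_ : NonZero d}} → d ≡ suc d′ → 0 < r → r ≤ d′ → k ≡ suc t * suc d′ + r → ⌈ k / d ⌉ ≡ suc (suc t)
ceiling≡ k d′ t (suc r) refl _ r<d k≡ = begin
  (k + d′) / suc d′                         ≡⟨ cong (_/ suc d′) (trans (cong (_+ d′) k≡) (arith t d′ r)) ⟩
  (r + suc (suc t) * suc d′) / suc d′       ≡⟨ +-distrib-/-∣ʳ r (divides-refl (suc (suc t))) ⟩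
  r / suc d′ + suc (suc t) * suc d′ / suc d′ ≡⟨ cong₂ _+_ (m<n⇒m/n≡0 (<-trans r<d (n<1+n d′))) (m*n/n≡m (suc (suc t)) (suc d′)) ⟩
  suc (suc t)                               ∎
  where
  open ≡-Reasoning
  arith : ∀ t d r → suc t * suc d + suc r + d ≡ r + suc (suc t) * suc d
  arith = solve-∀

record Division (k d : ℕ) : Set where
  field
    d′ t r : ℕ
    d≡     : d ≡ suc d′
    r>0    : 0 < r
    r≤d′   : r ≤ d′
    k≡     : k ≡ suc t * suc d′ + r

division : ∀ k d → 0 < d → d ≤ k → d ∤ k → Division k d
division k (suc d′) _ d≤k d∤k = byQuotient (k / suc d′) (k % suc d′) (m≡m%n+[m/n]*n k (suc d′)) (m%n<n k (suc d′)) (λ e → d∤k (m%n≡0⇒n∣m k (suc d′) e))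
  where
  byQuotient : ∀ q r → k ≡ r + q * suc d′ → r < suc d′ → r ≢ 0 → Division k (suc d′)
  byQuotient zero r k≡ r< r≢0 = contradiction (≤-<-trans d≤k (≤-<-trans (≤-reflexive (trans k≡ (+-identityʳ r))) r<)) (<-irrefl refl)
  byQuotient (suc t) r k≡ r< r≢0 = record { d′ = d′ ; t = t ; r = r ; d≡ = refl ; r>0 = n≢0⇒n>0 r≢0 ; r≤d′ = ≤-pred r< ; k≡ = trans k≡ (+-comm r _) }

floor-sizes : ∀ {q q′} n b .{{_ : NonZero q}} → q ≡ suc q′ → + b ≡ floor ((1ℚ ℚ.- (+ 1) ℚ./ q) ℚ.* fromℕ n) → b * suc q′ ≤ q′ * n × q′ * n < suc b * suc q′
floor-sizes {q′ = q′} n b refl h = floor-bounds _ (one-minus n q′) h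

K : ℕ → ℕ → ℕ → ℕ
K k d′ t = Numbers.κ k d′ t 0 * k ^ k

Δ : ℕ → ℚ
Δ K = (+ 1) ℚ./ suc K

Δ>0 : ∀ K → 0ℚ ℚ.< Δ K
Δ>0 K = ℚₚ.toℚᵘ-cancel-< (ℚᵘₚ.<-respʳ-≃ (ℚᵘₚ.≃-sym (toℚᵘ-/ 1 (suc K))) (ℚᵘ.*<* (ℤ.+<+ (s≤s z≤n))))

≤-drop-/ : ∀ {p q} a → p ℚ.+ (+ a) ℚ./ 2 ℚ.≤ q → p ℚ.≤ q
≤-drop-/ {p} a h = ℚₚ.≤-trans (subst (ℚ._≤ p ℚ.+ (+ a) ℚ./ 2) (ℚₚ.+-identityʳ p) (ℚₚ.+-monoʳ-≤ p nonneg)) h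
  where
  nonneg : 0ℚ ℚ.≤ (+ a) ℚ./ 2
  nonneg = ℚₚ.toℚᵘ-cancel-≤ (ℚᵘₚ.≤-respʳ-≃ (ℚᵘₚ.≃-sym (toℚᵘ-/ a 2)) (ℚᵘ.*≤* (subst (λ z → ℤ.0ℤ ℤ.≤ z) (sym (ℤₚ.*-identityʳ (+ a))) (ℤ.+≤+ z≤n))))

strict : ∀ K e {N} → 0 < N → suc K * e ≤ N → K * e < N
strict K zero {N} N>0 h = subst (_< N) (sym (*-zeroʳ K)) N>0
strict K (suc e)  N>0 h = <-≤-trans (m<n+m (K * suc e) z<s) h

theorem1p7 : ∀ (k ℓ : ℕ) → 3 ≤ k → k < 2 * ℓ → (ℓ<k : ℓ < k) → (k ∸ ℓ) ∤ k →
    let open Parameters ℓ<k in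
    Σ[ Δ ∈ ℚ ] (0ℚ ℚ.< Δ) × (Σ[ n₀ ∈ ℕ ]
    (∀ n → n₀ ≤ n → (k ∸ ℓ) ∣ n → (H : Hypergraph k n) →
    Extremal Δ H →
    ((4 * ℓ < 3 * k) × (n /s[k-ℓ] ℚ.≤ fromℕ (minCodegree H)))
    ⊎ ((n /s[k-ℓ] ℚ.+ (+ (k ^ 2)) ℚ./ 2) ℚ.≤ fromℕ (minCodegree H)) →
    HasHamiltonCycle ℓ H))
theorem1p7 k ℓ k≥3 k<2ℓ ℓ<k ∤k = Δ (K k d′ t) , Δ>0 (K k d′ t) , Numbers.n₀ k d′ t , cycle
  where
  open Parameters ℓ<k
  open Division (division k (k ∸ ℓ) (m<n⇒0<n∸m ℓ<k) (m∸n≤m k ℓ) ∤k)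
  k-ℓ≢0 : NonZero (k ∸ ℓ)
  k-ℓ≢0 = >-nonZero (m<n⇒0<n∸m ℓ<k)
  k>1 : 1 < k
  k>1 = ≤-trans (s≤s (s≤s z≤n)) k≥3
  d≥2 : 2 ≤ suc d′
  d≥2 = s≤s (≤-trans r>0 r≤d′)
  cycle : ∀ n → Numbers.n₀ k d′ t ≤ n → (k ∸ ℓ) ∣ n → (H : Hypergraph k n) → Extremal (Δ (K k d′ t)) H →
          ((4 * ℓ < 3 * k) × (n /s[k-ℓ] ℚ.≤ fromℕ (minCodegree H)))
          ⊎ ((n /s[k-ℓ] ℚ.+ (+ (k ^ 2)) ℚ./ 2) ℚ.≤ fromℕ (minCodegree H)) → HasHamiltonCycle ℓ H
  cycle n hn (divides m n≡) H (B , size , few) degree = subst (λ x → HasHamiltonCycle x H) (trans (cong (k ∸_) (sym d≡)) (m∸[m∸n]≡n (<⇒≤ ℓ<k)))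
      (NiceWords.Codegree.Blocks.Construct.hamilton H B (Numbers.κ k d′ t) (Numbers.κ-mono k d′ t) (≤-trans (s≤s z≤n) n≥2) k>1
        (Sz.out≤ lo hi (minCodegree H) (≤-trans δ-bound (≤-reflexive (cong (minCodegree H *_) sizes)))) d′ t r r>0 r≤d′ k≡ (Numbers.hierarchy k d′ t k>1) hn
        sparse (Sz.n≤2#in lo hi) m n≡′ (Sz.m≤s#out lo hi) (Sz.s#out≤ lo hi))
    where
    n≡′ : n ≡ m * suc d′
    n≡′ = trans n≡ (cong (m *_) d≡)
    n≥2 : 2 ≤ n
    n≥2 = ≤-trans (≤-trans (+-mono-≤ (<⇒≤ k>1) (<⇒≤ k>1)) (Numbers.n₈≤n₀ k d′ t)) hn
    module Sz = Sizes H B (suc d′) t m ∣ B ∣ d≥2 n≡′ n≥2 refl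
    sizes : s * (k ∸ ℓ) ≡ suc Sz.q′
    sizes = trans (cong₂ _*_ (ceiling≡ k d′ t r {{k-ℓ≢0}} d≡ r>0 r≤d′ k≡) d≡) (sym Sz.q≡)
    s[k-ℓ]≢0 : NonZero (s * (k ∸ ℓ))
    s[k-ℓ]≢0 = >-nonZero (subst (0 <_) (sym sizes) z<s)
    bounds : ∣ B ∣ * suc Sz.q′ ≤ Sz.q′ * n × Sz.q′ * n < suc ∣ B ∣ * suc Sz.q′
    bounds = floor-sizes n ∣ B ∣ {{s[k-ℓ]≢0}} sizes size
    lo = proj₁ bounds
    hi = proj₂ bounds
    δ-bound : n ≤ minCodegree H * (s * (k ∸ ℓ))
    δ-bound = by degree
      where
      by : ((4 * ℓ < 3 * k) × (n /s[k-ℓ] ℚ.≤ fromℕ (minCodegree H))) ⊎ ((n /s[k-ℓ] ℚ.+ (+ (k ^ 2)) ℚ./ 2) ℚ.≤ fromℕ (minCodegree H)) → n ≤ minCodegree H * (s * (k ∸ ℓ))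
      by (inj₁ (_ , h)) = /≤fromℕ {n} {minCodegree H} (s * (k ∸ ℓ)) {{s[k-ℓ]≢0}} h
      by (inj₂ h) = /≤fromℕ {n} {minCodegree H} (s * (k ∸ ℓ)) {{s[k-ℓ]≢0}} (≤-drop-/ (k ^ 2) h)
    sparse : Numbers.κ k d′ t 0 * (k ^ k * e H B) < n ^ k
    sparse = ≤-<-trans (≤-reflexive (sym (*-assoc (Numbers.κ k d′ t 0) (k ^ k) (e H B))))
      (strict (K k d′ t) (e H B) (m^n>0 n {{>-nonZero (≤-trans (s≤s z≤n) n≥2)}} k) (fromℕ≤/* (K k d′ t) few))
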